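{- There is an absolute constant $c$ such that for all $\varepsilon,\delta,p\in(0,1)$, $$S(\varepsilon,\delta,p) \le \mathrm{twr}_{1/\varepsilon}\big(c\log(1/p)/\delta^2\big).$$ In particular, for every fixed $C,\delta_0>0$ we have $S(p^C,\delta_0,p) \le \mathrm{twr}(O(\log(1/p)))$.
   Context: For a graph $G$ on vertex set $V$, its density is $d_G=2|E(G)|/|V|^2$; for vertex sets $A,B$, $d_G(A,B)=e_G(A,B)/(|A||B|)$ where $e_G(A,B)$ counts ordered pairs $(u,v)\in A\times B$ with $uv\in E(G)$. A pair $(A,B)$ is $\varepsilon$-regular if $|d_G(A,B)-d_G(A',B')|\le\varepsilon$ for all $A'\subseteq A,B'\subseteq B$ with $|A'|\ge\varepsilon|A|,|B'|\ge\varepsilon|B|$. An equipartition is a partition whose part sizes differ by at most $1$; its order is its number of parts; an equipartition $\{Z_1,\dots,Z_k\}$ is $\varepsilon$-regular if all but at most $\varepsilon k^2$ pairs $(Z_i,Z_j)$ are $\varepsilon$-regular. $S(\varepsilon,\delta,p)$ is the smallest integer $S$ such that whenever $G$ has density at least $p$ and $\mathcal P_0$ is an equipartition of $V(G)$ of order at most $1/\varepsilon$, one can add/remove at most $\delta|E(G)|$ edges so that the resulting graph has an $\varepsilon$-regular equipartition refining $\mathcal P_0$ of order at most $S$. $\mathrm{twr}_y(x)$ denotes a tower of $x$ exponents (of base 2) with $y$ at the top, i.e. $\mathrm{twr}_y(0)=y$ and $\mathrm{twr}_y(x+1)=2^{\mathrm{twr}_y(x)}$ (non-integer heights rounded up),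 and $\mathrm{twr}(x)=\mathrm{twr}_1(x)$ is a tower of 2's of height $x$.
   Formalization: The parameters ε, δ, p range over the rationals in (0,1) instead of the reals, and the immediate consequence S(p^C, δ₀, p) ≤ twr(O(log(1/p))) is not stated separately. -}

module Defs where

open import Data.Bool using (Bool; true; false; T; _∧_; _xor_; if_then_else_)
open import Data.Nat as ℕ using (ℕ; zero; suc; ⌊_/2⌋)
open import Data.Integer as ℤ using (ℤ; +_; -[1+_])
open import Data.Fin using (Fin; zero; suc; _≟_)
open import Data.Rational
  using (ℚ; 0ℚ; 1ℚ; _/_; _*_; _-_; _≤_; _<_; ∣_∣; ↥_; ↧ₙ_; 1/_; positive)
open import Data.Rational.Properties using (pos⇒nonZero)
open import Data.Product using (Σ; _×_; _,_)
open import Data.Sum using (_⊎_)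
open import Relation.Binary.PropositionalEquality using (_≡_)
open import Relation.Nullary.Decidable using (⌊_⌋)

ℕ→ℚ : ℕ → ℚ
ℕ→ℚ n = + n / 1

-- a / b as a rational (convention: a / 0 = 0; only used with b > 0)
frac : ℕ → ℕ → ℚ
frac a zero    = 0ℚ
frac a (suc b) = + a / suc b

inv : (q : ℚ) → 0ℚ < q → ℚ
inv q 0<q = (1/ q) {{pos⇒nonZero q {{positive 0<q}}}}

_^ℚ_ : ℚ → ℕ → ℚ
r ^ℚ zero  = 1ℚ
r ^ℚ suc k = r * (r ^ℚ k)

2^ : ℕ → ℚ
2^ k = ℕ→ℚ (2 ℕ.^ k)

-- For r > 0 and rational s = a/b:  r ≤ 2^s  (i.e. log₂ r ≤ s)
Log2≤ : ℚ → ℚ → Set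
Log2≤ r s with ↥ s
... | + a      = (r ^ℚ (↧ₙ s)) ≤ 2^ a
... | -[1+ a ] = ((r ^ℚ (↧ₙ s)) * 2^ (suc a)) ≤ 1ℚ

-- For r > 0 and rational s = a/b:  2^s < r  (i.e. s < log₂ r)
Log2> : ℚ → ℚ → Set
Log2> r s with ↥ s
... | + a      = 2^ a < (r ^ℚ (↧ₙ s))
... | -[1+ a ] = 1ℚ < ((r ^ℚ (↧ₙ s)) * 2^ (suc a))

-- Real-valued towers, described exactly via rational lower cuts.
-- twr_y(0) = y,  twr_y(h+1) = 2^{twr_y(h)}.
-- LtTwr r y h  ⇔  r < twr_y(h)   (for rational r, y).
-- Using density of ℚ:  r < 2^T  ⇔  r ≤ 0  or  ∃ s ∈ ℚ. log₂ r ≤ s < T.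

LtTwr : ℚ → ℚ → ℕ → Set
LtTwr r y zero    = r < y
LtTwr r y (suc h) = (r ≤ 0ℚ) ⊎ Σ ℚ (λ s → (0ℚ < r) × Log2≤ r s × LtTwr s y h)

_≤twr[_]_ : ℕ → ℚ → ℕ → Set
N ≤twr[ y ] h = (r : ℚ) → r < ℕ→ℚ N → LtTwr r y h

record Graph (n : ℕ) : Set where
  field
    adj   : Fin n → Fin n → Bool
    sym   : ∀ u v → adj u v ≡ adj v u
    irrefl : ∀ u → adj u u ≡ false
open Graph public

count : ∀ {n} → (Fin n → Bool) → ℕ
count {zero}  P = 0
count {suc n} P = (if P zero then 1 else 0) ℕ.+ count (λ i → P (suc i))

sumF : ∀ {n} → (Fin n → ℕ) → ℕ
sumF {zero}  f = 0
sumF {suc n} f = f zero ℕ.+ sumF (λ i → f (suc i))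

VSet : ℕ → Set
VSet n = Fin n → Bool

∣_∣ˢ : ∀ {n} → VSet n → ℕ
∣ A ∣ˢ = count A

_⊆ˢ_ : ∀ {n} → VSet n → VSet n → Set
A ⊆ˢ B = ∀ v → T (A v) → T (B v)

e : ∀ {n} → Graph n → VSet n → VSet n → ℕ
e G A B = sumF (λ u → count (λ v → A u ∧ B v ∧ adj G u v))

twiceEdges : ∀ {n} → Graph n → ℕ
twiceEdges G = e G (λ _ → true) (λ _ → true)

edges : ∀ {n} → Graph n → ℕ
edges G = ⌊ twiceEdges G /2⌋

density : ∀ {n} → Graph n → ℚ
density {n} G = frac (twiceEdges G) (n ℕ.* n)

pairDensity : ∀ {n} → Graph n → VSet n → VSet n → ℚ
pairDensity G A B = frac (e G A B) (∣ A ∣ˢ ℕ.* ∣ B ∣ˢ)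

editDistance : ∀ {n} → Graph n → Graph n → ℕ
editDistance G H =
  ⌊ sumF (λ u → count (λ v → adj G u v xor adj H u v)) /2⌋

RegularPair : ∀ {n} → ℚ → Graph n → VSet n → VSet n → Set
RegularPair {n} ε G A B =
  (A' B' : VSet n) → A' ⊆ˢ A → B' ⊆ˢ B →
  ε * ℕ→ℚ ∣ A ∣ˢ ≤ ℕ→ℚ ∣ A' ∣ˢ → ε * ℕ→ℚ ∣ B ∣ˢ ≤ ℕ→ℚ ∣ B' ∣ˢ →
  ∣ pairDensity G A B - pairDensity G A' B' ∣ ≤ ε

record Partition (n k : ℕ) : Set where
  field
    part     : Fin n → Fin k
    nonempty : ∀ (i : Fin k) → Σ (Fin n) (λ v → part v ≡ i)
open Partition public

Part : ∀ {n k} → Partition n k → Fin k → VSet n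
Part P i v = ⌊ part P v ≟ i ⌋

IsEquipartition : ∀ {n k} → Partition n k → Set
IsEquipartition P = ∀ i j → ∣ Part P i ∣ˢ ℕ.≤ suc ∣ Part P j ∣ˢ

Refines : ∀ {n k l} → Partition n l → Partition n k → Set
Refines {k = k} {l} Q P = Σ (Fin l → Fin k) (λ g → ∀ v → part P v ≡ g (part Q v))

-- ε-regular equipartition: all but at most ε k² (ordered) pairs (Z_i, Z_j)
-- are ε-regular.  Irregular pairs are counted via a decision-free
-- formulation: there is a set I of ordered index pairs with |I| ≤ ε k²
-- such that every pair outside I is ε-regular.
IsRegularPartition : ∀ {n k} → ℚ → Graph n → Partition n k → Set
IsRegularPartition {n} {k} ε G P =
  Σ (Fin k → Fin k → Bool) λ I →
    (ℕ→ℚ (sumF (λ i → count (λ j → I i j))) ≤ ε * ℕ→ℚ (k ℕ.* k)) ×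
    (∀ i j → I i j ≡ false → RegularPair ε G (Part P i) (Part P j))

Works : ℚ → ℚ → ℚ → ℕ → Set
Works ε δ p S =
  ∀ (n : ℕ) (G : Graph n) → p ≤ density G →
  ∀ (k₀ : ℕ) (P₀ : Partition n k₀) → IsEquipartition P₀ → ε * ℕ→ℚ k₀ ≤ 1ℚ →
  Σ (Graph n) λ G' →
    (ℕ→ℚ (editDistance G G') ≤ δ * ℕ→ℚ (edges G)) ×
    Σ ℕ λ k → (k ℕ.≤ S) × Σ (Partition n k) λ P →
      IsEquipartition P × Refines P P₀ × IsRegularPartition ε G' P

{-# OPTIONS --safe #-}
-- Write D_P(u, v) for the density of the block of u v in a partition P, d for the density of G and n
-- for its order. Refine P by Frieze–Kannan weak regularity to a colouring c with a single exponential
-- number of classes, such that the block-wise rescaled deviations of G from D_c have small cut norm.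
-- If D_c is close to D_P in L¹, rescale G on every block of c so that its density becomes D_P. The
-- resulting weighted graph is rounded to a graph by choosing row after row with signs that keep the
-- codegrees and the number of flips small; this graph is close to D_P in cut norm, so every pair of parts
-- of P is ε-regular in it, at a cost of at most δ |E| edits.
-- Otherwise an equitable refinement of P that almost refines c increases a convex potential: a sum over
-- the dyadic scales t from 1 to d of Huber functions, whose curvature 1 / max(x, d) makes every step gain
-- of order δ² d n² while the total range is of order d log(1/d) n². Thus O(log(1/p) / δ²) steps suffice, and
-- each of them costs two exponentials. When log(1/p) is small compared with δ, the graph is so dense that
-- it can be completed; when n is at most the bound, the partition into singletons works.

module Submission where

open import Defs hiding (sym)
open import Data.Nat using (ℕ; suc)
open import Data.Rational using (ℚ; 0ℚ; 1ℚ; _*_; _<_)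
open import Data.Product using (Σ; _×_)

open import Algebra.Bundles using (CommutativeRing)
open import Data.Bool using (Bool; true; false; T; _∧_; _xor_; if_then_else_; not)
open import Data.Empty using (⊥-elim)
open import Data.Fin as Fin using (Fin; zero; suc)
open import Data.Fin.Properties
  using (combine-injectiveˡ; combine-injectiveʳ; combine-surjective; remQuot-combine; any?)
open import Data.Fin.Subset.Properties using (anySubset?)
open import Data.Integer as ℤ using (ℤ; -[1+_])
import Data.Integer.Properties as ℤᵖ
open import Data.Nat as ℕ using (zero; z≤n; s≤s)
import Data.Nat.Coprimality as Cop
import Data.Nat.Divisibility as Div
open import Data.Nat.Divisibility using (∣m+n∣m⇒∣n; ∣1⇒≡1; ∣n⇒∣m*n)
open import Data.Nat.DivMod
  using (m≥n⇒m/n>0; m/n*n≤m; m≡m%n+[m/n]*n; m%n<n; /-monoˡ-≤)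
import Data.Nat.Properties as ℕᵖ
open import Data.Nat.Tactic.RingSolver using () renaming (solve-∀ to ℕ-solve-∀)
open import Data.Product using (_,_; proj₁; proj₂)
open import Data.Rational as ℚ
  using (mkℚ; _/_; _+_; _-_; -_; _≤_; ∣_∣; *≤*; *<*; _⊓_)
open import Data.Rational.Properties as ℚᵖ
  using (+-*-commutativeRing; ≤-refl; ≤-trans; ≤-reflexive; <⇒≤; _≤?_; _<?_; *-assoc;
    *-cancelˡ-≤-pos; *-comm; *-distribˡ-+; *-identityʳ; *-identityˡ; *-inverseʳ; *-inverseˡ;
    *-monoʳ-<-pos; *-monoʳ-≤-nonNeg; *-monoˡ-<-pos; *-monoˡ-≤-nonNeg; *-zeroʳ; *-zeroˡ;
    +-assoc; +-identityʳ; +-identityˡ; +-inverseʳ; +-mono-≤; +-mono-≤-<; +-monoʳ-<; +-monoʳ-≤;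
    +-monoˡ-<; +-monoˡ-≤; 0≤p⇒∣p∣≡p; 0≤∣p∣; 1/pos⇒pos; <-cmp; <-irrefl; <-trans; <-≤-trans;
    neg-antimono-≤; nonNegative⁻¹; normalize-coprime; normalize-nonNeg; positive⁻¹;
    pos⇒nonZero; p≤p⊔q; p≤q⇒p⊓q≡p; p≤q⊔p; p≥q⇒p⊓q≡q; p⊓q≤p; p⊓q≤q; toℚᵘ-fromℚᵘ; toℚᵘ-homo-*;
    toℚᵘ-injective; ↥p/↧p≡p; ∣-p∣≡∣p∣; ∣p*q∣≡∣p∣*∣q∣; ∣p+q∣≤∣p∣+∣q∣; ∣p-q∣≤∣p∣+∣q∣;
    ∣p∣≡p∨∣p∣≡-p; ≤-<-trans; ≤-antisym; ≤-total; ≮⇒≥; ≰⇒>; ⊓-glb; ⊔-lub)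
import Data.Rational.Unnormalised as ℚᵘ
import Data.Rational.Unnormalised.Properties as ℚᵘᵖ
open import Data.Sum as Sum using (_⊎_; inj₁; inj₂)
open import Data.Unit using (tt)
open import Data.Vec using (lookup; tabulate)
open import Data.Vec.Properties using (lookup∘tabulate)
open import Function using (_∘_; id)
import Relation.Binary.Definitions as Tri
open import Relation.Binary.PropositionalEquality
  using (_≡_; _≢_; refl; trans; cong; cong₂; sym; subst; subst₂; module ≡-Reasoning)
open import Relation.Nullary using (¬_; yes; no)
open import Relation.Nullary.Decidable using (⌊_⌋; dec⇒maybe)
open import Tactic.RingSolver using (solve-∀)
open import Tactic.RingSolver.Core.AlmostCommutativeRing
  using (AlmostCommutativeRing; fromCommutativeRing)
open import Algebra.Properties.Semiring.Sum (CommutativeRing.semiring +-*-commutativeRing)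
  using (sum; sum-cong-≗; ∑-distrib-+; ∑-comm; *-distribˡ-sum)

-- The obstacle is sparseness. With the energy Σ D² a step that moves D by δ d n² in L¹ gains only
-- about δ² d² n², out of a range of order d n²; this would allow about 1 / (δ² d) steps. A
-- potential of curvature about 1 / x gains a factor 1 / d per step, while its range grows only by
-- the factor log(1/d). The natural candidate is x log x; the sum of Huber functions imitates it
-- with rational values, so that every estimate becomes a polynomial inequality. Closeness in L¹ is
-- the right alternative because rescaling a block only deletes or only adds edges: the fractional
-- number of edits is then exactly Σ |D_c - D_P|, while the deviations of G from D_c, which may be
-- far larger than δ d n², cost nothing. Rounding is usually a random choice with a concentration
-- bound. Here the second moments of the codegrees and of the signed number of flips are bounded by
-- a deterministic greedy choice, which needs only finite sums of rationals.

ℚ-ring : AlmostCommutativeRing _ _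
ℚ-ring = fromCommutativeRing +-*-commutativeRing (λ x → dec⇒maybe (0ℚ ℚ.≟ x))

-- Ordered field arithmetic

2ℚ : ℚ
2ℚ = 1ℚ + 1ℚ

module _ {a b : ℚ} where
  ≤⇒0≤- : a ≤ b → 0ℚ ≤ b - a
  ≤⇒0≤- a≤b = subst (_≤ b - a) (+-inverseʳ a) (+-monoˡ-≤ (- a) a≤b)

  <⇒0<- : a < b → 0ℚ < b - a
  <⇒0<- a<b = subst (_< b - a) (+-inverseʳ a) (+-monoˡ-< (- a) a<b)

<⇒≱ : ∀ {a b} → a < b → ¬ (b ≤ a)
<⇒≱ a<b b≤a = <-irrefl refl (<-≤-trans a<b b≤a)

private
  cancel : ∀ a b → b - a + a ≡ b
  cancel = solve-∀ ℚ-ring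

-- Reduces an inequality to a certificate: a visibly nonnegative expression and a polynomial
-- identity, which the ring solver checks. Most estimates below have this form, with the certificate
-- as the first argument.
≤-by : ∀ {a b d} → 0ℚ ≤ d → d ≡ b - a → a ≤ b
≤-by {a} {b} 0≤d refl =
  subst₂ _≤_ (+-identityˡ a) (cancel a b) (+-monoˡ-≤ a 0≤d)

<-by : ∀ {a b d} → 0ℚ < d → d ≡ b - a → a < b
<-by {a} {b} 0<d refl =
  subst₂ _<_ (+-identityˡ a) (cancel a b) (+-monoˡ-< a 0<d)

0≤+ : ∀ {a b} → 0ℚ ≤ a → 0ℚ ≤ b → 0ℚ ≤ a + b
0≤+ = +-mono-≤

*-monoʳ : ∀ {a b c} → 0ℚ ≤ c → a ≤ b → c * a ≤ c * b
*-monoʳ {c = c} 0≤c = *-monoˡ-≤-nonNeg c {{ℚ.nonNegative 0≤c}}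

*-monoˡ : ∀ {a b c} → 0ℚ ≤ c → a ≤ b → a * c ≤ b * c
*-monoˡ {c = c} 0≤c = *-monoʳ-≤-nonNeg c {{ℚ.nonNegative 0≤c}}

0≤* : ∀ {a b} → 0ℚ ≤ a → 0ℚ ≤ b → 0ℚ ≤ a * b
0≤* {a} {b} 0≤a 0≤b = subst (_≤ a * b) (*-zeroʳ a) (*-monoʳ 0≤a 0≤b)

0<* : ∀ {a b} → 0ℚ < a → 0ℚ < b → 0ℚ < a * b
0<* {a} {b} 0<a 0<b =
  subst (_< a * b) (*-zeroʳ a) (*-monoʳ-<-pos a {{ℚ.positive 0<a}} 0<b)

*-mono : ∀ {a b c d} → 0ℚ ≤ a → 0ℚ ≤ d → a ≤ b → c ≤ d → a * c ≤ b * d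
*-mono 0≤a 0≤d a≤b c≤d = ≤-trans (*-monoʳ 0≤a c≤d) (*-monoˡ 0≤d a≤b)

*-cancelˡ : ∀ {a b c} → 0ℚ < c → c * a ≤ c * b → a ≤ b
*-cancelˡ {c = c} 0<c = *-cancelˡ-≤-pos c {{ℚ.positive 0<c}}

*-mono-< : ∀ {a b c} → 0ℚ < c → a < b → c * a < c * b
*-mono-< {c = c} 0<c = *-monoʳ-<-pos c {{ℚ.positive 0<c}}

neg-≤ : ∀ {a} → a ≤ 0ℚ → 0ℚ ≤ - a
neg-≤ = neg-antimono-≤

0≤² : ∀ a → 0ℚ ≤ a * a
0≤² a with ≤-total 0ℚ a
... | inj₁ 0≤a = 0≤* 0≤a 0≤a
... | inj₂ a≤0 = subst (0ℚ ≤_) (lemma a) (0≤* (neg-≤ a≤0) (neg-≤ a≤0))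
  where
  lemma : ∀ a → (- a) * (- a) ≡ a * a
  lemma = solve-∀ ℚ-ring

x≤∣x∣ : ∀ x → x ≤ ∣ x ∣
x≤∣x∣ x with ≤-total 0ℚ x
... | inj₁ 0≤x = ≤-reflexive (sym (0≤p⇒∣p∣≡p 0≤x))
... | inj₂ x≤0 = ≤-trans x≤0 (0≤∣p∣ x)

-x≤∣x∣ : ∀ x → - x ≤ ∣ x ∣
-x≤∣x∣ x = subst (- x ≤_) (∣-p∣≡∣p∣ x) (x≤∣x∣ (- x))

∣∣≤ : ∀ {x b} → x ≤ b → - x ≤ b → ∣ x ∣ ≤ b
∣∣≤ {x} x≤b -x≤b with ∣p∣≡p∨∣p∣≡-p x
... | inj₁ eq = subst (_≤ _) (sym eq) x≤b
... | inj₂ eq = subst (_≤ _) (sym eq) -x≤b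

-- Natural numbers inside ℚ

ℕ→ℚ-def : ∀ n → ℕ→ℚ n ≡ mkℚ (ℤ.+ n) 0 (Cop.sym (Cop.1-coprimeTo n))
ℕ→ℚ-def n = normalize-coprime (Cop.sym (Cop.1-coprimeTo n))

ℕ→ℚ-+ : ∀ a b → ℕ→ℚ (a ℕ.+ b) ≡ ℕ→ℚ a + ℕ→ℚ b
ℕ→ℚ-+ a b rewrite ℕ→ℚ-def a | ℕ→ℚ-def b =
  cong (λ z → z / 1) (cong₂ ℤ._+_ (sym (ℤᵖ.*-identityʳ (ℤ.+ a))) (sym (ℤᵖ.*-identityʳ (ℤ.+ b))))

ℕ→ℚ-* : ∀ a b → ℕ→ℚ (a ℕ.* b) ≡ ℕ→ℚ a * ℕ→ℚ b
ℕ→ℚ-* a b rewrite ℕ→ℚ-def a | ℕ→ℚ-def b = cong (_/ 1) (ℤᵖ.pos-* a b)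

ℕ→ℚ-mono : ∀ {a b} → a ℕ.≤ b → ℕ→ℚ a ≤ ℕ→ℚ b
ℕ→ℚ-mono {a} {b} a≤b rewrite ℕ→ℚ-def a | ℕ→ℚ-def b =
  *≤* (ℤᵖ.*-monoʳ-≤-nonNeg (ℤ.+ 1) (ℤ.+≤+ a≤b))

ℕ→ℚ-mono-< : ∀ {a b} → a ℕ.< b → ℕ→ℚ a < ℕ→ℚ b
ℕ→ℚ-mono-< {a} {b} a<b rewrite ℕ→ℚ-def a | ℕ→ℚ-def b =
  *<* (ℤᵖ.*-monoʳ-<-pos (ℤ.+ 1) (ℤ.+<+ a<b))

0≤ℕ : ∀ n → 0ℚ ≤ ℕ→ℚ n
0≤ℕ n = ℕ→ℚ-mono (z≤n {n})

0<ℕ : ∀ {n} → 0 ℕ.< n → 0ℚ < ℕ→ℚ n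
0<ℕ = ℕ→ℚ-mono-<

ℕ→ℚ-suc : ∀ n → ℕ→ℚ (suc n) ≡ 1ℚ + ℕ→ℚ n
ℕ→ℚ-suc = ℕ→ℚ-+ 1

ℕ→ℚ-cancel-≤ : ∀ {a b} → ℕ→ℚ a ≤ ℕ→ℚ b → a ℕ.≤ b
ℕ→ℚ-cancel-≤ {a} {b} h with a ℕ.≤? b
... | yes a≤b = a≤b
... | no a≰b = ⊥-elim (<⇒≱ (ℕ→ℚ-mono-< (ℕᵖ.≰⇒> a≰b)) h)

ℕ→ℚ-cancel-< : ∀ {a b} → ℕ→ℚ a < ℕ→ℚ b → a ℕ.< b
ℕ→ℚ-cancel-< {a} {b} h with suc a ℕ.≤? b
... | yes a<b = a<b
... | no a≮b = ⊥-elim (<⇒≱ h (ℕ→ℚ-mono (ℕᵖ.≮⇒≥ a≮b)))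

0≤1 : 0ℚ ≤ 1ℚ
0≤1 = 0≤ℕ 1

0<inv : ∀ q (h : 0ℚ < q) → 0ℚ < inv q h
0<inv q h = positive⁻¹ _ {{1/pos⇒pos q {{ℚ.positive h}}}}

inv-*ˡ : ∀ q (h : 0ℚ < q) → inv q h * q ≡ 1ℚ
inv-*ˡ q h = *-inverseˡ q {{pos⇒nonZero q {{ℚ.positive h}}}}

inv-*ʳ : ∀ q (h : 0ℚ < q) → q * inv q h ≡ 1ℚ
inv-*ʳ q h = *-inverseʳ q {{pos⇒nonZero q {{ℚ.positive h}}}}

frac-def : ∀ a b → frac a (suc b) * ℕ→ℚ (suc b) ≡ ℕ→ℚ a
frac-def a b = toℚᵘ-injective (begin
  ℚ.toℚᵘ (frac a (suc b) * ℕ→ℚ (suc b))  ≈⟨ toℚᵘ-homo-* (frac a (suc b)) (ℕ→ℚ (suc b)) ⟩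
  ℚ.toℚᵘ (frac a (suc b)) ℚᵘ.* ℚ.toℚᵘ (ℕ→ℚ (suc b))
    ≈⟨ ℚᵘᵖ.*-cong (toℚᵘ-fromℚᵘ (ℚᵘ.mkℚᵘ (ℤ.+ a) b)) (toℚᵘ-fromℚᵘ (ℚᵘ.mkℚᵘ (ℤ.+ suc b) 0)) ⟩
  ℚᵘ.mkℚᵘ (ℤ.+ a) b ℚᵘ.* ℚᵘ.mkℚᵘ (ℤ.+ suc b) 0  ≈⟨ ℚᵘ.*≡* (lemma a b) ⟩
  ℚᵘ.mkℚᵘ (ℤ.+ a) 0  ≈⟨ ℚᵘᵖ.≃-sym (toℚᵘ-fromℚᵘ (ℚᵘ.mkℚᵘ (ℤ.+ a) 0)) ⟩
  ℚ.toℚᵘ (ℕ→ℚ a) ∎)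
  where
  open ℚᵘᵖ.≃-Reasoning
  lemma : ∀ a b → (ℤ.+ a ℤ.* ℤ.+ suc b) ℤ.* ℤ.+ 1 ≡ ℤ.+ a ℤ.* (ℤ.+ (suc b ℕ.* 1))
  lemma a b = trans (ℤᵖ.*-assoc (ℤ.+ a) (ℤ.+ suc b) (ℤ.+ 1))
    (cong (ℤ.+ a ℤ.*_) (sym (ℤᵖ.pos-* (suc b) 1)))

frac-* : ∀ a {b} → 0 ℕ.< b → frac a b * ℕ→ℚ b ≡ ℕ→ℚ a
frac-* a {suc b} _ = frac-def a b

𝟙 : Bool → ℚ
𝟙 true = 1ℚ
𝟙 false = 0ℚ

𝟙-∧ : ∀ a b → 𝟙 (a ∧ b) ≡ 𝟙 a * 𝟙 b
𝟙-∧ true b = sym (*-identityˡ (𝟙 b))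
𝟙-∧ false b = sym (*-zeroˡ (𝟙 b))

0≤𝟙 : ∀ b → 0ℚ ≤ 𝟙 b
0≤𝟙 true = 0≤1
0≤𝟙 false = ≤-refl

𝟙≤1 : ∀ b → 𝟙 b ≤ 1ℚ
𝟙≤1 true = ≤-refl
𝟙≤1 false = 0≤1

-- Finite sums

opaque
  -- Opaque, so that sums stay folded and behave as atoms in unification and in ring identities; the
  -- equations below are the interface.
  ∑ : ∀ {n} → (Fin n → ℚ) → ℚ
  ∑ = sum

  ∑-zero : {f : Fin 0 → ℚ} → ∑ f ≡ 0ℚ
  ∑-zero = refl

  ∑-suc : ∀ {n} (f : Fin (suc n) → ℚ) → ∑ f ≡ f zero + ∑ (f ∘ suc)
  ∑-suc f = refl

  ∑-swap : ∀ {m n} (F : Fin m → Fin n → ℚ) → ∑ (λ u → ∑ λ v → F u v) ≡ ∑ λ v → ∑ λ u → F u v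
  ∑-swap = ∑-comm

  ∑-cong : ∀ {n} {f g : Fin n → ℚ} → (∀ i → f i ≡ g i) → ∑ f ≡ ∑ g
  ∑-cong = sum-cong-≗

  ∑-mono : ∀ {n} {f g : Fin n → ℚ} → (∀ i → f i ≤ g i) → ∑ f ≤ ∑ g
  ∑-mono {zero} h = ≤-refl
  ∑-mono {suc n} h = +-mono-≤ (h zero) (∑-mono (h ∘ suc))

  ∑-+ : ∀ {n} (f g : Fin n → ℚ) → ∑ (λ i → f i + g i) ≡ ∑ f + ∑ g
  ∑-+ = ∑-distrib-+

  ∑-* : ∀ {n} c (f : Fin n → ℚ) → ∑ (λ i → c * f i) ≡ c * ∑ f
  ∑-* c f = sym (*-distribˡ-sum c f)

  ∑-const : ∀ n c → ∑ {n} (λ _ → c) ≡ ℕ→ℚ n * c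
  ∑-const zero c = sym (*-zeroˡ c)
  ∑-const (suc n) c = trans (cong (c +_) (∑-const n c))
    (trans (lemma c (ℕ→ℚ n)) (cong (_* c) (sym (ℕ→ℚ-suc n))))
    where
    lemma : ∀ c m → c + m * c ≡ (1ℚ + m) * c
    lemma = solve-∀ ℚ-ring

  0≤∑ : ∀ {n} {f : Fin n → ℚ} → (∀ i → 0ℚ ≤ f i) → 0ℚ ≤ ∑ f
  0≤∑ {zero} h = ≤-refl
  0≤∑ {suc n} h = 0≤+ (h zero) (0≤∑ (h ∘ suc))

∑₂ : ∀ {m n} → (Fin m → Fin n → ℚ) → ℚ
∑₂ F = ∑ λ u → ∑ λ v → F u v

module _ {m n : ℕ} where
  ∑₂-cong : {F H : Fin m → Fin n → ℚ} → (∀ u v → F u v ≡ H u v) → ∑₂ F ≡ ∑₂ H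
  ∑₂-cong h = ∑-cong λ u → ∑-cong λ v → h u v

  ∑₂-mono : {F H : Fin m → Fin n → ℚ} → (∀ u v → F u v ≤ H u v) → ∑₂ F ≤ ∑₂ H
  ∑₂-mono h = ∑-mono λ u → ∑-mono λ v → h u v

  ∑₂-+ : (F H : Fin m → Fin n → ℚ) → ∑₂ (λ u v → F u v + H u v) ≡ ∑₂ F + ∑₂ H
  ∑₂-+ F H = trans (∑-cong λ u → ∑-+ (F u) (H u)) (∑-+ _ _)

  ∑₂-* : ∀ c (F : Fin m → Fin n → ℚ) → ∑₂ (λ u v → c * F u v) ≡ c * ∑₂ F
  ∑₂-* c F = trans (∑-cong λ u → ∑-* c (F u)) (∑-* c _)

  ∑₂-lin : ∀ a b (F H : Fin m → Fin n → ℚ) →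
    ∑₂ (λ u v → a * F u v + b * H u v) ≡ a * ∑₂ F + b * ∑₂ H
  ∑₂-lin a b F H = trans (∑₂-+ _ _) (cong₂ _+_ (∑₂-* a F) (∑₂-* b H))

  ∑₂-- : (F H : Fin m → Fin n → ℚ) → ∑₂ (λ u v → F u v - H u v) ≡ ∑₂ F - ∑₂ H
  ∑₂-- F H = trans (∑₂-cong λ u v → to (F u v) (H u v))
    (trans (∑₂-lin 1ℚ (- 1ℚ) F H) (sym (to (∑₂ F) (∑₂ H))))
    where
    to : ∀ x y → x - y ≡ 1ℚ * x + (- 1ℚ) * y
    to = solve-∀ ℚ-ring

  ∑₂-comm : (F : Fin m → Fin n → ℚ) → ∑₂ F ≡ ∑₂ (λ v u → F u v)
  ∑₂-comm = ∑-swap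

  0≤∑₂ : {F : Fin m → Fin n → ℚ} → (∀ u v → 0ℚ ≤ F u v) → 0ℚ ≤ ∑₂ F
  0≤∑₂ h = 0≤∑ λ u → 0≤∑ (h u)

  ∑₂-const : ∀ c → ∑₂ {m} {n} (λ _ _ → c) ≡ ℕ→ℚ m * ℕ→ℚ n * c
  ∑₂-const c = trans (∑-const m _) (trans (cong (ℕ→ℚ m *_) (∑-const n c))
    (sym (*-assoc (ℕ→ℚ m) (ℕ→ℚ n) c)))

count-∑ : ∀ {n} (P : Fin n → Bool) → ℕ→ℚ (count P) ≡ ∑ (𝟙 ∘ P)
count-∑ {zero} P = sym ∑-zero
count-∑ {suc n} P = trans (ℕ→ℚ-+ (if P zero then 1 else 0) (count (P ∘ suc)))
  (trans (cong₂ _+_ (lemma (P zero)) (count-∑ (P ∘ suc))) (sym (∑-suc (𝟙 ∘ P))))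
  where
  lemma : ∀ b → ℕ→ℚ (if b then 1 else 0) ≡ 𝟙 b
  lemma true = refl
  lemma false = refl

sumF-∑ : ∀ {n} (f : Fin n → ℕ) → ℕ→ℚ (sumF f) ≡ ∑ (ℕ→ℚ ∘ f)
sumF-∑ {zero} f = sym ∑-zero
sumF-∑ {suc n} f = trans (ℕ→ℚ-+ (f zero) (sumF (f ∘ suc)))
  (trans (cong (ℕ→ℚ (f zero) +_) (sumF-∑ (f ∘ suc))) (sym (∑-suc (ℕ→ℚ ∘ f))))

sumF-count-∑ : ∀ {m n} (P : Fin m → Fin n → Bool) →
  ℕ→ℚ (sumF λ u → count (P u)) ≡ ∑₂ (λ u v → 𝟙 (P u v))
sumF-count-∑ P = trans (sumF-∑ λ u → count (P u)) (∑-cong λ u → count-∑ (P u))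

e-∑ : ∀ {n} (G : Graph n) A B → ℕ→ℚ (e G A B) ≡ ∑₂ (λ u v → 𝟙 (A u) * 𝟙 (B v) * 𝟙 (adj G u v))
e-∑ G A B = trans (sumF-count-∑ (λ u v → A u ∧ B v ∧ adj G u v)) (∑₂-cong λ u v →
  trans (𝟙-∧ (A u) (B v ∧ adj G u v)) (trans (cong (𝟙 (A u) *_) (𝟙-∧ (B v) (adj G u v)))
    (sym (*-assoc (𝟙 (A u)) (𝟙 (B v)) (𝟙 (adj G u v))))))

-- Averaging over the classes of a colouring

≟-comm : ∀ {k} (i j : Fin k) → ⌊ i Fin.≟ j ⌋ ≡ ⌊ j Fin.≟ i ⌋
≟-comm i j with i Fin.≟ j | j Fin.≟ i
... | yes _ | yes _ = refl
... | no _ | no _ = refl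
... | yes p | no q = ⊥-elim (q (sym p))
... | no p | yes q = ⊥-elim (p (sym q))

≟-refl : ∀ {k} (i : Fin k) → ⌊ i Fin.≟ i ⌋ ≡ true
≟-refl i with i Fin.≟ i
... | yes _ = refl
... | no p = ⊥-elim (p refl)

count-pos : ∀ {n} (P : Fin n → Bool) u → P u ≡ true → 0 ℕ.< count P
count-pos {suc n} P zero eq rewrite eq = s≤s z≤n
count-pos {suc n} P (suc u) eq = ℕᵖ.≤-trans (count-pos (P ∘ suc) u eq) (ℕᵖ.m≤n+m _ _)

Meas : ∀ {n k} → (Fin n → Fin k) → (Fin n → ℚ) → Set
Meas c g = ∀ u v → c u ≡ c v → g u ≡ g v

Meas₂ : ∀ {n k} → (Fin n → Fin k) → (Fin n → Fin n → ℚ) → Set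
Meas₂ c g = ∀ u v u′ v′ → c u ≡ c u′ → c v ≡ c v′ → g u v ≡ g u′ v′

_≼_ : ∀ {n l k} → (Fin n → Fin l) → (Fin n → Fin k) → Set
c′ ≼ c = ∀ u v → c′ u ≡ c′ v → c u ≡ c v

Meas₂-≼ : ∀ {n l k} {c′ : Fin n → Fin l} {c : Fin n → Fin k} {g} → c′ ≼ c → Meas₂ c g → Meas₂ c′ g
Meas₂-≼ r m u v u′ v′ p q = m u v u′ v′ (r u u′ p) (r v v′ q)

module _ {n k : ℕ} (c : Fin n → Fin k) where

  [_∈_] : Fin n → Fin k → ℚ
  [ v ∈ i ] = 𝟙 ⌊ c v Fin.≟ i ⌋

  classSize : Fin k → ℕ
  classSize i = count λ v → ⌊ c v Fin.≟ i ⌋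

  -- `frac` gives an empty class the average 0; the laws that cancel a class size speak of classes
  -- `c u`, which contain u.
  average : (Fin n → ℚ) → Fin k → ℚ
  average f i = frac 1 (classSize i) * ∑ λ v → [ v ∈ i ] * f v

  classSize-∑ : ∀ u → ∑ (λ v → [ v ∈ c u ]) ≡ ℕ→ℚ (classSize (c u))
  classSize-∑ u = sym (count-∑ λ v → ⌊ c v Fin.≟ c u ⌋)

  frac-classSize : ∀ u → frac 1 (classSize (c u)) * ℕ→ℚ (classSize (c u)) ≡ 1ℚ
  frac-classSize u = frac-* 1 (count-pos _ u (≟-refl (c u)))

  0≤frac1 : ∀ b → 0ℚ ≤ frac 1 b
  0≤frac1 zero = ≤-refl
  0≤frac1 (suc b) = nonNegative⁻¹ _ {{normalize-nonNeg 1 (suc b)}}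

  transfer : ∀ {h} → Meas c h → ∀ u v → [ v ∈ c u ] * h u ≡ [ v ∈ c u ] * h v
  transfer {h} m u v with c v Fin.≟ c u
  ... | yes p = cong (1ℚ *_) (m u v (sym p))
  ... | no _ = trans (*-zeroˡ (h u)) (sym (*-zeroˡ (h v)))

  -- Averaging is self-adjoint, being given by a symmetric kernel: exchanging the two sums moves the
  -- average from f to g, which is constant on classes and hence unchanged.
  average-∑ : ∀ {g} → Meas c g → ∀ f → ∑ (λ u → g u * average f (c u)) ≡ ∑ (λ u → g u * f u)
  average-∑ {g} m f = begin
    ∑ (λ u → g u * average f (c u))
      ≡⟨ ∑-cong (λ u → trans (sym (*-assoc (g u) (r u) _)) (sym (∑-* (g u * r u) (λ v → [ v ∈ c u ] * f v)))) ⟩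
    ∑₂ (λ u v → g u * r u * ([ v ∈ c u ] * f v))
      ≡⟨ ∑₂-comm _ ⟩
    ∑₂ (λ v u → g u * r u * ([ v ∈ c u ] * f v))
      ≡⟨ ∑₂-cong (λ v u → step (g u * r u) (g v * r v) [ v ∈ c u ] [ u ∈ c v ] (f v)
          (transfer mr u v) (cong 𝟙 (≟-comm (c v) (c u)))) ⟩
    ∑₂ (λ v u → f v * (g v * r v) * [ u ∈ c v ])
      ≡⟨ ∑-cong (λ v → ∑-* (f v * (g v * r v)) (λ u → [ u ∈ c v ])) ⟩
    ∑ (λ v → f v * (g v * r v) * ∑ (λ u → [ u ∈ c v ]))
      ≡⟨ ∑-cong (λ v → trans (cong (f v * (g v * r v) *_) (classSize-∑ v))
          (fin (f v) (g v) (r v) _ (frac-classSize v))) ⟩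
    ∑ (λ v → g v * f v) ∎
    where
    open ≡-Reasoning
    r : Fin n → ℚ
    r u = frac 1 (classSize (c u))
    mr : Meas c (λ u → g u * r u)
    mr u v eq = cong₂ _*_ (m u v eq) (cong (λ i → frac 1 (classSize i)) eq)
    step : ∀ a b x y z → x * a ≡ x * b → x ≡ y → a * (x * z) ≡ z * b * y
    step a b x y z h refl = trans (l₁ a x z) (trans (cong (_* z) h) (l₂ b x z))
      where
      l₁ : ∀ a x z → a * (x * z) ≡ x * a * z
      l₁ = solve-∀ ℚ-ring
      l₂ : ∀ b x z → x * b * z ≡ z * b * x
      l₂ = solve-∀ ℚ-ring
    fin : ∀ x y a b → a * b ≡ 1ℚ → x * (y * a) * b ≡ y * x
    fin x y a b h = trans (l₁ x y a b) (trans (cong (x * y *_) h) (l₂ x y))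
      where
      l₁ : ∀ x y a b → x * (y * a) * b ≡ x * y * (a * b)
      l₁ = solve-∀ ℚ-ring
      l₂ : ∀ x y → x * y * 1ℚ ≡ y * x
      l₂ = solve-∀ ℚ-ring

  average-mono : ∀ {f h} → (∀ v → f v ≤ h v) → ∀ i → average f i ≤ average h i
  average-mono f≤h i = *-monoʳ (0≤frac1 (classSize i))
    (∑-mono λ v → *-monoʳ (0≤𝟙 ⌊ c v Fin.≟ i ⌋) (f≤h v))

  average-const : ∀ a u → average (λ _ → a) (c u) ≡ a
  average-const a u = begin
    r * ∑ (λ v → [ v ∈ c u ] * a)  ≡⟨ cong (r *_) (∑-cong λ v → *-comm _ a) ⟩
    r * ∑ (λ v → a * [ v ∈ c u ])  ≡⟨ cong (r *_) (∑-* a _) ⟩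
    r * (a * ∑ (λ v → [ v ∈ c u ]))  ≡⟨ cong (λ z → r * (a * z)) (classSize-∑ u) ⟩
    r * (a * s)  ≡⟨ l r a s ⟩
    a * (r * s)  ≡⟨ cong (a *_) (frac-classSize u) ⟩
    a * 1ℚ  ≡⟨ *-identityʳ a ⟩
    a ∎
    where
    open ≡-Reasoning
    r s : ℚ
    r = frac 1 (classSize (c u))
    s = ℕ→ℚ (classSize (c u))
    l : ∀ r a s → r * (a * s) ≡ a * (r * s)
    l = solve-∀ ℚ-ring

  average-cong : ∀ {f h} → (∀ v → f v ≡ h v) → ∀ i → average f i ≡ average h i
  average-cong eq i = cong (frac 1 (classSize i) *_) (∑-cong λ v → cong ([ v ∈ i ] *_) (eq v))

  -- Both sides are the same normalised double sum. This yields the symmetry of block densities.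
  average-swap : ∀ (X : Fin n → Fin n → ℚ) i j →
    average (λ u → average (X u) j) i ≡ average (λ v → average (λ u → X u v) i) j
  average-swap X i j = begin
    a * ∑ (λ u → [ u ∈ i ] * (b * ∑ (λ v → [ v ∈ j ] * X u v)))
      ≡⟨ cong (a *_) (expand b i (λ u v → [ v ∈ j ] * X u v)) ⟩
    a * (b * ∑₂ (λ u v → [ u ∈ i ] * ([ v ∈ j ] * X u v)))
      ≡⟨ l₁ a b _ ⟩
    b * (a * ∑₂ (λ u v → [ u ∈ i ] * ([ v ∈ j ] * X u v)))
      ≡⟨ cong (λ z → b * (a * z)) (trans (∑₂-comm _) (∑₂-cong λ v u → l₁ [ u ∈ i ] [ v ∈ j ] (X u v))) ⟩
    b * (a * ∑₂ (λ v u → [ v ∈ j ] * ([ u ∈ i ] * X u v)))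
      ≡⟨ cong (b *_) (sym (expand a j (λ v u → [ u ∈ i ] * X u v))) ⟩
    b * ∑ (λ v → [ v ∈ j ] * (a * ∑ (λ u → [ u ∈ i ] * X u v))) ∎
    where
    open ≡-Reasoning
    a b : ℚ
    a = frac 1 (classSize i)
    b = frac 1 (classSize j)
    l₁ : ∀ x y z → x * (y * z) ≡ y * (x * z)
    l₁ = solve-∀ ℚ-ring
    expand : ∀ s i (F : Fin n → Fin n → ℚ) →
      ∑ (λ u → [ u ∈ i ] * (s * ∑ (F u))) ≡ s * ∑₂ (λ u v → [ u ∈ i ] * F u v)
    expand s i F = trans (∑-cong λ u → trans (l₁ [ u ∈ i ] s (∑ (F u))) (cong (s *_) (sym (∑-* [ u ∈ i ] (F u)))))
      (∑-* s _)

module _ {n k : ℕ} (c : Fin n → Fin k) (X : Fin n → Fin n → ℚ) where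
  opaque
    -- Two one-dimensional averages instead of a quotient by the size of a block, so that bounds and
    -- the projection property follow one variable at a time.
    blockAverage : Fin n → Fin n → ℚ
    blockAverage u v = average c (λ u′ → average c (X u′) (c v)) (c u)

    blockAverage-meas : Meas₂ c blockAverage
    blockAverage-meas u v u′ v′ p q = cong₂ (λ i j → average c (λ w → average c (X w) j) i) p q

    blockAverage-∑ : ∀ {g} → Meas₂ c g → ∑₂ (λ u v → g u v * blockAverage u v) ≡ ∑₂ (λ u v → g u v * X u v)
    blockAverage-∑ {g} m = begin
      ∑₂ (λ u v → g u v * average c (λ w → average c (X w) (c v)) (c u))
        ≡⟨ ∑₂-comm _ ⟩
      ∑ (λ v → ∑ (λ u → g u v * average c (λ w → average c (X w) (c v)) (c u)))
        ≡⟨ ∑-cong (λ v → average-∑ c (λ u u′ p → m u v u′ v p refl) (λ w → average c (X w) (c v))) ⟩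
      ∑ (λ v → ∑ (λ u → g u v * average c (X u) (c v)))
        ≡⟨ ∑₂-comm _ ⟩
      ∑ (λ u → ∑ (λ v → g u v * average c (X u) (c v)))
        ≡⟨ ∑-cong (λ u → average-∑ c (λ v v′ p → m u v u v′ refl p) (X u)) ⟩
      ∑₂ (λ u v → g u v * X u v) ∎
      where open ≡-Reasoning

    0≤blockAverage : (∀ u v → 0ℚ ≤ X u v) → ∀ u v → 0ℚ ≤ blockAverage u v
    0≤blockAverage h u v = subst (_≤ blockAverage u v) (average-const c 0ℚ u)
      (average-mono c (λ u′ → subst (_≤ average c (X u′) (c v)) (average-const c 0ℚ v)
          (average-mono c (h u′) (c v))) (c u))

    blockAverage≤1 : (∀ u v → X u v ≤ 1ℚ) → ∀ u v → blockAverage u v ≤ 1ℚ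
    blockAverage≤1 h u v = subst (blockAverage u v ≤_) (average-const c 1ℚ u)
      (average-mono c (λ u′ → subst (average c (X u′) (c v) ≤_) (average-const c 1ℚ v)
          (average-mono c (h u′) (c v))) (c u))

    blockAverage-sym : (∀ u v → X u v ≡ X v u) → ∀ u v → blockAverage u v ≡ blockAverage v u
    blockAverage-sym h u v = trans (average-swap c X (c u) (c v))
      (average-cong c (λ w → average-cong c (λ w′ → h w′ w) (c u)) (c v))

-- Weak regularity

bit : Bool → Fin 2
bit true = suc zero
bit false = zero

bit-injective : ∀ {a b} → bit a ≡ bit b → a ≡ b
bit-injective {true} {true} _ = refl
bit-injective {false} {false} _ = refl

module _ {n l : ℕ} (c : Fin n → Fin l) (S T : VSet n) where
  splitBy : Fin n → Fin (l ℕ.* 2 ℕ.* 2)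
  splitBy v = Fin.combine (Fin.combine (c v) (bit (S v))) (bit (T v))

  private
    fst≡ : ∀ {u v} → splitBy u ≡ splitBy v → Fin.combine (c u) (bit (S u)) ≡ Fin.combine (c v) (bit (S v))
    fst≡ {u} {v} eq = combine-injectiveˡ (Fin.combine (c u) (bit (S u))) (bit (T u))
        (Fin.combine (c v) (bit (S v))) (bit (T v)) eq

  splitBy-≼ : splitBy ≼ c
  splitBy-≼ u v eq = combine-injectiveˡ (c u) (bit (S u)) (c v) (bit (S v)) (fst≡ eq)

  splitBy-S : ∀ u v → splitBy u ≡ splitBy v → S u ≡ S v
  splitBy-S u v eq = bit-injective (combine-injectiveʳ (c u) (bit (S u)) (c v) (bit (S v)) (fst≡ eq))

  splitBy-T : ∀ u v → splitBy u ≡ splitBy v → T u ≡ T v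
  splitBy-T u v eq = bit-injective
    (combine-injectiveʳ (Fin.combine (c u) (bit (S u))) (bit (T u)) (Fin.combine (c v) (bit (S v))) (bit (T v)) eq)

module _ {n : ℕ} (X : Fin n → Fin n → ℚ) (0≤X : ∀ u v → 0ℚ ≤ X u v) (X≤1 : ∀ u v → X u v ≤ 1ℚ) where

  private
    D : ∀ {l} → (Fin n → Fin l) → Fin n → Fin n → ℚ
    D c = blockAverage c X

    N : ℚ
    N = ℕ→ℚ n * ℕ→ℚ n

  energy : ∀ {l} → (Fin n → Fin l) → ℚ
  energy c = ∑₂ λ u v → D c u v * D c u v

  energy≤ : ∀ {l} (c : Fin n → Fin l) → energy c ≤ N
  energy≤ c = subst (energy c ≤_) (trans (∑₂-const 1ℚ) (*-identityʳ N))
    (∑₂-mono λ u v → *-mono (0≤blockAverage c X 0≤X u v) 0≤1 (blockAverage≤1 c X X≤1 u v)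
        (blockAverage≤1 c X X≤1 u v))

  0≤energy : ∀ {l} (c : Fin n → Fin l) → 0ℚ ≤ energy c
  0≤energy c = 0≤∑₂ λ u v → 0≤² (D c u v)

  module _ {l l′} {c : Fin n → Fin l} {c′ : Fin n → Fin l′} (c′≼c : c′ ≼ c) where

    ∑₂-refine : ∀ {w} → Meas₂ c′ w →
      ∑₂ (λ u v → w u v * (X u v - D c u v)) ≡ ∑₂ (λ u v → w u v * (D c′ u v - D c u v))
    ∑₂-refine {w} mw = begin
      ∑₂ (λ u v → w u v * (X u v - D c u v))  ≡⟨ ∑₂-cong (λ u v → dist (w u v) (X u v) (D c u v)) ⟩
      ∑₂ (λ u v → w u v * X u v - w u v * D c u v)  ≡⟨ ∑₂-- (λ u v → w u v * X u v) (λ u v → w u v * D c u v) ⟩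
      ∑₂ (λ u v → w u v * X u v) - ∑₂ (λ u v → w u v * D c u v)
        ≡⟨ cong (_- ∑₂ (λ u v → w u v * D c u v)) (sym (blockAverage-∑ c′ X mw)) ⟩
      ∑₂ (λ u v → w u v * D c′ u v) - ∑₂ (λ u v → w u v * D c u v)
        ≡⟨ sym (∑₂-- (λ u v → w u v * D c′ u v) (λ u v → w u v * D c u v)) ⟩
      ∑₂ (λ u v → w u v * D c′ u v - w u v * D c u v)
        ≡⟨ ∑₂-cong (λ u v → sym (dist (w u v) (D c′ u v) (D c u v))) ⟩
      ∑₂ (λ u v → w u v * (D c′ u v - D c u v)) ∎
      where
      open ≡-Reasoning
      dist : ∀ w x y → w * (x - y) ≡ w * x - w * y
      dist = solve-∀ ℚ-ring

    -- Tested with a weight that is constant on the coarser blocks, `D c` and `D c′` both give the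
    -- same sum as X.
    ∑₂-martingale : ∀ {w} → Meas₂ c w → ∑₂ (λ u v → w u v * (D c′ u v - D c u v)) ≡ 0ℚ
    ∑₂-martingale {w} mw = begin
      ∑₂ (λ u v → w u v * (D c′ u v - D c u v)) ≡⟨ sym (∑₂-refine (Meas₂-≼ {c = c} c′≼c mw)) ⟩
      ∑₂ (λ u v → w u v * (X u v - D c u v))  ≡⟨ ∑₂-cong (λ u v → dist (w u v) (X u v) (D c u v)) ⟩
      ∑₂ (λ u v → w u v * X u v - w u v * D c u v)  ≡⟨ ∑₂-- (λ u v → w u v * X u v) (λ u v → w u v * D c u v) ⟩
      ∑₂ (λ u v → w u v * X u v) - ∑₂ (λ u v → w u v * D c u v)
        ≡⟨ cong (λ z → ∑₂ (λ u v → w u v * X u v) - z) (blockAverage-∑ c X mw) ⟩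
      ∑₂ (λ u v → w u v * X u v) - ∑₂ (λ u v → w u v * X u v)  ≡⟨ +-inverseʳ (∑₂ λ u v → w u v * X u v) ⟩
      0ℚ ∎
      where
      open ≡-Reasoning
      dist : ∀ w x y → w * (x - y) ≡ w * x - w * y
      dist = solve-∀ ℚ-ring

    energy-pythagoras : energy c′ ≡ energy c + ∑₂ (λ u v → (D c′ u v - D c u v) * (D c′ u v - D c u v))
    energy-pythagoras = begin
      energy c′ ≡⟨ ∑₂-cong (λ u v → l₁ (D c′ u v) (D c u v)) ⟩
      ∑₂ (λ u v → D c u v * D c u v + Δ² u v + 2ℚ * cross u v)
        ≡⟨ trans (∑₂-+ (λ u v → D c u v * D c u v + Δ² u v) (λ u v → 2ℚ * cross u v))
             (cong₂ _+_ (∑₂-+ (λ u v → D c u v * D c u v) Δ²) (∑₂-* 2ℚ cross)) ⟩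
      energy c + ∑₂ Δ² + 2ℚ * ∑₂ cross
        ≡⟨ cong (λ z → energy c + ∑₂ Δ² + 2ℚ * z) (∑₂-martingale (blockAverage-meas c X)) ⟩
      energy c + ∑₂ Δ² + 2ℚ * 0ℚ ≡⟨ trans (cong (energy c + ∑₂ Δ² +_) (*-zeroʳ 2ℚ)) (+-identityʳ _) ⟩
      energy c + ∑₂ Δ² ∎
      where
      open ≡-Reasoning
      Δ² cross : Fin n → Fin n → ℚ
      Δ² u v = (D c′ u v - D c u v) * (D c′ u v - D c u v)
      cross u v = D c u v * (D c′ u v - D c u v)
      l₁ : ∀ y x → y * y ≡ x * x + (y - x) * (y - x) + 2ℚ * (x * (y - x))
      l₁ = solve-∀ ℚ-ring

    -- Pointwise (Δ - γ w)² ≥ 0 and w² ≤ 1 give Δ² ≥ 2 γ w Δ - γ². Summed, the correlation γ N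
    -- yields 2 γ² N - γ² N, and by `energy-pythagoras` Σ Δ² is the gain. This is Cauchy-Schwarz
    -- without roots or quotients.
    energy-gain : ∀ {w γ} → Meas₂ c′ w → (∀ u v → w u v * w u v ≤ 1ℚ) → 0ℚ ≤ γ →
      γ * N ≤ ∑₂ (λ u v → w u v * (X u v - D c u v)) → energy c + γ * γ * N ≤ energy c′
    energy-gain {w} {γ} mw w≤1 0≤γ h = ≤-by final eq
      where
      Δ : Fin n → Fin n → ℚ
      Δ u v = D c′ u v - D c u v
      A B : ℚ
      A = ∑₂ (λ u v → w u v * Δ u v)
      B = ∑₂ (λ u v → Δ u v * Δ u v)
      pt : ∀ u v → 2ℚ * γ * (w u v * Δ u v) ≤ 1ℚ * (Δ u v * Δ u v) + γ * γ * 1ℚ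
      pt u v = ≤-by (0≤+ (0≤² (Δ u v - γ * w u v)) (0≤* (0≤² γ) (≤⇒0≤- (w≤1 u v)))) (square (Δ u v) γ (w u v))
        where
        square : ∀ d g w → (d - g * w) * (d - g * w) + g * g * (1ℚ - w * w) ≡
            (1ℚ * (d * d) + g * g * 1ℚ) - 2ℚ * g * (w * d)
        square = solve-∀ ℚ-ring
      summed : 2ℚ * γ * A ≤ 1ℚ * B + γ * γ * (N * 1ℚ)
      summed = subst₂ _≤_ (∑₂-* (2ℚ * γ) (λ u v → w u v * Δ u v))
        (trans (∑₂-lin 1ℚ (γ * γ) (λ u v → Δ u v * Δ u v) (λ _ _ → 1ℚ))
            (cong (λ z → 1ℚ * B + γ * γ * z) (∑₂-const 1ℚ))) (∑₂-mono pt)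
      low : γ * (γ * N) ≤ γ * A
      low = *-monoʳ 0≤γ (subst (γ * N ≤_) (∑₂-refine mw) h)
      final : 0ℚ ≤ ((1ℚ * B + γ * γ * (N * 1ℚ)) - 2ℚ * γ * A) + 2ℚ * (γ * A - γ * (γ * N))
      final = 0≤+ (≤⇒0≤- summed) (0≤* (0≤ℕ 2) (≤⇒0≤- low))
      l₂ : ∀ E A B g N → ((1ℚ * B + g * g * (N * 1ℚ)) - 2ℚ * g * A) + 2ℚ * (g * A - g * (g * N)) ≡
          (E + B) - (E + g * g * N)
      l₂ = solve-∀ ℚ-ring
      eq : ((1ℚ * B + γ * γ * (N * 1ℚ)) - 2ℚ * γ * A) + 2ℚ * (γ * A - γ * (γ * N)) ≡ energy c′ -
          (energy c + γ * γ * N)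
      eq = trans (l₂ (energy c) A B γ N) (cong (_- (energy c + γ * γ * N)) (sym energy-pythagoras))

  module _ {k} (c₀ : Fin n → Fin k) (ρ : ℚ → ℚ → ℚ)
    (0≤ρ : ∀ {x y} → 0ℚ ≤ x → x ≤ 1ℚ → 0ℚ ≤ y → y ≤ 1ℚ → 0ℚ ≤ ρ x y)
    (ρ≤1 : ∀ {x y} → 0ℚ ≤ x → x ≤ 1ℚ → 0ℚ ≤ y → y ≤ 1ℚ → ρ x y ≤ 1ℚ) where

    -- The weight `ρ` depends on the coarse and on the current block density; it will be the factor
    -- by which deviations are rescaled. Being constant on blocks and in the unit interval, it
    -- leaves the energy increment intact.
    discrepancy : ∀ {l} → (Fin n → Fin l) → VSet n → VSet n → ℚ
    discrepancy c S T = ∑₂ λ u v → 𝟙 (S u) * 𝟙 (T v) * ρ (D c₀ u v) (D c u v) * (X u v - D c u v)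

    CutRegular : ∀ {l} → ℚ → (Fin n → Fin l) → Set
    CutRegular γ c = ∀ S T → ∣ discrepancy c S T ∣ ≤ γ * N

    module _ {l} {c : Fin n → Fin l} (c≼c₀ : c ≼ c₀) (S T : VSet n) where
      private
        c′ = splitBy c S T

        w : Fin n → Fin n → ℚ
        w u v = 𝟙 (S u) * 𝟙 (T v) * ρ (D c₀ u v) (D c u v)

        mw : Meas₂ c′ w
        mw u v u′ v′ p q = cong₂ _*_
          (cong₂ _*_ (cong 𝟙 (splitBy-S c S T u u′ p)) (cong 𝟙 (splitBy-T c S T v v′ q)))
          (cong₂ ρ (blockAverage-meas c₀ X u v u′ v′ (c≼c₀ u u′ (p₁ u u′ p)) (c≼c₀ v v′ (p₁ v v′ q)))
                   (blockAverage-meas c X u v u′ v′ (p₁ u u′ p) (p₁ v v′ q)))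
          where
          p₁ = splitBy-≼ c S T

        0≤w : ∀ u v → 0ℚ ≤ w u v
        0≤w u v = 0≤* (0≤* (0≤𝟙 (S u)) (0≤𝟙 (T v)))
          (0≤ρ (0≤blockAverage c₀ X 0≤X u v) (blockAverage≤1 c₀ X X≤1 u v)
              (0≤blockAverage c X 0≤X u v) (blockAverage≤1 c X X≤1 u v))

        w≤1 : ∀ u v → w u v ≤ 1ℚ
        w≤1 u v = *-mono (0≤* (0≤𝟙 (S u)) (0≤𝟙 (T v))) 0≤1 (*-mono (0≤𝟙 (S u)) 0≤1 (𝟙≤1 (S u)) (𝟙≤1 (T v)))
          (ρ≤1 (0≤blockAverage c₀ X 0≤X u v) (blockAverage≤1 c₀ X X≤1 u v)
              (0≤blockAverage c X 0≤X u v) (blockAverage≤1 c X X≤1 u v))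

        w² : ∀ u v → w u v * w u v ≤ 1ℚ
        w² u v = *-mono (0≤w u v) 0≤1 (w≤1 u v) (w≤1 u v)

        neg² : ∀ a → (- a) * (- a) ≡ a * a
        neg² = solve-∀ ℚ-ring

        neg-∑ : ∑₂ (λ u v → - w u v * (X u v - D c u v)) ≡ - discrepancy c S T
        neg-∑ = trans (∑₂-cong λ u v → pull (w u v) (X u v - D c u v))
          (trans (∑₂-* (- 1ℚ) (λ u v → w u v * (X u v - D c u v))) (l′ (discrepancy c S T)))
          where
          pull : ∀ a b → - a * b ≡ - 1ℚ * (a * b)
          pull = solve-∀ ℚ-ring
          l′ : ∀ a → - 1ℚ * a ≡ - a
          l′ = solve-∀ ℚ-ring

      energy-splitBy : ∀ {γ} → 0ℚ ≤ γ → γ * N < ∣ discrepancy c S T ∣ →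
        energy c + γ * γ * N ≤ energy c′
      energy-splitBy {γ} 0≤γ h with ∣p∣≡p∨∣p∣≡-p (discrepancy c S T)
      ... | inj₁ eq = energy-gain (splitBy-≼ c S T) {w} mw w² 0≤γ (subst (γ * N ≤_) eq (<⇒≤ h))
      ... | inj₂ eq = energy-gain (splitBy-≼ c S T) { λ u v → - w u v }
        (λ u v u′ v′ p q → cong -_ (mw u v u′ v′ p q))
        (λ u v → subst (_≤ 1ℚ) (sym (neg² (w u v))) (w² u v)) 0≤γ
        (subst (γ * N ≤_) (trans eq (sym neg-∑)) (<⇒≤ h))

    discrepancy-cong : ∀ {l} (c : Fin n → Fin l) {S S′ T T′} → (∀ v → S v ≡ S′ v) → (∀ v → T v ≡ T′ v) →
      discrepancy c S T ≡ discrepancy c S′ T′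
    discrepancy-cong c p q = ∑₂-cong λ u v →
      cong₂ (λ a b → 𝟙 a * 𝟙 b * ρ (D c₀ u v) (D c u v) * (X u v - D c u v)) (p u) (q v)

    -- A constructive case distinction by search through all pairs of vertex sets; the search runs
    -- over bit vectors, hence `lookup` and `tabulate`.
    cutRegular? : ∀ {l} γ (c : Fin n → Fin l) →
      CutRegular γ c ⊎ Σ (VSet n) λ S → Σ (VSet n) λ T → γ * N < ∣ discrepancy c S T ∣
    cutRegular? γ c with anySubset? (λ S → anySubset? (λ T → γ * N <? ∣ discrepancy c (lookup S) (lookup T) ∣))
    ... | yes (S , T , h) = inj₂ (lookup S , lookup T , h)
    ... | no none = inj₁ λ S T → subst (λ z → ∣ z ∣ ≤ γ * N)
      (discrepancy-cong c (lookup∘tabulate S) (lookup∘tabulate T))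
      (≮⇒≥ λ h → none (tabulate S , tabulate T , h))

    weakRegularity : ∀ {γ} g → 0ℚ ≤ γ → 0ℚ < N → 1ℚ ≤ ℕ→ℚ g * (γ * γ) →
      Σ ℕ λ l → l ℕ.≤ k ℕ.* 4 ℕ.^ g × Σ (Fin n → Fin l) λ c → c ≼ c₀ × CutRegular γ c
    -- One unit of fuel more than g: after g + 1 splits the energy would be at least (g + 1) γ² N,
    -- which exceeds N.
    weakRegularity {γ} g 0≤γ 0<N hg = loop (suc g) 0 (ℕᵖ.+-identityʳ (suc g)) k
      (ℕᵖ.≤-reflexive (sym (ℕᵖ.*-identityʳ k))) c₀ (λ _ _ eq → eq)
      (subst (_≤ energy c₀) (sym (*-zeroˡ (γ * γ * N))) (0≤energy c₀))
      where
      loop : ∀ fuel j → fuel ℕ.+ j ≡ suc g → ∀ l → l ℕ.≤ k ℕ.* 4 ℕ.^ j → (c : Fin n → Fin l) → c ≼ c₀ →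
        ℕ→ℚ j * (γ * γ * N) ≤ energy c →
        Σ ℕ λ l → l ℕ.≤ k ℕ.* 4 ℕ.^ g × Σ (Fin n → Fin l) λ c → c ≼ c₀ × CutRegular γ c
      loop zero j refl l hl c c≼c₀ he = ⊥-elim (<⇒≱ strict (energy≤ c))
        where
        0<γ² : 0ℚ < γ * γ
        0<γ² with <-cmp 0ℚ (γ * γ)
        ... | Tri.tri< h _ _ = h
        ... | Tri.tri≈ _ h _ = ⊥-elim (<⇒≱ (0<ℕ {1} (s≤s z≤n))
            (≤-trans hg (≤-reflexive (trans (cong (ℕ→ℚ g *_) (sym h)) (*-zeroʳ (ℕ→ℚ g))))))
        ... | Tri.tri> _ _ h = ⊥-elim (<⇒≱ h (0≤² γ))
        l₁ : ∀ g γ N → (g * (γ * γ) - 1ℚ) * N + γ * γ * N ≡ (1ℚ + g) * (γ * γ * N) - N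
        l₁ = solve-∀ ℚ-ring
        strict : N < energy c
        strict = <-≤-trans
          (<-by (+-mono-≤-< (0≤* (≤⇒0≤- hg) (<⇒≤ 0<N)) (0<* 0<γ² 0<N))
            (trans (l₁ (ℕ→ℚ g) γ N) (cong (λ z → z * (γ * γ * N) - N) (sym (ℕ→ℚ-suc g))))) he
      loop (suc fuel) j eq l hl c c≼c₀ he with cutRegular? γ c
      ... | inj₁ reg = l , ℕᵖ.≤-trans hl (ℕᵖ.*-monoʳ-≤ k (ℕᵖ.^-monoʳ-≤ 4 j≤g)) , c , c≼c₀ , reg
        where
        j≤g : j ℕ.≤ g
        j≤g = subst (j ℕ.≤_) (ℕᵖ.suc-injective eq) (ℕᵖ.m≤n+m j fuel)
      ... | inj₂ (S , T , h) = loop fuel (suc j) (trans (ℕᵖ.+-suc fuel j) eq) (l ℕ.* 2 ℕ.* 2)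
        (ℕᵖ.≤-trans (ℕᵖ.≤-reflexive (ℕᵖ.*-assoc l 2 2)) (ℕᵖ.≤-trans (ℕᵖ.*-monoˡ-≤ 4 hl)
          (ℕᵖ.≤-reflexive (trans (ℕᵖ.*-assoc k (4 ℕ.^ j) 4) (cong (k ℕ.*_) (ℕᵖ.*-comm (4 ℕ.^ j) 4))))))
        (splitBy c S T) (λ u v p → c≼c₀ u v (splitBy-≼ c S T u v p))
        (≤-trans (≤-trans (≤-reflexive (trans (cong (_* (γ * γ * N)) (ℕ→ℚ-suc j)) (l₁ (ℕ→ℚ j) (γ * γ * N))))
          (+-monoˡ-≤ (γ * γ * N) he)) (energy-splitBy c≼c₀ S T 0≤γ h))
        where
        l₁ : ∀ j x → (1ℚ + j) * x ≡ j * x + x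
        l₁ = solve-∀ ℚ-ring

-- Rounding a weighted graph

-- Twice the difference of the two sides is Σ (f u - f v)².
∑-cauchy : ∀ {n} (f : Fin n → ℚ) → ∑ f * ∑ f ≤ ℕ→ℚ n * ∑ (λ i → f i * f i)
∑-cauchy {n} f = *-cancelˡ {c = 1ℚ + 1ℚ} (0<ℕ {2} (s≤s z≤n)) (≤-by (0≤∑₂ λ u v → 0≤² (f u - f v)) expand)
  where
  open ≡-Reasoning
  Q = ∑ (λ i → f i * f i)
  sq : ∀ x y → (x - y) * (x - y) ≡ 1ℚ * (x * x + y * y) + (- 2ℚ) * (x * y)
  sq = solve-∀ ℚ-ring
  fin : ∀ n Q s → 1ℚ * (n * Q + n * Q) + (- 2ℚ) * (s * s) ≡ 2ℚ * (n * Q) - 2ℚ * (s * s)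
  fin = solve-∀ ℚ-ring
  first : ∑₂ {n} {n} (λ u v → f u * f u) ≡ ℕ→ℚ n * Q
  first = trans (∑-cong λ u → ∑-const n (f u * f u)) (∑-* (ℕ→ℚ n) _)
  prod : ∑₂ (λ u v → f u * f v) ≡ ∑ f * ∑ f
  prod = trans (∑-cong λ u → trans (∑-* (f u) f) (*-comm (f u) (∑ f))) (∑-* (∑ f) f)
  expand : ∑₂ (λ u v → (f u - f v) * (f u - f v)) ≡ 2ℚ * (ℕ→ℚ n * Q) - 2ℚ * (∑ f * ∑ f)
  expand = begin
    ∑₂ (λ u v → (f u - f v) * (f u - f v)) ≡⟨ ∑₂-cong (λ u v → sq (f u) (f v)) ⟩
    ∑₂ (λ u v → 1ℚ * (f u * f u + f v * f v) + (- 2ℚ) * (f u * f v))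
      ≡⟨ ∑₂-lin 1ℚ (- 2ℚ) (λ u v → f u * f u + f v * f v) (λ u v → f u * f v) ⟩
    1ℚ * ∑₂ (λ u v → f u * f u + f v * f v) + (- 2ℚ) * ∑₂ (λ u v → f u * f v)
      ≡⟨ cong₂ (λ a b → 1ℚ * a + (- 2ℚ) * b)
           (trans (∑₂-+ (λ u v → f u * f u) (λ u v → f v * f v)) (cong₂ _+_ first (∑-const n Q))) prod ⟩
    1ℚ * (ℕ→ℚ n * Q + ℕ→ℚ n * Q) + (- 2ℚ) * (∑ f * ∑ f) ≡⟨ fin (ℕ→ℚ n) Q (∑ f) ⟩
    2ℚ * (ℕ→ℚ n * Q) - 2ℚ * (∑ f * ∑ f) ∎

∑₂-cauchy : ∀ {n} (F : Fin n → Fin n → ℚ) → ∑₂ F * ∑₂ F ≤ ℕ→ℚ n * (ℕ→ℚ n * ∑₂ (λ u v → F u v * F u v))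
∑₂-cauchy {n} F = ≤-trans (∑-cauchy λ u → ∑ (F u)) (*-monoʳ (0≤ℕ n)
  (≤-trans (∑-mono λ u → ∑-cauchy (F u)) (≤-reflexive (∑-* (ℕ→ℚ n) _))))

if-elim : ∀ {A : Set} (P : A → Set) b {x y : A} → P x → P y → P (if b then x else y)
if-elim P true px py = px
if-elim P false px py = py

𝟙-if : ∀ b w → 𝟙 b - w ≡ (if b then 1ℚ - w else - w)
𝟙-if true w = refl
𝟙-if false w = +-identityˡ (- w)

-- Each coordinate is chosen so that the cross term of the square does not increase the sum.
greedySigns : ∀ {n m} (A : Fin m → ℚ) (c : Fin n → Fin m → ℚ) (lo hi : Fin n → ℚ) →
  (∀ u → lo u ≤ 0ℚ) → (∀ u → 0ℚ ≤ hi u) → (∀ u → lo u * lo u ≤ 1ℚ) → (∀ u → hi u * hi u ≤ 1ℚ) →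
  Σ (Fin n → Bool) λ b → let ξ = λ u → if b u then hi u else lo u in
    ∑ (λ j → (A j + ∑ (λ u → ξ u * c u j)) * (A j + ∑ (λ u → ξ u * c u j)))
      ≤ ∑ (λ j → A j * A j) + ∑₂ (λ u j → c u j * c u j)
greedySigns {zero} A c lo hi _ _ _ _ = (λ ()) , ≤-reflexive (trans
  (∑-cong λ j → cong (λ z → z * z) (trans (cong (A j +_) ∑-zero) (+-identityʳ (A j))))
  (sym (trans (cong (∑ (λ j → A j * A j) +_) ∑-zero) (+-identityʳ _))))
greedySigns {suc n} {m} A c lo hi lo≤0 0≤hi lo² hi² = b , ≤-trans (≤-reflexive rearr)
  (≤-trans (proj₂ rest) (≤-trans (+-monoˡ-≤ R first) (≤-reflexive assocR)))
  where
  open ≡-Reasoning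
  s C : ℚ
  s = ∑ (λ j → A j * c zero j)
  C = ∑ (λ j → c zero j * c zero j)
  pick : Σ Bool λ β → (if β then hi zero else lo zero) * s ≤ 0ℚ
  pick with ≤-total s 0ℚ
  ... | inj₁ s≤0 = true , subst (hi zero * s ≤_) (*-zeroʳ (hi zero)) (*-monoʳ (0≤hi zero) s≤0)
  ... | inj₂ 0≤s = false , subst (lo zero * s ≤_) (*-zeroˡ s) (*-monoˡ 0≤s (lo≤0 zero))
  ξ₀ : ℚ
  ξ₀ = if proj₁ pick then hi zero else lo zero
  ξ₀² : ξ₀ * ξ₀ ≤ 1ℚ
  ξ₀² = if-elim (λ x → x * x ≤ 1ℚ) (proj₁ pick) (hi² zero) (lo² zero)
  A′ : Fin m → ℚ
  A′ j = A j + ξ₀ * c zero j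
  rest = greedySigns A′ (c ∘ suc) (lo ∘ suc) (hi ∘ suc) (lo≤0 ∘ suc) (0≤hi ∘ suc) (lo² ∘ suc) (hi² ∘ suc)
  b : Fin (suc n) → Bool
  b zero = proj₁ pick
  b (suc u) = proj₁ rest u
  ξ : Fin (suc n) → ℚ
  ξ u = if b u then hi u else lo u
  R : ℚ
  R = ∑₂ (λ u j → c (suc u) j * c (suc u) j)
  rearr : ∑ (λ j → (A j + ∑ (λ u → ξ u * c u j)) * (A j + ∑ (λ u → ξ u * c u j)))
    ≡ ∑ (λ j → (A′ j + ∑ (λ u → ξ (suc u) * c (suc u) j)) * (A′ j + ∑ (λ u → ξ (suc u) * c (suc u) j)))
  rearr = ∑-cong λ j → cong (λ z → z * z)
    (trans (cong (A j +_) (∑-suc (λ u → ξ u * c u j))) (sym (+-assoc (A j) (ξ₀ * c zero j) _)))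
  sq : ∀ a x c → (a + x * c) * (a + x * c) ≡ 1ℚ * (a * a) + (2ℚ * x * (a * c) + x * x * (c * c))
  sq = solve-∀ ℚ-ring
  S : ℚ
  S = ∑ (λ j → A j * A j)
  sumA′ : ∑ (λ j → A′ j * A′ j) ≡ 1ℚ * S + (2ℚ * ξ₀ * s + ξ₀ * ξ₀ * C)
  sumA′ = trans (∑-cong λ j → sq (A j) ξ₀ (c zero j))
    (trans (∑-+ (λ j → 1ℚ * (A j * A j)) (λ j → 2ℚ * ξ₀ * (A j * c zero j) + ξ₀ * ξ₀ * (c zero j * c zero j)))
    (cong₂ _+_ (∑-* 1ℚ (λ j → A j * A j))
      (trans (∑-+ (λ j → 2ℚ * ξ₀ * (A j * c zero j)) (λ j → ξ₀ * ξ₀ * (c zero j * c zero j)))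
        (cong₂ _+_ (∑-* (2ℚ * ξ₀) (λ j → A j * c zero j)) (∑-* (ξ₀ * ξ₀) (λ j → c zero j * c zero j))))))
  fin : ∀ S C x s → 2ℚ * (- (x * s)) + (1ℚ - x * x) * C ≡ (S + C) - (1ℚ * S + (2ℚ * x * s + x * x * C))
  fin = solve-∀ ℚ-ring
  first : ∑ (λ j → A′ j * A′ j) ≤ S + C
  first = subst (_≤ S + C) (sym sumA′)
    (≤-by (0≤+ (0≤* (0≤ℕ 2) (neg-≤ (proj₂ pick))) (0≤* (≤⇒0≤- ξ₀²) (0≤∑ λ j → 0≤² (c zero j)))) (fin S C ξ₀ s))
  assocR : S + C + R ≡ S + ∑₂ (λ u j → c u j * c u j)
  assocR = trans (+-assoc S C R) (cong (S +_) (sym (∑-suc λ u → ∑ λ j → c u j * c u j)))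

Symmetric : ∀ {n} → (Fin n → Fin n → ℚ) → Set
Symmetric W = ∀ u v → W u v ≡ W v u

cube : ℚ → ℚ
cube x = x * x * x

-- U carries the rounding errors above the diagonal, V those on it.
record Rounding {n : ℕ} (W σ : Fin n → Fin n → ℚ) : Set where
  field
    H : Graph n
    U V : Fin n → Fin n → ℚ
    split : ∀ u v → 𝟙 (adj H u v) - W u v ≡ U u v + U v u - V u v
    U²≤1 : ∀ u v → U u v * U u v ≤ 1ℚ
    0≤V : ∀ u v → 0ℚ ≤ V u v
    ∑V≤ : ∑₂ V ≤ ℕ→ℚ n
  dot : Fin n → Fin n → ℚ
  dot u u′ = ∑ λ v → U u v * U u′ v
  drift : ℚ
  drift = ∑₂ λ u v → σ u v * U u v
  field
    -- The factor 2 is dictated by the induction: a new row meets every old row in two symmetric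
    -- entries of the codegree matrix, while the greedy choice bounds these codegrees once, together
    -- with one copy of the squared drift.
    bound : ∑₂ (λ u u′ → dot u u′ * dot u u′) + 2ℚ * (drift * drift) ≤ ℕ→ℚ 3 * cube (ℕ→ℚ n)

x²≤1 : ∀ {x} → 0ℚ ≤ x → x ≤ 1ℚ → x * x ≤ 1ℚ
x²≤1 0≤x x≤1 = *-mono 0≤x 0≤1 x≤1 x≤1

-- Vertex zero is added to a rounding of the rest. Its row is chosen by `greedySigns` against the
-- vectors that record its inner products with `σ` and with the old rows, so that the squared drift
-- plus the new squared codegrees exceeds the old squared drift by at most n + n².
greedyRounding : ∀ {n} (W σ : Fin n → Fin n → ℚ) → (∀ u v → 0ℚ ≤ W u v) → (∀ u v → W u v ≤ 1ℚ) →
  Symmetric W → (∀ u v → σ u v * σ u v ≤ 1ℚ) → Rounding W σ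
greedyRounding {zero} W σ _ _ _ _ = record
  { H = record { adj = λ () ; sym = λ () ; irrefl = λ () }
  ; U = λ () ; V = λ () ; split = λ () ; U²≤1 = λ () ; 0≤V = λ ()
  ; ∑V≤ = ≤-reflexive ∑-zero
  ; bound = ≤-reflexive (cong₂ (λ a b → a + 2ℚ * (b * b)) ∑-zero ∑-zero) }
greedyRounding {suc n} W σ 0≤W W≤1 symW σ² = record
  { H = record { adj = adj′ ; sym = sym′ ; irrefl = irrefl′ }
  ; U = U ; V = V ; split = split′ ; U²≤1 = U² ; 0≤V = 0≤V′ ; ∑V≤ = ∑V′ ; bound = bound′ }
  where
  ih : Rounding (λ i j → W (suc i) (suc j)) (λ i j → σ (suc i) (suc j))
  ih = greedyRounding (λ i j → W (suc i) (suc j)) (λ i j → σ (suc i) (suc j)) (λ i j → 0≤W (suc i) (suc j))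
    (λ i j → W≤1 (suc i) (suc j)) (λ i j → symW (suc i) (suc j)) (λ i j → σ² (suc i) (suc j))
  module I = Rounding ih
  hi lo w : Fin n → ℚ
  w j = W zero (suc j)
  hi j = 1ℚ - w j
  lo j = - w j
  -- Coordinate zero carries the drift so far; coordinate `suc i` starts at 0 and will carry the
  -- codegree of the new row with row i.
  A : Fin (suc n) → ℚ
  A zero = I.drift
  A (suc i) = 0ℚ
  c : Fin n → Fin (suc n) → ℚ
  c u zero = σ zero (suc u)
  c u (suc i) = I.U i u
  0≤hi : ∀ u → 0ℚ ≤ hi u
  0≤hi u = ≤⇒0≤- (W≤1 zero (suc u))
  hi≤1 : ∀ u → hi u ≤ 1ℚ
  hi≤1 u = ≤-by (0≤W zero (suc u)) (l (w u))
    where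
    l : ∀ x → x ≡ 1ℚ - (1ℚ - x)
    l = solve-∀ ℚ-ring
  lo² : ∀ u → lo u * lo u ≤ 1ℚ
  lo² u = subst (_≤ 1ℚ) (l (w u)) (x²≤1 (0≤W zero (suc u)) (W≤1 zero (suc u)))
    where
    l : ∀ x → x * x ≡ (- x) * (- x)
    l = solve-∀ ℚ-ring
  hi² : ∀ u → hi u * hi u ≤ 1ℚ
  hi² u = x²≤1 (0≤hi u) (hi≤1 u)
  signs = greedySigns A c lo hi (λ u → neg-antimono-≤ (0≤W zero (suc u))) 0≤hi lo² hi²
  b : Fin n → Bool
  b = proj₁ signs
  ξ : Fin n → ℚ
  ξ u = if b u then hi u else lo u
  ξ² : ∀ u → ξ u * ξ u ≤ 1ℚ
  ξ² u = if-elim (λ x → x * x ≤ 1ℚ) (b u) (hi² u) (lo² u)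
  ξ-def : ∀ u → 𝟙 (b u) - w u ≡ ξ u
  ξ-def u = 𝟙-if (b u) (w u)
  adj′ : Fin (suc n) → Fin (suc n) → Bool
  adj′ zero zero = false
  adj′ zero (suc j) = b j
  adj′ (suc i) zero = b i
  adj′ (suc i) (suc j) = adj I.H i j
  sym′ : ∀ u v → adj′ u v ≡ adj′ v u
  sym′ zero zero = refl
  sym′ zero (suc j) = refl
  sym′ (suc i) zero = refl
  sym′ (suc i) (suc j) = Graph.sym I.H i j
  irrefl′ : ∀ u → adj′ u u ≡ false
  irrefl′ zero = refl
  irrefl′ (suc i) = irrefl I.H i
  U V : Fin (suc n) → Fin (suc n) → ℚ
  U zero zero = 0ℚ
  U zero (suc j) = ξ j
  U (suc i) zero = 0ℚ
  U (suc i) (suc j) = I.U i j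
  V zero zero = W zero zero
  V zero (suc j) = 0ℚ
  V (suc i) zero = 0ℚ
  V (suc i) (suc j) = I.V i j
  split′ : ∀ u v → 𝟙 (adj′ u v) - W u v ≡ U u v + U v u - V u v
  split′ zero zero = refl
  split′ zero (suc j) = trans (ξ-def j) (l (ξ j))
    where
    l : ∀ x → x ≡ x + 0ℚ - 0ℚ
    l = solve-∀ ℚ-ring
  split′ (suc i) zero = trans (cong (λ z → 𝟙 (b i) - z) (symW (suc i) zero)) (trans (ξ-def i) (l (ξ i)))
    where
    l : ∀ x → x ≡ 0ℚ + x - 0ℚ
    l = solve-∀ ℚ-ring
  split′ (suc i) (suc j) = I.split i j
  U² : ∀ u v → U u v * U u v ≤ 1ℚ
  U² zero zero = 0≤1
  U² zero (suc j) = ξ² j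
  U² (suc i) zero = 0≤1
  U² (suc i) (suc j) = I.U²≤1 i j
  0≤V′ : ∀ u v → 0ℚ ≤ V u v
  0≤V′ zero zero = 0≤W zero zero
  0≤V′ zero (suc j) = ≤-refl
  0≤V′ (suc i) zero = ≤-refl
  0≤V′ (suc i) (suc j) = I.0≤V i j
  expand₂ : ∀ (F : Fin (suc n) → Fin (suc n) → ℚ) →
    ∑₂ F ≡ (F zero zero + ∑ (λ j → F zero (suc j))) + (∑ (λ i → F (suc i) zero) + ∑₂ (λ i j → F (suc i) (suc j)))
  expand₂ F = trans (∑-suc (λ u → ∑ (F u))) (cong₂ _+_ (∑-suc (F zero))
    (trans (∑-cong λ i → ∑-suc (F (suc i))) (∑-+ _ _)))
  ∑0 : ∑ {n} (λ _ → 0ℚ) ≡ 0ℚ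
  ∑0 = trans (∑-const n 0ℚ) (*-zeroʳ (ℕ→ℚ n))
  ν : ℚ
  ν = ℕ→ℚ n
  ∑V′ : ∑₂ V ≤ ℕ→ℚ (suc n)
  ∑V′ = subst₂ _≤_ (sym (trans (expand₂ V) (trans (cong₂ (λ a b → (W zero zero + a) + (b + ∑₂ I.V))
      ∑0 ∑0) (l (W zero zero) (∑₂ I.V)))))
    (sym (ℕ→ℚ-suc n)) (+-mono-≤ (W≤1 zero zero) I.∑V≤)
    where
    l : ∀ x y → (x + 0ℚ) + (0ℚ + y) ≡ x + y
    l = solve-∀ ℚ-ring
  dot : Fin (suc n) → Fin (suc n) → ℚ
  dot u u′ = ∑ λ v → U u v * U u′ v
  d : Fin n → ℚ
  d i = ∑ λ j → ξ j * I.U i j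
  drop0 : ∀ x y z → x ≡ 0ℚ → x * y + z ≡ z
  drop0 x y z refl = trans (cong (_+ z) (*-zeroˡ y)) (+-identityˡ z)
  dot-00 : dot zero zero ≡ ∑ (λ j → ξ j * ξ j)
  dot-00 = trans (∑-suc (λ v → U zero v * U zero v)) (drop0 0ℚ 0ℚ _ refl)
  dot-0s : ∀ i → dot zero (suc i) ≡ d i
  dot-0s i = trans (∑-suc (λ v → U zero v * U (suc i) v)) (drop0 0ℚ 0ℚ _ refl)
  dot-s0 : ∀ i → dot (suc i) zero ≡ d i
  dot-s0 i = trans (∑-suc (λ v → U (suc i) v * U zero v)) (trans (drop0 0ℚ 0ℚ _ refl)
    (∑-cong λ j → *-comm (I.U i j) (ξ j)))
  dot-ss : ∀ i i′ → dot (suc i) (suc i′) ≡ I.dot i i′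
  dot-ss i i′ = trans (∑-suc (λ v → U (suc i) v * U (suc i′) v)) (drop0 0ℚ 0ℚ _ refl)
  sq-cong : ∀ {x y : ℚ} → x ≡ y → x * x ≡ y * y
  sq-cong = cong λ z → z * z
  n₀ D Φ E E′ ζ : ℚ
  n₀ = ∑ (λ j → ξ j * ξ j)
  D = ∑ (λ i → d i * d i)
  Φ = ∑₂ (λ i i′ → I.dot i i′ * I.dot i i′)
  E = I.drift
  ζ = ∑ (λ j → ξ j * σ zero (suc j))
  E′ = ∑₂ (λ u v → σ u v * U u v)
  Φ′≡ : ∑₂ (λ u u′ → dot u u′ * dot u u′) ≡ (n₀ * n₀ + D) + (D + Φ)
  Φ′≡ = trans (expand₂ (λ u u′ → dot u u′ * dot u u′))
    (cong₂ _+_ (cong₂ _+_ (sq-cong dot-00) (∑-cong λ i → sq-cong (dot-0s i)))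
      (cong₂ _+_ (∑-cong λ i → sq-cong (dot-s0 i)) (∑₂-cong λ i i′ → sq-cong (dot-ss i i′))))
  E′≡ : E′ ≡ E + ζ
  E′≡ = trans (expand₂ (λ u v → σ u v * U u v)) (trans
    (cong₂ (λ a b → (a + ∑ (λ j → σ zero (suc j) * ξ j)) + (b + E)) (*-zeroʳ (σ zero zero))
      (trans (∑-cong λ i → *-zeroʳ (σ (suc i) zero)) ∑0))
    (trans (cong (λ z → (0ℚ + z) + (0ℚ + E)) (∑-cong λ j → *-comm (σ zero (suc j)) (ξ j))) (l ζ E)))
    where
    l : ∀ x y → (0ℚ + x) + (0ℚ + y) ≡ y + x
    l = solve-∀ ℚ-ring
  greedy : (E + ζ) * (E + ζ) + D ≤ E * E + (ν + ν * ν)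
  greedy = ≤-trans (≤-reflexive lhs≡) (≤-trans (proj₂ signs) (+-mono-≤ (≤-reflexive accs) cs))
    where
    lhs≡ : (E + ζ) * (E + ζ) + D ≡ ∑ (λ j → (A j + ∑ (λ u → ξ u * c u j)) * (A j + ∑ (λ u → ξ u * c u j)))
    lhs≡ = sym (trans (∑-suc (λ j → (A j + ∑ (λ u → ξ u * c u j)) * (A j + ∑ (λ u → ξ u * c u j))))
      (cong ((E + ζ) * (E + ζ) +_) (∑-cong λ i → sq-cong (+-identityˡ (d i)))))
    accs : ∑ (λ j → A j * A j) ≡ E * E
    accs = trans (∑-suc (λ j → A j * A j)) (trans (cong (E * E +_)
        (trans (∑-cong {n} (λ _ → *-zeroˡ 0ℚ)) ∑0)) (+-identityʳ (E * E)))
    cs : ∑₂ (λ u j → c u j * c u j) ≤ ν + ν * ν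
    cs = ≤-trans (≤-reflexive (trans (∑-cong λ u → ∑-suc (λ j → c u j * c u j)) (∑-+ _ _)))
      (+-mono-≤ (≤-trans (∑-mono λ u → σ² zero (suc u)) (≤-reflexive (trans (∑-const n 1ℚ) (*-identityʳ ν))))
        (≤-trans (∑₂-mono λ u i → I.U²≤1 i u) (≤-reflexive (trans (∑₂-const {n} {n} 1ℚ) (*-identityʳ (ν * ν))))))
  0≤n₀ : 0ℚ ≤ n₀
  0≤n₀ = 0≤∑ λ j → 0≤² (ξ j)
  n₀≤ν : n₀ ≤ ν
  n₀≤ν = ≤-trans (∑-mono ξ²) (≤-reflexive (trans (∑-const n 1ℚ) (*-identityʳ ν)))
  -- Twice n + n², plus n² for the new diagonal codegree, is 3 n² + 2 n, whereas 3 (n + 1)³ exceeds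
  -- 3 n³ by 9 n² + 9 n + 3; the surplus 6 n² + 7 n + 3 closes the certificate.
  bound′ : ∑₂ (λ u u′ → dot u u′ * dot u u′) + 2ℚ * (E′ * E′) ≤ ℕ→ℚ 3 * cube (ℕ→ℚ (suc n))
  bound′ = subst₂ _≤_ (sym (cong₂ (λ a b → a + 2ℚ * (b * b)) Φ′≡ E′≡))
      (cong (λ z → ℕ→ℚ 3 * cube z) (sym (ℕ→ℚ-suc n)))
    (≤-by (0≤+ (0≤+ (0≤* (0≤ℕ 2) (≤⇒0≤- greedy)) (≤⇒0≤- I.bound))
            (0≤+ (≤⇒0≤- (*-mono 0≤n₀ (0≤ℕ n) n₀≤ν n₀≤ν))
                (0≤+ (0≤+ (0≤* (0≤ℕ 6) (0≤² ν)) (0≤* (0≤ℕ 7) (0≤ℕ n))) (0≤ℕ 3))))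
      (l ν n₀ D Φ E ζ))
    where
    l : ∀ ν n₀ D Φ E ζ →
      (2ℚ * ((E * E + (ν + ν * ν)) - ((E + ζ) * (E + ζ) + D)) + (ℕ→ℚ 3 * (ν * ν * ν) - (Φ + 2ℚ * (E * E))))
        + ((ν * ν - n₀ * n₀) + ((ℕ→ℚ 6 * (ν * ν) + ℕ→ℚ 7 * ν) + ℕ→ℚ 3))
      ≡ ℕ→ℚ 3 * ((1ℚ + ν) * (1ℚ + ν) * (1ℚ + ν)) - (((n₀ * n₀ + D) + (D + Φ)) + 2ℚ * ((E + ζ) * (E + ζ)))
    l = solve-∀ ℚ-ring

square-cancel : ∀ {x b} → 0ℚ ≤ b → x * x ≤ b * b → x ≤ b
square-cancel {x} {b} 0≤b h with x ≤? b
... | yes x≤b = x≤b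
... | no x≰b = ⊥-elim (<⇒≱ (≤-<-trans (*-monoʳ 0≤b (<⇒≤ b<x))
    (*-monoˡ-<-pos x {{ℚ.positive (≤-<-trans 0≤b b<x)}} b<x)) h)
  where
  b<x : b < x
  b<x = ≰⇒> x≰b

∣∣≤-square : ∀ {x b} → 0ℚ ≤ b → x * x ≤ b * b → ∣ x ∣ ≤ b
∣∣≤-square {x} {b} 0≤b h = ∣∣≤ (square-cancel 0≤b h) (square-cancel 0≤b (subst (_≤ b * b) (l x) h))
  where
  l : ∀ x → x * x ≡ (- x) * (- x)
  l = solve-∀ ℚ-ring

-- Cut norm and drift of the rounding error

module _ {n : ℕ} {W σ : Fin n → Fin n → ℚ} (ρ : Rounding W σ) where
  open Rounding ρ
  private
    ν N : ℚ
    ν = ℕ→ℚ n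
    N = ν * ν

  cut : (Fin n → ℚ) → (Fin n → ℚ) → ℚ
  cut s t = ∑₂ λ u v → s u * t v * U u v

  private
    Φ : ℚ
    Φ = ∑₂ λ u u′ → dot u u′ * dot u u′

    0≤Φ : 0ℚ ≤ Φ
    0≤Φ = 0≤∑₂ λ u u′ → 0≤² (dot u u′)

    0≤E² : 0ℚ ≤ drift * drift
    0≤E² = 0≤² drift

    0≤N : 0ℚ ≤ N
    0≤N = 0≤² ν

  -- Cauchy–Schwarz twice: the cut norm is controlled by the codegrees, which the greedy choice keeps small.
  cut⁴≤ : ∀ {s t} → (∀ u → s u * s u ≤ 1ℚ) → (∀ v → t v * t v ≤ 1ℚ) →
    (cut s t * cut s t) * (cut s t * cut s t) ≤ N * N * Φ
  cut⁴≤ {s} {t} s² t² = ≤-trans (*-mono (0≤² x) (0≤* (0≤ℕ n) 0≤z) x²≤ x²≤)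
    (≤-trans (≤-reflexive (l₁ ν z)) (≤-trans (*-monoʳ 0≤N z²≤) (≤-reflexive (l₂ ν Φ))))
    where
    open ≡-Reasoning
    l₁ : ∀ ν z → (ν * z) * (ν * z) ≡ (ν * ν) * (z * z)
    l₁ = solve-∀ ℚ-ring
    l₂ : ∀ ν Φ → (ν * ν) * (ν * (ν * Φ)) ≡ (ν * ν) * (ν * ν) * Φ
    l₂ = solve-∀ ℚ-ring
    l₃ : ∀ a b c → a * b * c ≡ b * (a * c)
    l₃ = solve-∀ ℚ-ring
    l₄ : ∀ t y → 1ℚ * (y * y) - (t * y) * (t * y) ≡ (1ℚ - t * t) * (y * y)
    l₄ = solve-∀ ℚ-ring
    x z : ℚ
    x = cut s t
    y : Fin n → ℚ
    y v = ∑ λ u → s u * U u v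
    z = ∑ λ v → y v * y v
    0≤z : 0ℚ ≤ z
    0≤z = 0≤∑ λ v → 0≤² (y v)
    x≡ : x ≡ ∑ (λ v → t v * y v)
    x≡ = trans (∑₂-comm _) (∑-cong λ v → trans (∑-cong λ u → l₃ (s u) (t v) (U u v)) (∑-* (t v) _))
    shrink : ∀ v → (t v * y v) * (t v * y v) ≤ y v * y v
    shrink v = subst ((t v * y v) * (t v * y v) ≤_) (*-identityˡ (y v * y v))
      (≤-by (0≤* (≤⇒0≤- (t² v)) (0≤² (y v))) (sym (l₄ (t v) (y v))))
    x²≤ : x * x ≤ ν * z
    x²≤ = subst (λ a → a * a ≤ ν * z) (sym x≡)
      (≤-trans (∑-cauchy (λ v → t v * y v)) (*-monoʳ (0≤ℕ n) (∑-mono shrink)))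
    F : Fin n → Fin n → ℚ
    F u u′ = s u * s u′ * dot u u′
    l₅ : ∀ a b c d → (a * b) * (c * d) ≡ a * c * (b * d)
    l₅ = solve-∀ ℚ-ring
    y² : ∀ v → y v * y v ≡ ∑₂ (λ u u′ → s u * s u′ * (U u v * U u′ v))
    y² v = trans (sym (∑-* (y v) (λ u → s u * U u v))) (∑-cong λ u → trans (*-comm (y v) (s u * U u v))
      (trans (sym (∑-* (s u * U u v) (λ u′ → s u′ * U u′ v))) (∑-cong λ u′ → l₅ (s u) (U u v) (s u′) (U u′ v))))
    z≡ : z ≡ ∑₂ F
    z≡ = begin
      z ≡⟨ ∑-cong y² ⟩
      ∑ (λ v → ∑₂ (λ u u′ → s u * s u′ * (U u v * U u′ v)))
          ≡⟨ ∑₂-comm (λ v u → ∑ (λ u′ → s u * s u′ * (U u v * U u′ v))) ⟩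
      ∑ (λ u → ∑₂ (λ v u′ → s u * s u′ * (U u v * U u′ v)))
          ≡⟨ ∑-cong (λ u → ∑₂-comm (λ v u′ → s u * s u′ * (U u v * U u′ v))) ⟩
      ∑₂ (λ u u′ → ∑ (λ v → s u * s u′ * (U u v * U u′ v)))
          ≡⟨ ∑₂-cong (λ u u′ → ∑-* (s u * s u′) (λ v → U u v * U u′ v)) ⟩
      ∑₂ F ∎
    l₆ : ∀ a b d → (a * b * d) * (a * b * d) ≡ (a * a) * (b * b) * (d * d)
    l₆ = solve-∀ ℚ-ring
    z²≤ : z * z ≤ ν * (ν * Φ)
    z²≤ = subst (λ a → a * a ≤ ν * (ν * Φ)) (sym z≡) (≤-trans (∑₂-cauchy F)
      (*-monoʳ (0≤ℕ n) (*-monoʳ (0≤ℕ n) (∑₂-mono λ u u′ →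
        subst₂ _≤_ (sym (l₆ (s u) (s u′) (dot u u′))) (*-identityˡ (dot u u′ * dot u u′))
          (*-monoˡ (0≤² (dot u u′)) (*-mono (0≤² (s u)) 0≤1 (s² u) (s² u′)))))))

  module _ {θ : ℚ} (0≤θ : 0ℚ ≤ θ) (θ≤1 : θ ≤ 1ℚ) (large : ℕ→ℚ 3 ≤ θ * θ * (θ * θ) * ν) where
    private
      0≤θN : 0ℚ ≤ θ * N
      0≤θN = 0≤* 0≤θ 0≤N

      0≤θ² : 0ℚ ≤ θ * θ
      0≤θ² = 0≤² θ

      θ²≤1 : θ * θ ≤ 1ℚ
      θ²≤1 = x²≤1 0≤θ θ≤1

      large² : ℕ→ℚ 3 ≤ θ * θ * ν
      large² = ≤-trans large (*-monoˡ (0≤ℕ n) (subst (θ * θ * (θ * θ) ≤_) (*-identityʳ (θ * θ))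
          (*-monoʳ 0≤θ² θ²≤1)))

      large¹ : ℕ→ℚ 3 ≤ θ * ν
      large¹ = ≤-trans large² (*-monoˡ (0≤ℕ n) (subst (θ * θ ≤_) (*-identityʳ θ) (*-monoʳ 0≤θ θ≤1)))

      ν≤ : ν ≤ θ * N
      ν≤ = subst₂ _≤_ (*-identityˡ ν) (*-assoc θ ν ν)
          (*-monoˡ (0≤ℕ n) (≤-trans (ℕ→ℚ-mono {1} {3} (s≤s z≤n)) large¹))

      Φ≤ : Φ ≤ ℕ→ℚ 3 * cube ν
      Φ≤ = ≤-trans (≤-by (0≤* (0≤ℕ 2) 0≤E²) (l Φ (drift * drift))) bound
        where
        l : ∀ a b → 2ℚ * b ≡ (a + 2ℚ * b) - a
        l = solve-∀ ℚ-ring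

    -- `cut⁴≤` and the codegree bound make the fourth power at most 3 n⁷, and `large` turns this
    -- into θ⁴ n⁸.
    cut≤ : ∀ {s t} → (∀ u → s u * s u ≤ 1ℚ) → (∀ v → t v * t v ≤ 1ℚ) → ∣ cut s t ∣ ≤ θ * N
    cut≤ {s} {t} s² t² = ∣∣≤-square 0≤θN (square-cancel (0≤² (θ * N)) (≤-trans (cut⁴≤ {s} {t} s² t²)
      (≤-trans (*-monoʳ (0≤* 0≤N 0≤N) Φ≤) (≤-by (0≤* (0≤* (0≤* 0≤N 0≤N) (0≤* (0≤ℕ n) 0≤N))
          (≤⇒0≤- large)) (l ν θ)))))
      where
      l : ∀ ν θ → (ν * ν) * (ν * ν) * (ν * (ν * ν)) * (θ * θ * (θ * θ) * ν - ℕ→ℚ 3)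
        ≡ (θ * (ν * ν)) * (θ * (ν * ν)) * ((θ * (ν * ν)) * (θ * (ν * ν))) - (ν * ν) * (ν * ν) *
            (ℕ→ℚ 3 * (ν * ν * ν))
      l = solve-∀ ℚ-ring

    drift≤ : ∣ drift ∣ ≤ θ * N
    drift≤ = ∣∣≤-square 0≤θN (*-cancelˡ {c = 1ℚ + 1ℚ} (0<ℕ {2} (s≤s z≤n)) (≤-trans
      (≤-trans (≤-by 0≤Φ (l₁ Φ (drift * drift))) bound)
      (≤-by (0≤+ (0≤* (0≤* (0≤ℕ n) 0≤N) (≤⇒0≤- large²)) (0≤* 0≤θ² (0≤* 0≤N 0≤N))) (l₂ ν θ))))
      where
      l₁ : ∀ a b → a ≡ (a + 2ℚ * b) - 2ℚ * b
      l₁ = solve-∀ ℚ-ring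
      l₂ : ∀ ν θ → ν * (ν * ν) * (θ * θ * ν - ℕ→ℚ 3) + θ * θ * ((ν * ν) * (ν * ν))
        ≡ 2ℚ * ((θ * (ν * ν)) * (θ * (ν * ν))) - ℕ→ℚ 3 * (ν * ν * ν)
      l₂ = solve-∀ ℚ-ring

    private
      R : Fin n → Fin n → ℚ
      R u v = 𝟙 (adj H u v) - W u v

      ∑₂-split : ∀ (w : Fin n → Fin n → ℚ) → ∑₂ (λ u v → w u v * R u v)
        ≡ ∑₂ (λ u v → w u v * U u v) + ∑₂ (λ u v → w v u * U u v) - ∑₂ (λ u v → w u v * V u v)
      ∑₂-split w = trans (∑₂-cong λ u v → trans (cong (w u v *_) (split u v)) (l (w u v) (U u v) (U v u) (V u v)))
        (trans (∑₂-- (λ u v → w u v * U u v + w u v * U v u) (λ u v → w u v * V u v))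
          (cong (_- ∑₂ (λ u v → w u v * V u v)) (trans (∑₂-+ (λ u v → w u v * U u v) (λ u v → w u v * U v u))
            (cong (∑₂ (λ u v → w u v * U u v) +_) (∑₂-comm (λ u v → w u v * U v u))))))
        where
        l : ∀ w a b c → w * (a + b - c) ≡ w * a + w * b - w * c
        l = solve-∀ ℚ-ring

      three : ∀ {a b c} → ∣ a ∣ ≤ θ * N → ∣ b ∣ ≤ θ * N → ∣ c ∣ ≤ ν → ∣ a + b - c ∣ ≤ ℕ→ℚ 3 * (θ * N)
      three {a} {b} {c} ha hb hc = ≤-trans (∣p-q∣≤∣p∣+∣q∣ (a + b) c)
        (≤-trans (+-mono-≤ (≤-trans (∣p+q∣≤∣p∣+∣q∣ a b) (+-mono-≤ ha hb)) (≤-trans hc ν≤))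
            (≤-reflexive (l (θ * N))))
        where
        l : ∀ x → x + x + x ≡ ℕ→ℚ 3 * x
        l = solve-∀ ℚ-ring

      wV : ∀ {w : Fin n → Fin n → ℚ} → (∀ u v → w u v ≤ 1ℚ) → (∀ u v → - w u v ≤ 1ℚ) → ∣ ∑₂
          (λ u v → w u v * V u v) ∣ ≤ ν
      wV {w} w≤1 -w≤1 = ∣∣≤
        (≤-trans (∑₂-mono λ u v → subst (w u v * V u v ≤_) (*-identityˡ (V u v)) (*-monoˡ (0≤V u v) (w≤1 u v))) ∑V≤)
        (≤-trans (≤-reflexive neg) (≤-trans
          (∑₂-mono λ u v → subst ((- w u v) * V u v ≤_) (*-identityˡ (V u v)) (*-monoˡ (0≤V u v) (-w≤1 u v))) ∑V≤))
        where
        l₁ : ∀ a → - a ≡ (- 1ℚ) * a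
        l₁ = solve-∀ ℚ-ring
        l₂ : ∀ a b → (- 1ℚ) * (a * b) ≡ (- a) * b
        l₂ = solve-∀ ℚ-ring
        neg : - ∑₂ (λ u v → w u v * V u v) ≡ ∑₂ (λ u v → (- w u v) * V u v)
        neg = trans (l₁ _) (trans (sym (∑₂-* (- 1ℚ) (λ u v → w u v * V u v))) (∑₂-cong λ u v → l₂ (w u v) (V u v)))

    -- The error of `H` is U plus its transpose minus V. The transposed term is a cut of U with S
    -- and T exchanged, and V has total mass at most n ≤ θ N; so each of the three terms is at most
    -- θ N.
    rounding-cut : ∀ S T → ∣ ∑₂ (λ u v → 𝟙 (S u) * 𝟙 (T v) * R u v) ∣ ≤ ℕ→ℚ 3 * (θ * N)
    rounding-cut S T = subst (λ z → ∣ z ∣ ≤ ℕ→ℚ 3 * (θ * N)) (sym (∑₂-split w))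
      (three (cut≤ {𝟙 ∘ S} {𝟙 ∘ T} (𝟙² S) (𝟙² T))
        (subst (λ z → ∣ z ∣ ≤ θ * N) (∑₂-cong λ u v → cong (_* U u v) (*-comm (𝟙 (T u)) (𝟙 (S v))))
            (cut≤ {𝟙 ∘ T} {𝟙 ∘ S} (𝟙² T) (𝟙² S)))
        (wV {w} (λ u v → *-mono (0≤𝟙 (S u)) 0≤1 (𝟙≤1 (S u)) (𝟙≤1 (T v)))
          (λ u v → ≤-trans (neg-antimono-≤ (0≤* (0≤𝟙 (S u)) (0≤𝟙 (T v)))) 0≤1)))
      where
      w : Fin n → Fin n → ℚ
      w u v = 𝟙 (S u) * 𝟙 (T v)
      𝟙² : ∀ (S : VSet n) u → 𝟙 (S u) * 𝟙 (S u) ≤ 1ℚ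
      𝟙² S u = x²≤1 (0≤𝟙 (S u)) (𝟙≤1 (S u))

    rounding-drift : Symmetric σ → (∀ u v → σ u v ≤ 1ℚ) → (∀ u v → - σ u v ≤ 1ℚ) →
      ∑₂ (λ u v → σ u v * R u v) ≤ ℕ→ℚ 3 * (θ * N)
    rounding-drift symσ σ≤1 -σ≤1 = ≤-trans (x≤∣x∣ _) (subst (λ z → ∣ z ∣ ≤ ℕ→ℚ 3 * (θ * N)) (sym (∑₂-split σ))
      (three drift≤ (subst (λ z → ∣ z ∣ ≤ θ * N) (∑₂-cong λ u v → cong (_* U u v) (symσ u v))
          drift≤) (wV σ≤1 -σ≤1)))

-- Moving the density of every block from y to x

-- The factor r by which the deviation from the density y is rescaled when the density is moved to x,
-- with s = 1 if this deletes edges and s = -1 if it adds edges.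
Rescaling : ℚ → ℚ → ℚ → ℚ → Set
Rescaling x y r s =
  (x ≤ y × r * y ≡ x × s ≡ 1ℚ) ⊎ (y ≤ x × r * (1ℚ - y) ≡ 1ℚ - x × s ≡ - 1ℚ)

scaleSign : ℚ → ℚ → ℚ × ℚ
scaleSign x y with x ≤? y
... | yes _ with 0ℚ <? y
...   | yes 0<y = x * inv y 0<y , 1ℚ
-- For two densities this means x = y = 0, so every factor in the unit interval satisfies
-- `Rescaling`. The last default below concerns y ≥ 1 together with x > y, which densities exclude.
...   | no _ = 1ℚ , 1ℚ
scaleSign x y | no _ with 0ℚ <? (1ℚ - y)
...   | yes h = (1ℚ - x) * inv (1ℚ - y) h , - 1ℚ
...   | no _ = 1ℚ , - 1ℚ

scale : ℚ → ℚ → ℚ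
scale x y = proj₁ (scaleSign x y)

scaleSign-spec : ∀ {x y} → 0ℚ ≤ x → x ≤ 1ℚ → 0ℚ ≤ y → y ≤ 1ℚ →
  0ℚ ≤ scale x y × scale x y ≤ 1ℚ × Rescaling x y (scale x y) (proj₂ (scaleSign x y))
scaleSign-spec {x} {y} 0≤x x≤1 0≤y y≤1 with x ≤? y
... | yes x≤y with 0ℚ <? y
...   | yes 0<y = 0≤* 0≤x 0≤i
    , subst (x * inv y 0<y ≤_) (inv-*ʳ y 0<y) (*-monoˡ 0≤i x≤y)
    , inj₁ (x≤y , trans (*-assoc x _ y) (trans (cong (x *_) (inv-*ˡ y 0<y)) (*-identityʳ x)) , refl)
  where
  0≤i : 0ℚ ≤ inv y 0<y
  0≤i = <⇒≤ (0<inv y 0<y)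
...   | no y≯0 = 0≤1 , ≤-refl , inj₁ (x≤y , trans (*-identityˡ y)
        (≤-antisym (≤-trans (≮⇒≥ y≯0) 0≤x) x≤y) , refl)
scaleSign-spec {x} {y} 0≤x x≤1 0≤y y≤1 | no x≰y with 0ℚ <? (1ℚ - y)
... | yes h = 0≤* (≤⇒0≤- x≤1) 0≤i
    , subst ((1ℚ - x) * inv (1ℚ - y) h ≤_) (inv-*ʳ (1ℚ - y) h) (*-monoˡ 0≤i (+-monoʳ-≤ 1ℚ (neg-antimono-≤ y≤x)))
    , inj₂ (y≤x , trans (*-assoc (1ℚ - x) _ (1ℚ - y))
        (trans (cong ((1ℚ - x) *_) (inv-*ˡ (1ℚ - y) h)) (*-identityʳ (1ℚ - x))) , refl)
  where
  y≤x : y ≤ x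
  y≤x = <⇒≤ (≰⇒> x≰y)
  0≤i : 0ℚ ≤ inv (1ℚ - y) h
  0≤i = <⇒≤ (0<inv (1ℚ - y) h)
... | no h = ⊥-elim (h (<⇒0<- (<-≤-trans (≰⇒> x≰y) x≤1)))

complement≤1 : ∀ {r} → 0ℚ ≤ r → 1ℚ - r ≤ 1ℚ
complement≤1 {r} 0≤r = ≤-by 0≤r (l r)
  where
  l : ∀ r → r ≡ 1ℚ - (1ℚ - r)
  l = solve-∀ ℚ-ring

private
  solveFor-x : ∀ x y r → r * (1ℚ - y) ≡ 1ℚ - x → x ≡ 1ℚ - r * (1ℚ - y)
  solveFor-x x y r eq = trans (l x) (cong (λ z → 1ℚ - z) (sym eq))
    where
    l : ∀ x → x ≡ 1ℚ - (1ℚ - x)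
    l = solve-∀ ℚ-ring

-- When edges are deleted, x = r y and the weight is r on edges and 0 elsewhere; when they are
-- added, it is 1 on edges and 1 - r elsewhere. Thus all changes within a block go in one direction.
rescaled-value : ∀ {x y r s} → 0ℚ ≤ r → r ≤ 1ℚ → Rescaling x y r s →
  ∀ b → 0ℚ ≤ x + r * (𝟙 b - y) × x + r * (𝟙 b - y) ≤ 1ℚ
rescaled-value {x} {y} {r} 0≤r r≤1 (inj₁ (_ , refl , _)) true =
  subst (λ z → 0ℚ ≤ z × z ≤ 1ℚ) (l r y) (0≤r , r≤1)
  where
  l : ∀ r y → r ≡ r * y + r * (1ℚ - y)
  l = solve-∀ ℚ-ring
rescaled-value {x} {y} {r} 0≤r r≤1 (inj₁ (_ , refl , _)) false =
  subst (λ z → 0ℚ ≤ z × z ≤ 1ℚ) (l r y) (≤-refl , 0≤1)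
  where
  l : ∀ r y → 0ℚ ≡ r * y + r * (0ℚ - y)
  l = solve-∀ ℚ-ring
rescaled-value {x} {y} {r} 0≤r r≤1 (inj₂ (_ , eq , _)) true = subst (λ z → 0ℚ ≤ z × z ≤ 1ℚ)
  (trans (l r y) (cong (λ z → z + r * (1ℚ - y)) (sym (solveFor-x x y r eq)))) (0≤1 , ≤-refl)
  where
  l : ∀ r y → 1ℚ ≡ 1ℚ - r * (1ℚ - y) + r * (1ℚ - y)
  l = solve-∀ ℚ-ring
rescaled-value {x} {y} {r} 0≤r r≤1 (inj₂ (_ , eq , _)) false = subst (λ z → 0ℚ ≤ z × z ≤ 1ℚ)
  (trans (l r y) (cong (λ z → z + r * (0ℚ - y)) (sym (solveFor-x x y r eq)))) (≤⇒0≤- r≤1 , complement≤1 0≤r)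
  where
  l : ∀ r y → 1ℚ - r ≡ 1ℚ - r * (1ℚ - y) + r * (0ℚ - y)
  l = solve-∀ ℚ-ring

-- The second term is a block constant times the deviation from the block density, so it cancels
-- over a block. What remains is the change of density, however G is spread inside the block.
rescaled-cost : ∀ {x y r s} → Rescaling x y r s → ∀ b →
  (1ℚ - 2ℚ * 𝟙 b) * (x + r * (𝟙 b - y) - 𝟙 b) ≡ ∣ y - x ∣ + s * (1ℚ - r) * (𝟙 b - y)
rescaled-cost {x} {y} {r} (inj₁ (x≤y , refl , refl)) b = trans (value b)
  (cong (_+ 1ℚ * (1ℚ - r) * (𝟙 b - y)) (sym (0≤p⇒∣p∣≡p (≤⇒0≤- x≤y))))
  where
  lᵗ : ∀ r y → (1ℚ - 2ℚ * 1ℚ) * (r * y + r * (1ℚ - y) - 1ℚ) ≡ y - r * y + 1ℚ * (1ℚ - r) * (1ℚ - y)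
  lᵗ = solve-∀ ℚ-ring
  lᶠ : ∀ r y → (1ℚ - 2ℚ * 0ℚ) * (r * y + r * (0ℚ - y) - 0ℚ) ≡ y - r * y + 1ℚ * (1ℚ - r) * (0ℚ - y)
  lᶠ = solve-∀ ℚ-ring
  value : ∀ b → (1ℚ - 2ℚ * 𝟙 b) * (r * y + r * (𝟙 b - y) - 𝟙 b) ≡ y - r * y + 1ℚ * (1ℚ - r) * (𝟙 b - y)
  value true = lᵗ r y
  value false = lᶠ r y
rescaled-cost {x} {y} {r} (inj₂ (y≤x , eq , refl)) b = trans (value b)
  (cong (_+ (- 1ℚ) * (1ℚ - r) * (𝟙 b - y)) (trans (sym (0≤p⇒∣p∣≡p (≤⇒0≤- y≤x)))
    (trans (sym (∣-p∣≡∣p∣ (x - y))) (cong ∣_∣ (neg x y)))))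
  where
  neg : ∀ x y → - (x - y) ≡ y - x
  neg = solve-∀ ℚ-ring
  lᵗ : ∀ r y → (1ℚ - 2ℚ * 1ℚ) * (1ℚ - r * (1ℚ - y) + r * (1ℚ - y) - 1ℚ) ≡ 1ℚ - r * (1ℚ - y) - y +
      (- 1ℚ) * (1ℚ - r) * (1ℚ - y)
  lᵗ = solve-∀ ℚ-ring
  lᶠ : ∀ r y → (1ℚ - 2ℚ * 0ℚ) * (1ℚ - r * (1ℚ - y) + r * (0ℚ - y) - 0ℚ) ≡ 1ℚ - r * (1ℚ - y) - y +
      (- 1ℚ) * (1ℚ - r) * (0ℚ - y)
  lᶠ = solve-∀ ℚ-ring
  value : ∀ b → (1ℚ - 2ℚ * 𝟙 b) * (x + r * (𝟙 b - y) - 𝟙 b) ≡ x - y + (- 1ℚ) * (1ℚ - r) * (𝟙 b - y)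
  value true = subst (λ z → (1ℚ - 2ℚ * 1ℚ) * (z + r * (1ℚ - y) - 1ℚ) ≡ z - y + (- 1ℚ) * (1ℚ - r) *
      (1ℚ - y)) (sym (solveFor-x x y r eq)) (lᵗ r y)
  value false = subst (λ z → (1ℚ - 2ℚ * 0ℚ) * (z + r * (0ℚ - y) - 0ℚ) ≡ z - y + (- 1ℚ) * (1ℚ - r) *
      (0ℚ - y)) (sym (solveFor-x x y r eq)) (lᶠ r y)

adjacency : ∀ {n} → Graph n → Fin n → Fin n → ℚ
adjacency G u v = 𝟙 (adj G u v)

-- flipSign G u v * (adjacency H u v - adjacency G u v) is the indicator of a flip from G to H.
flipSign : ∀ {n} → Graph n → Fin n → Fin n → ℚ
flipSign G u v = 1ℚ - 2ℚ * adjacency G u v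

module _ {n k l : ℕ} (G : Graph n) (c₀ : Fin n → Fin k) (c : Fin n → Fin l) (c≼c₀ : c ≼ c₀) where
  private
    X D₀ D σ W : Fin n → Fin n → ℚ
    X = adjacency G
    D₀ = blockAverage c₀ X
    D = blockAverage c X
    σ = flipSign G
    W u v = D₀ u v + scale (D₀ u v) (D u v) * (X u v - D u v)

    N : ℚ
    N = ℕ→ℚ n * ℕ→ℚ n

    0≤X : ∀ u v → 0ℚ ≤ X u v
    0≤X u v = 0≤𝟙 (adj G u v)

    X≤1 : ∀ u v → X u v ≤ 1ℚ
    X≤1 u v = 𝟙≤1 (adj G u v)

    spec : ∀ u v → 0ℚ ≤ scale (D₀ u v) (D u v) × scale (D₀ u v) (D u v) ≤ 1ℚ
      × Rescaling (D₀ u v) (D u v) (scale (D₀ u v) (D u v)) (proj₂ (scaleSign (D₀ u v) (D u v)))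
    spec u v = scaleSign-spec (0≤blockAverage c₀ X 0≤X u v) (blockAverage≤1 c₀ X X≤1 u v)
      (0≤blockAverage c X 0≤X u v) (blockAverage≤1 c X X≤1 u v)

    W∈[0,1] : ∀ u v → 0ℚ ≤ W u v × W u v ≤ 1ℚ
    W∈[0,1] u v = let 0≤r , r≤1 , sp = spec u v in rescaled-value {r = scale (D₀ u v) (D u v)} 0≤r r≤1 sp (adj G u v)

    X-sym : Symmetric X
    X-sym u v = cong 𝟙 (Graph.sym G u v)

    W-sym : Symmetric W
    W-sym u v rewrite X-sym u v | blockAverage-sym c₀ X X-sym u v | blockAverage-sym c X X-sym u v = refl

    σ≤1 : ∀ u v → σ u v ≤ 1ℚ × - σ u v ≤ 1ℚ × σ u v * σ u v ≤ 1ℚ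
    σ≤1 u v with adj G u v
    ... | true = ℕ≤ , ≤-refl , ≤-refl
      where
      ℕ≤ : - 1ℚ ≤ 1ℚ
      ℕ≤ = ≤-trans (neg-antimono-≤ 0≤1) 0≤1
    ... | false = ≤-refl , ≤-trans (neg-antimono-≤ 0≤1) 0≤1 , ≤-refl

    dot-split : ∀ (w A B C : Fin n → Fin n → ℚ) → (∀ u v → A u v ≡ B u v + C u v) →
      ∑₂ (λ u v → w u v * A u v) ≡ ∑₂ (λ u v → w u v * B u v) + ∑₂ (λ u v → w u v * C u v)
    dot-split w A B C eq = trans (∑₂-cong λ u v → trans (cong (w u v *_) (eq u v))
        (*-distribˡ-+ (w u v) (B u v) (C u v)))
      (∑₂-+ (λ u v → w u v * B u v) (λ u v → w u v * C u v))

    fractionalCost : ∑₂ (λ u v → σ u v * (W u v - X u v)) ≡ ∑₂ (λ u v → ∣ D u v - D₀ u v ∣)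
    fractionalCost = begin
      ∑₂ (λ u v → σ u v * (W u v - X u v))
        ≡⟨ ∑₂-cong (λ u v → rescaled-cost {r = scale (D₀ u v) (D u v)} (proj₂ (proj₂ (spec u v))) (adj G u v)) ⟩
      ∑₂ (λ u v → ∣ D u v - D₀ u v ∣ + b u v * (X u v - D u v))
        ≡⟨ ∑₂-+ (λ u v → ∣ D u v - D₀ u v ∣) (λ u v → b u v * (X u v - D u v)) ⟩
      ∑₂ (λ u v → ∣ D u v - D₀ u v ∣) + ∑₂ (λ u v → b u v * (X u v - D u v))
        -- `b` is constant on the blocks of c, so X may be replaced by its block average, and the
        -- sum vanishes.
        ≡⟨ cong (∑₂ (λ u v → ∣ D u v - D₀ u v ∣) +_) (trans (∑₂-refine X 0≤X X≤1 {c = c} {c′ = c} (λ _ _ p → p) mb)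
             (∑₂-martingale X 0≤X X≤1 {c = c} {c′ = c} (λ _ _ p → p) mb)) ⟩
      ∑₂ (λ u v → ∣ D u v - D₀ u v ∣) + 0ℚ ≡⟨ +-identityʳ _ ⟩
      ∑₂ (λ u v → ∣ D u v - D₀ u v ∣) ∎
      where
      open ≡-Reasoning
      b : Fin n → Fin n → ℚ
      b u v = proj₂ (scaleSign (D₀ u v) (D u v)) * (1ℚ - scale (D₀ u v) (D u v))
      mb : Meas₂ c b
      mb u v u′ v′ p q = cong₂ (λ x y → proj₂ (scaleSign x y) * (1ℚ - scale x y))
        (blockAverage-meas c₀ X u v u′ v′ (c≼c₀ u u′ p) (c≼c₀ v v′ q)) (blockAverage-meas c X u v u′ v′ p q)

  -- The rounding takes `flipSign` as its drift weight, so that the surplus of actual over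
  -- fractional edits is controlled as a drift. The difference H - D₀ splits into the rounding error
  -- H - W and the rescaled deviation, which the cut hypothesis bounds.
  regularApproximation : ∀ {θ γ} → 0ℚ ≤ θ → θ ≤ 1ℚ → ℕ→ℚ 3 ≤ θ * θ * (θ * θ) * ℕ→ℚ n →
    (∀ S T → ∣ ∑₂ (λ u v → 𝟙 (S u) * 𝟙 (T v) * scale (D₀ u v) (D u v) * (X u v - D u v)) ∣ ≤ γ * N) →
    Σ (Graph n) λ H →
      (∀ S T → ∣ ∑₂ (λ u v → 𝟙 (S u) * 𝟙 (T v) * (adjacency H u v - D₀ u v)) ∣ ≤ ℕ→ℚ 3 * (θ * N) + γ * N)
      × ∑₂ (λ u v → σ u v * (adjacency H u v - X u v)) ≤ ℕ→ℚ 3 * (θ * N) + ∑₂ (λ u v → ∣ D u v - D₀ u v ∣)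
  regularApproximation {θ} {γ} 0≤θ θ≤1 large cutReg = H , cutBound , costBound
    where
    rounded : Rounding W σ
    rounded = greedyRounding W σ (λ u v → proj₁ (W∈[0,1] u v)) (λ u v → proj₂ (W∈[0,1] u v)) W-sym
        (λ u v → proj₂ (proj₂ (σ≤1 u v)))
    H : Graph n
    H = Rounding.H rounded
    l₁ : ∀ h a z → h - a ≡ (h - (a + z)) + z
    l₁ = solve-∀ ℚ-ring
    l₂ : ∀ h w x → h - x ≡ (h - w) + (w - x)
    l₂ = solve-∀ ℚ-ring
    discrepancyᶜ : VSet n → VSet n → ℚ
    discrepancyᶜ S T = ∑₂ (λ u v → 𝟙 (S u) * 𝟙 (T v) * scale (D₀ u v) (D u v) * (X u v - D u v))
    cutBound : ∀ S T → ∣ ∑₂ (λ u v → 𝟙 (S u) * 𝟙 (T v) * (adjacency H u v - D₀ u v)) ∣ ≤ ℕ→ℚ 3 * (θ * N) + γ * N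
    cutBound S T = subst (λ z → ∣ z ∣ ≤ ℕ→ℚ 3 * (θ * N) + γ * N) (sym eq)
      (≤-trans (∣p+q∣≤∣p∣+∣q∣ (∑₂ (λ u v → 𝟙 (S u) * 𝟙 (T v) * (adjacency H u v - W u v)))
          (discrepancyᶜ S T)) (+-mono-≤ (rounding-cut rounded 0≤θ θ≤1 large S T) (cutReg S T)))
      where
      eq : ∑₂ (λ u v → 𝟙 (S u) * 𝟙 (T v) * (adjacency H u v - D₀ u v))
        ≡ ∑₂ (λ u v → 𝟙 (S u) * 𝟙 (T v) * (adjacency H u v - W u v))
          + ∑₂ (λ u v → 𝟙 (S u) * 𝟙 (T v) * scale (D₀ u v) (D u v) * (X u v - D u v))
      eq = trans (dot-split (λ u v → 𝟙 (S u) * 𝟙 (T v)) _ (λ u v → adjacency H u v - W u v)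
          (λ u v → scale (D₀ u v) (D u v) * (X u v - D u v))
          (λ u v → l₁ (adjacency H u v) (D₀ u v) (scale (D₀ u v) (D u v) * (X u v - D u v))))
        (cong (∑₂ (λ u v → 𝟙 (S u) * 𝟙 (T v) * (adjacency H u v - W u v)) +_)
          (∑₂-cong λ u v → sym (*-assoc (𝟙 (S u) * 𝟙 (T v)) (scale (D₀ u v) (D u v)) (X u v - D u v))))
    costBound : ∑₂ (λ u v → σ u v * (adjacency H u v - X u v)) ≤ ℕ→ℚ 3 * (θ * N) + ∑₂ (λ u v → ∣ D u v - D₀ u v ∣)
    costBound = subst (_≤ ℕ→ℚ 3 * (θ * N) + ∑₂ (λ u v → ∣ D u v - D₀ u v ∣))
      (sym (dot-split σ _ (λ u v → adjacency H u v - W u v) (λ u v → W u v - X u v)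
        (λ u v → l₂ (adjacency H u v) (W u v) (X u v))))
      (+-mono-≤ (rounding-drift rounded 0≤θ θ≤1 large (λ u v → cong (λ z → 1ℚ - 2ℚ * z) (X-sym u v))
        (λ u v → proj₁ (σ≤1 u v)) (λ u v → proj₁ (proj₂ (σ≤1 u v)))) (≤-reflexive fractionalCost))

-- A convex potential at all dyadic scales

half^ : ℕ → ℚ
half^ zero = 1ℚ
half^ (suc j) = ℚ.½ * half^ j

2^-suc : ∀ j → 2^ (suc j) ≡ 2ℚ * 2^ j
2^-suc j = ℕ→ℚ-* 2 (2 ℕ.^ j)

0≤half^ : ∀ j → 0ℚ ≤ half^ j
0≤half^ zero = 0≤1
0≤half^ (suc j) = 0≤* (nonNegative⁻¹ ℚ.½) (0≤half^ j)

2^*half^ : ∀ j → 2^ j * half^ j ≡ 1ℚ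
2^*half^ zero = refl
2^*half^ (suc j) = trans (cong (_* half^ (suc j)) (2^-suc j)) (trans (l (2^ j) (half^ j)) (2^*half^ j))
  where
  l : ∀ x y → (2ℚ * x) * (ℚ.½ * y) ≡ x * y
  l = solve-∀ ℚ-ring

0≤2^ : ∀ j → 0ℚ ≤ 2^ j
0≤2^ j = 0≤ℕ (2 ℕ.^ j)

-- The Huber function at scale h = 1/p: quadratic up to h and linear beyond.
huber : ℚ → ℚ → ℚ → ℚ
huber p h x = p * (2ℚ * (x ⊓ h) * x - (x ⊓ h) * (x ⊓ h))

module _ {p h : ℚ} (0≤p : 0ℚ ≤ p) (0≤h : 0ℚ ≤ h) (ph : p * h ≡ 1ℚ) where

  huber-small : ∀ {x} → x ≤ h → huber p h x ≡ p * (x * x)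
  huber-small {x} x≤h = trans (cong (λ s → p * (2ℚ * s * x - s * s)) (p≤q⇒p⊓q≡p x≤h)) (l p x)
    where
    l : ∀ p x → p * (2ℚ * x * x - x * x) ≡ p * (x * x)
    l = solve-∀ ℚ-ring

  0≤⊓ : ∀ {x} → 0ℚ ≤ x → 0ℚ ≤ x ⊓ h
  0≤⊓ 0≤x = ⊓-glb 0≤x 0≤h

  0≤huber : ∀ {x} → 0ℚ ≤ x → 0ℚ ≤ huber p h x
  0≤huber {x} 0≤x = subst (0ℚ ≤_) (l p x (x ⊓ h))
    (0≤* 0≤p (0≤+ (0≤* (0≤⊓ 0≤x) 0≤x) (0≤* (0≤⊓ 0≤x) (≤⇒0≤- (p⊓q≤p x h)))))
    where
    l : ∀ p x s → p * (s * x + s * (x - s)) ≡ p * (2ℚ * s * x - s * s)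
    l = solve-∀ ℚ-ring

  huber≤ : ∀ {x} → 0ℚ ≤ x → huber p h x ≤ 2ℚ * x
  huber≤ {x} 0≤x = ≤-by
    (0≤+ (0≤* (0≤* (0≤ℕ 2) 0≤x) (0≤* 0≤p (≤⇒0≤- (p⊓q≤q x h)))) (0≤* 0≤p (0≤² (x ⊓ h))))
    (trans (l p h x (x ⊓ h)) (trans (cong (λ z → 2ℚ * x * z - huber p h x) ph)
        (cong (_- huber p h x) (*-identityʳ (2ℚ * x)))))
    where
    l : ∀ p h x s → 2ℚ * x * (p * (h - s)) + p * (s * s)
      ≡ 2ℚ * x * (p * h) - p * (2ℚ * s * x - s * s)
    l = solve-∀ ℚ-ring

  slope : ℚ → ℚ
  slope x = 2ℚ * p * (x ⊓ h)

  -- Convexity with an explicit subgradient. Under refinement the linear term sums to zero, so only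
  -- the excess over the tangent counts.
  huber-tangent : ∀ x y → huber p h x + slope x * (y - x) ≤ huber p h y
  huber-tangent x y with ≤-total y h
  ... | inj₁ y≤h = subst (huber p h x + slope x * (y - x) ≤_) (sym (huber-small y≤h))
    (≤-by (0≤* 0≤p (0≤² (y - x ⊓ h))) (l p x y (x ⊓ h)))
    where
    l : ∀ p x y s → p * ((y - s) * (y - s)) ≡ p * (y * y) - (p * (2ℚ * s * x - s * s) + 2ℚ * p * s * (y - x))
    l = solve-∀ ℚ-ring
  ... | inj₂ h≤y = subst (huber p h x + slope x * (y - x) ≤_)
      (sym (cong (λ s → p * (2ℚ * s * y - s * s)) (p≥q⇒p⊓q≡q h≤y)))
    (≤-by (0≤* 0≤p (0≤* (≤⇒0≤- s≤h) (0≤+ (≤⇒0≤- h≤y) (≤⇒0≤- (≤-trans s≤h h≤y))))) (l p h x y (x ⊓ h)))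
    where
    s≤h : x ⊓ h ≤ h
    s≤h = p⊓q≤q x h
    l : ∀ p h x y s → p * ((h - s) * ((y - h) + (y - s)))
      ≡ p * (2ℚ * h * y - h * h) - (p * (2ℚ * s * x - s * s) + 2ℚ * p * s * (y - x))
    l = solve-∀ ℚ-ring

  -- The quadratic gain p (y - x)² is bounded below linearly by AM-GM.
  huber-gain : ∀ {x y θ} → x ≤ h → y ≤ h →
    huber p h x + slope x * (y - x) + (2ℚ * θ * ∣ y - x ∣ - θ * θ * h) ≤ huber p h y
  huber-gain {x} {y} {θ} x≤h y≤h = ≤-by (0≤* 0≤p (0≤² (∣ y - x ∣ - θ * h))) (begin
    p * ((a - θ * h) * (a - θ * h)) ≡⟨ l₁ p h a θ ⟩
    p * (a * a) - (2ℚ * θ * a * (p * h) - θ * θ * h * (p * h))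
      ≡⟨ cong₂ (λ w z → p * w - (2ℚ * θ * a * z - θ * θ * h * z)) a² ph ⟩
    p * ((y - x) * (y - x)) - (2ℚ * θ * a * 1ℚ - θ * θ * h * 1ℚ) ≡⟨ l₂ p h x y a θ ⟩
    p * (y * y) - (p * (x * x) + 2ℚ * p * x * (y - x) + (2ℚ * θ * a - θ * θ * h))
      ≡⟨ cong₂ (λ w z → w - (z + 2ℚ * p * x * (y - x) + (2ℚ * θ * a - θ * θ * h)))
          (sym (huber-small y≤h)) (sym (huber-small x≤h)) ⟩
    huber p h y - (huber p h x + 2ℚ * p * x * (y - x) + (2ℚ * θ * a - θ * θ * h))
      ≡⟨ cong (λ w → huber p h y - (huber p h x + 2ℚ * p * w * (y - x) + (2ℚ * θ * a - θ * θ * h)))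
          (sym (p≤q⇒p⊓q≡p x≤h)) ⟩
    huber p h y - (huber p h x + slope x * (y - x) + (2ℚ * θ * a - θ * θ * h)) ∎)
    where
    open ≡-Reasoning
    a : ℚ
    a = ∣ y - x ∣
    a² : a * a ≡ (y - x) * (y - x)
    a² with ∣p∣≡p∨∣p∣≡-p (y - x)
    ... | inj₁ eq = cong (λ z → z * z) eq
    ... | inj₂ eq = trans (cong (λ z → z * z) eq) (l (y - x))
      where
      l : ∀ z → (- z) * (- z) ≡ z * z
      l = solve-∀ ℚ-ring
    l₁ : ∀ p h a θ → p * ((a - θ * h) * (a - θ * h)) ≡ p * (a * a) - (2ℚ * θ * a * (p * h) - θ * θ * h * (p * h))
    l₁ = solve-∀ ℚ-ring
    l₂ : ∀ p h x y a θ → p * ((y - x) * (y - x)) - (2ℚ * θ * a * 1ℚ - θ * θ * h * 1ℚ)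
      ≡ p * (y * y) - (p * (x * x) + 2ℚ * p * x * (y - x) + (2ℚ * θ * a - θ * θ * h))
    l₂ = solve-∀ ℚ-ring

level : ℕ → ℚ → ℚ
level j = huber (2^ j) (half^ j)

levelSlope : ℕ → ℚ → ℚ
levelSlope j = slope (0≤2^ j) (0≤half^ j) (2^*half^ j)

-- A rational stand-in for x log x: near x the levels of scale above x are quadratic and the others
-- linear, and the curvatures 2 · 2^j of the former form a geometric sum of order 1 / max(x, 2^-L).
multiscale : ℕ → ℚ → ℚ
multiscale zero x = level 0 x
multiscale (suc L) x = level (suc L) x + multiscale L x

multiscaleSlope : ℕ → ℚ → ℚ
multiscaleSlope zero x = levelSlope 0 x
multiscaleSlope (suc L) x = levelSlope (suc L) x + multiscaleSlope L x

multiscale-tangent : ∀ L x y → multiscale L x + multiscaleSlope L x * (y - x) ≤ multiscale L y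
multiscale-tangent zero x y = huber-tangent (0≤2^ 0) (0≤half^ 0) (2^*half^ 0) x y
multiscale-tangent (suc L) x y = ≤-trans (≤-reflexive
    (l (level (suc L) x) (multiscale L x) (levelSlope (suc L) x) (multiscaleSlope L x) (y - x)))
  (+-mono-≤ (huber-tangent (0≤2^ (suc L)) (0≤half^ (suc L)) (2^*half^ (suc L)) x y) (multiscale-tangent L x y))
  where
  l : ∀ a b s t z → (a + b) + (s + t) * z ≡ (a + s * z) + (b + t * z)
  l = solve-∀ ℚ-ring

-- Only the scale h with M ≤ h < 2 M contributes to the gain.
multiscale-gain : ∀ L {x y M θ} → x ≤ M → y ≤ M → M ≤ 1ℚ → half^ L ≤ 2ℚ * M →
  multiscale L x + multiscaleSlope L x * (y - x) + (2ℚ * θ * ∣ y - x ∣ - 2ℚ * (θ * θ) * M) ≤ multiscale L y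
multiscale-gain zero {x} {y} {M} {θ} x≤M y≤M M≤1 h≤2M = ≤-trans
  (+-monoʳ-≤ (level 0 x + levelSlope 0 x * (y - x)) (≤-by (0≤* (0≤² θ) (≤⇒0≤- h≤2M)) (l θ ∣ y - x ∣ M 1ℚ)))
  (huber-gain (0≤2^ 0) (0≤half^ 0) (2^*half^ 0) {θ = θ} (≤-trans x≤M M≤1) (≤-trans y≤M M≤1))
  where
  l : ∀ θ a M h → θ * θ * (2ℚ * M - h) ≡ (2ℚ * θ * a - θ * θ * h) - (2ℚ * θ * a - 2ℚ * (θ * θ) * M)
  l = solve-∀ ℚ-ring
multiscale-gain (suc L) {x} {y} {M} {θ} x≤M y≤M M≤1 h≤2M with M ≤? half^ (suc L)
... | yes M≤h = ≤-trans
  (+-monoʳ-≤ (multiscale (suc L) x + multiscaleSlope (suc L) x * (y - x))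
      (≤-by (0≤* (0≤² θ) (≤⇒0≤- h≤2M)) (l₁ θ ∣ y - x ∣ M (half^ (suc L)))))
  (≤-trans (≤-reflexive (l₂ (level (suc L) x) (multiscale L x) (levelSlope (suc L) x)
      (multiscaleSlope L x) (y - x) _))
  (+-mono-≤ (huber-gain (0≤2^ (suc L)) (0≤half^ (suc L)) (2^*half^ (suc L)) {θ = θ}
      (≤-trans x≤M M≤h) (≤-trans y≤M M≤h)) (multiscale-tangent L x y)))
  where
  l₁ : ∀ θ a M h → θ * θ * (2ℚ * M - h) ≡ (2ℚ * θ * a - θ * θ * h) - (2ℚ * θ * a - 2ℚ * (θ * θ) * M)
  l₁ = solve-∀ ℚ-ring
  l₂ : ∀ a b s t z g → (a + b) + (s + t) * z + g ≡ (a + s * z + g) + (b + t * z)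
  l₂ = solve-∀ ℚ-ring
... | no M≰h = ≤-trans
  (≤-reflexive (l₂ (level (suc L) x) (multiscale L x) (levelSlope (suc L) x) (multiscaleSlope L x) (y - x) _))
  (+-mono-≤ (huber-tangent (0≤2^ (suc L)) (0≤half^ (suc L)) (2^*half^ (suc L)) x y)
    (multiscale-gain L {θ = θ} x≤M y≤M M≤1 (≤-trans (≤-reflexive (l₁ (half^ L)))
        (*-monoʳ (0≤ℕ 2) (<⇒≤ (≰⇒> M≰h))))))
  where
  l₁ : ∀ h → h ≡ 2ℚ * (ℚ.½ * h)
  l₁ = solve-∀ ℚ-ring
  l₂ : ∀ a b s t z g → (a + b) + (s + t) * z + g ≡ (a + s * z) + (b + t * z + g)
  l₂ = solve-∀ ℚ-ring

0≤multiscale : ∀ L {x} → 0ℚ ≤ x → 0ℚ ≤ multiscale L x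
0≤multiscale zero 0≤x = 0≤huber (0≤2^ 0) (0≤half^ 0) (2^*half^ 0) 0≤x
0≤multiscale (suc L) 0≤x = 0≤+ (0≤huber (0≤2^ (suc L)) (0≤half^ (suc L)) (2^*half^ (suc L)) 0≤x)
    (0≤multiscale L 0≤x)

multiscale≤ : ∀ L {x} → 0ℚ ≤ x → multiscale L x ≤ ℕ→ℚ (suc L) * (2ℚ * x)
multiscale≤ zero {x} 0≤x = subst (level 0 x ≤_) (sym (*-identityˡ (2ℚ * x)))
    (huber≤ (0≤2^ 0) (0≤half^ 0) (2^*half^ 0) 0≤x)
multiscale≤ (suc L) {x} 0≤x = ≤-trans
  (+-mono-≤ (huber≤ (0≤2^ (suc L)) (0≤half^ (suc L)) (2^*half^ (suc L)) 0≤x) (multiscale≤ L 0≤x))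
  (≤-reflexive (trans (l (2ℚ * x) (ℕ→ℚ (suc L))) (cong (_* (2ℚ * x)) (sym (ℕ→ℚ-suc (suc L))))))
  where
  l : ∀ z m → z + m * z ≡ (1ℚ + m) * z
  l = solve-∀ ℚ-ring

multiscale-0 : ∀ {x} → x ≤ 1ℚ → multiscale 0 x ≡ x * x
multiscale-0 {x} x≤1 = trans (huber-small (0≤2^ 0) (0≤half^ 0) (2^*half^ 0) x≤1) (*-identityˡ (x * x))

-- The potential of a colouring and its increase under refinement

module _ {n : ℕ} (X : Fin n → Fin n → ℚ) (0≤X : ∀ u v → 0ℚ ≤ X u v) (X≤1 : ∀ u v → X u v ≤ 1ℚ) where
  private
    D : ∀ {l} → (Fin n → Fin l) → Fin n → Fin n → ℚ
    D c = blockAverage c X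

    N : ℚ
    N = ℕ→ℚ n * ℕ→ℚ n

    0≤D : ∀ {l} (c : Fin n → Fin l) u v → 0ℚ ≤ D c u v
    0≤D c = 0≤blockAverage c X 0≤X

    D≤1 : ∀ {l} (c : Fin n → Fin l) u v → D c u v ≤ 1ℚ
    D≤1 c = blockAverage≤1 c X X≤1

  ∑₂-blockAverage : ∀ {l} (c : Fin n → Fin l) → ∑₂ (D c) ≡ ∑₂ X
  ∑₂-blockAverage c = trans (∑₂-cong λ u v → sym (*-identityˡ (D c u v)))
    (trans (blockAverage-∑ c X {λ _ _ → 1ℚ} (λ _ _ _ _ _ _ → refl)) (∑₂-cong λ u v → *-identityˡ (X u v)))

  potential : ∀ {l} → ℕ → (Fin n → Fin l) → ℚ
  potential L c = ∑₂ λ u v → multiscale L (D c u v)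

  0≤potential : ∀ {l} L (c : Fin n → Fin l) → 0ℚ ≤ potential L c
  0≤potential L c = 0≤∑₂ λ u v → 0≤multiscale L (0≤D c u v)

  potential≤ : ∀ {l} L (c : Fin n → Fin l) → potential L c ≤ ℕ→ℚ (suc L) * (2ℚ * ∑₂ X)
  potential≤ L c = ≤-trans (∑₂-mono λ u v → multiscale≤ L (0≤D c u v)) (≤-reflexive
    (trans (∑₂-* (ℕ→ℚ (suc L)) (λ u v → 2ℚ * D c u v)) (cong (ℕ→ℚ (suc L) *_)
      (trans (∑₂-* 2ℚ (D c)) (cong (2ℚ *_) (∑₂-blockAverage c))))))

  potential-0≤ : ∀ {l} (c : Fin n → Fin l) → potential 0 c ≤ ∑₂ X
  potential-0≤ c = subst (potential 0 c ≤_) (∑₂-blockAverage c) (∑₂-mono λ u v →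
    subst₂ _≤_ (sym (multiscale-0 (D≤1 c u v))) (*-identityʳ (D c u v)) (*-monoʳ (0≤D c u v) (D≤1 c u v)))

  module _ {d : ℚ} (0≤d : 0ℚ ≤ d) (d≤1 : d ≤ 1ℚ) (mass : ∑₂ X ≡ d * N) where

    -- At scale 1 the potential is Σ D²; the tangent to x² at the mean density d bounds it from
    -- below.
    ≤potential-0 : ∀ {l} (c : Fin n → Fin l) → d * d * N ≤ potential 0 c
    ≤potential-0 c = subst (_≤ potential 0 c) total (∑₂-mono λ u v →
      subst (2ℚ * d * D c u v + (- (d * d)) * 1ℚ ≤_) (sym (multiscale-0 (D≤1 c u v)))
        (≤-by (0≤² (D c u v - d)) (l₁ (D c u v) d)))
      where
      l₁ : ∀ x d → (x - d) * (x - d) ≡ x * x - (2ℚ * d * x + (- (d * d)) * 1ℚ)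
      l₁ = solve-∀ ℚ-ring
      l₂ : ∀ d N → 2ℚ * d * (d * N) + (- (d * d)) * (N * 1ℚ) ≡ d * d * N
      l₂ = solve-∀ ℚ-ring
      total : ∑₂ (λ u v → 2ℚ * d * D c u v + (- (d * d)) * 1ℚ) ≡ d * d * N
      total = trans (∑₂-lin (2ℚ * d) (- (d * d)) (D c) (λ _ _ → 1ℚ))
        (trans (cong₂ (λ a b → 2ℚ * d * a + (- (d * d)) * b) (trans (∑₂-blockAverage c) mass)
            (∑₂-const 1ℚ)) (l₂ d N))

    -- The scale at each pair is M = max(x, y, d). Bounding it by x + y + d makes its sum at most 3
    -- d N, since all three have the same mass; this is the source of the 6. The slopes are constant
    -- on the blocks of c, so their terms cancel.
    potential-gain : ∀ {l l′} L {θ} {c : Fin n → Fin l} {c′ : Fin n → Fin l′} → c′ ≼ c → half^ L ≤ 2ℚ * d →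
      potential L c + (2ℚ * θ * ∑₂ (λ u v → ∣ D c′ u v - D c u v ∣) - ℕ→ℚ 6 * (θ * θ) * (d * N)) ≤ potential L c′
    potential-gain L {θ} {c} {c′} c′≼c h≤2d = subst (_≤ potential L c′) total (∑₂-mono pointwise)
      where
      x y : Fin n → Fin n → ℚ
      x = D c
      y = D c′
      Δ : ℚ
      Δ = ∑₂ λ u v → ∣ y u v - x u v ∣
      slopeTerm : Fin n → Fin n → ℚ
      slopeTerm u v = multiscaleSlope L (x u v) * (y u v - x u v)
      gain : Fin n → Fin n → ℚ
      gain u v = 2ℚ * θ * ∣ y u v - x u v ∣ + (- (2ℚ * (θ * θ))) * (x u v + y u v + d * 1ℚ)
      pointwise : ∀ u v → multiscale L (x u v) + slopeTerm u v + gain u v ≤ multiscale L (y u v)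
      pointwise u v = ≤-trans (+-monoʳ-≤ (multiscale L (x u v) + slopeTerm u v)
          (≤-by (0≤* (0≤* (0≤ℕ 2) (0≤² θ)) (≤⇒0≤- M≤)) (l θ ∣ y u v - x u v ∣ M (x u v) (y u v) d)))
        (multiscale-gain L {θ = θ} (≤-trans (p≤p⊔q (x u v) (y u v)) xy≤M) (≤-trans (p≤q⊔p (x u v) (y u v)) xy≤M)
          (⊔-lub (⊔-lub (D≤1 c u v) (D≤1 c′ u v)) d≤1)
          (≤-trans h≤2d (*-monoʳ (0≤ℕ 2) (p≤q⊔p (x u v ℚ.⊔ y u v) d))))
        where
        M : ℚ
        M = (x u v ℚ.⊔ y u v) ℚ.⊔ d
        xy≤M : x u v ℚ.⊔ y u v ≤ M
        xy≤M = p≤p⊔q (x u v ℚ.⊔ y u v) d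
        0≤x : 0ℚ ≤ x u v
        0≤x = 0≤D c u v
        0≤y : 0ℚ ≤ y u v
        0≤y = 0≤D c′ u v
        l₁ : ∀ x y d → y + d ≡ (x + y + d) - x
        l₁ = solve-∀ ℚ-ring
        l₂ : ∀ x y d → x + d ≡ (x + y + d) - y
        l₂ = solve-∀ ℚ-ring
        l₃ : ∀ x y d → x + y ≡ (x + y + d) - d
        l₃ = solve-∀ ℚ-ring
        M≤ : M ≤ x u v + y u v + d
        M≤ = ⊔-lub (⊔-lub (≤-by (0≤+ 0≤y 0≤d) (l₁ (x u v) (y u v) d)) (≤-by (0≤+ 0≤x 0≤d) (l₂ (x u v) (y u v) d)))
          (≤-by (0≤+ 0≤x 0≤y) (l₃ (x u v) (y u v) d))
        l : ∀ θ a M x y d → 2ℚ * (θ * θ) * ((x + y + d) - M)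
          ≡ (2ℚ * θ * a - 2ℚ * (θ * θ) * M) - (2ℚ * θ * a + (- (2ℚ * (θ * θ))) * (x + y + d * 1ℚ))
        l = solve-∀ ℚ-ring
      mk : Meas₂ c (λ u v → multiscaleSlope L (x u v))
      mk u v u′ v′ p q = cong (multiscaleSlope L) (blockAverage-meas c X u v u′ v′ p q)
      l₄ : ∀ θ Δ m → 2ℚ * θ * Δ + (- (2ℚ * (θ * θ))) * (m + m + m) ≡ 2ℚ * θ * Δ - ℕ→ℚ 6 * (θ * θ) * m
      l₄ = solve-∀ ℚ-ring
      ∑gain : ∑₂ gain ≡ 2ℚ * θ * Δ - ℕ→ℚ 6 * (θ * θ) * (d * N)
      ∑gain = trans (∑₂-lin (2ℚ * θ) (- (2ℚ * (θ * θ))) (λ u v → ∣ y u v - x u v ∣)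
          (λ u v → x u v + y u v + d * 1ℚ))
        (trans (cong (λ z → 2ℚ * θ * Δ + (- (2ℚ * (θ * θ))) * z) masses) (l₄ θ Δ (d * N)))
        where
        masses : ∑₂ (λ u v → x u v + y u v + d * 1ℚ) ≡ d * N + d * N + d * N
        masses = trans (∑₂-+ (λ u v → x u v + y u v) (λ _ _ → d * 1ℚ)) (cong₂ _+_
          (trans (∑₂-+ x y) (cong₂ _+_ (trans (∑₂-blockAverage c) mass) (trans (∑₂-blockAverage c′) mass)))
          (trans (∑₂-* d (λ _ _ → 1ℚ)) (cong (d *_) (trans (∑₂-const 1ℚ) (*-identityʳ N)))))
      total : ∑₂ (λ u v → multiscale L (x u v) + slopeTerm u v + gain u v)
        ≡ potential L c + (2ℚ * θ * Δ - ℕ→ℚ 6 * (θ * θ) * (d * N))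
      total = trans (∑₂-+ (λ u v → multiscale L (x u v) + slopeTerm u v) gain) (cong₂ _+_
        (trans (∑₂-+ (λ u v → multiscale L (x u v)) slopeTerm)
          (trans (cong (potential L c +_) (∑₂-martingale X 0≤X X≤1 {c = c} {c′ = c′} c′≼c mk))
              (+-identityʳ (potential L c)))) ∑gain)

-- Equitable refinements

suc-≟ : ∀ {k} (i j : Fin k) → ⌊ suc i Fin.≟ suc j ⌋ ≡ ⌊ i Fin.≟ j ⌋
suc-≟ i j with i Fin.≟ j
... | yes _ = refl
... | no _ = refl

∑-indicator : ∀ {k} (i : Fin k) → ∑ (λ a → 𝟙 ⌊ i Fin.≟ a ⌋) ≡ 1ℚ
∑-indicator {suc k} zero = trans (∑-suc (λ a → 𝟙 ⌊ zero Fin.≟ a ⌋))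
  (trans (cong (1ℚ +_) (trans (∑-const k 0ℚ) (*-zeroʳ (ℕ→ℚ k)))) (+-identityʳ 1ℚ))
∑-indicator {suc k} (suc i) = trans (∑-suc (λ a → 𝟙 ⌊ suc i Fin.≟ a ⌋))
  (trans (+-identityˡ _) (trans (∑-cong λ a → cong 𝟙 (suc-≟ i a)) (∑-indicator i)))

module _ {n l : ℕ} (A : VSet n) (f : Fin n → Fin l) where
  fibre : Fin l → VSet n
  fibre a v = A v ∧ ⌊ f v Fin.≟ a ⌋

  count-fibres : ℕ→ℚ (count A) ≡ ∑ (λ a → ℕ→ℚ (count (fibre a)))
  count-fibres = begin
    ℕ→ℚ (count A) ≡⟨ count-∑ A ⟩
    ∑ (λ v → 𝟙 (A v)) ≡⟨ ∑-cong (λ v → sym (trans (∑-cong λ a → 𝟙-∧ (A v) ⌊ f v Fin.≟ a ⌋)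
      (trans (∑-* (𝟙 (A v)) (λ a → 𝟙 ⌊ f v Fin.≟ a ⌋))
          (trans (cong (𝟙 (A v) *_) (∑-indicator (f v))) (*-identityʳ (𝟙 (A v))))))) ⟩
    ∑₂ (λ v a → 𝟙 (fibre a v)) ≡⟨ ∑₂-comm (λ v a → 𝟙 (fibre a v)) ⟩
    ∑₂ (λ a v → 𝟙 (fibre a v)) ≡⟨ ∑-cong (λ a → sym (count-∑ (fibre a))) ⟩
    ∑ (λ a → ℕ→ℚ (count (fibre a))) ∎
    where open ≡-Reasoning

  count≤ : ∀ {s} → (∀ a → count (fibre a) ℕ.≤ s) → count A ℕ.≤ l ℕ.* s
  count≤ {s} h = ℕ→ℚ-cancel-≤ (subst₂ _≤_ (sym count-fibres)
    (trans (∑-const l (ℕ→ℚ s)) (sym (ℕ→ℚ-* l s))) (∑-mono λ a → ℕ→ℚ-mono (h a)))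

  ≤count : ∀ {s} → (∀ a → s ℕ.≤ count (fibre a)) → l ℕ.* s ℕ.≤ count A
  ≤count {s} h = ℕ→ℚ-cancel-≤ (subst₂ _≤_
    (trans (∑-const l (ℕ→ℚ s)) (sym (ℕ→ℚ-* l s))) (sym count-fibres) (∑-mono λ a → ℕ→ℚ-mono (h a)))

count-cong : ∀ {n} {A B : VSet n} → (∀ v → A v ≡ B v) → count A ≡ count B
count-cong {zero} h = refl
count-cong {suc n} h = cong₂ ℕ._+_ (cong (λ b → if b then 1 else 0) (h zero)) (count-cong (h ∘ suc))

count-mono : ∀ {n} {A B : VSet n} → (∀ v → A v ≡ true → B v ≡ true) → count A ℕ.≤ count B
count-mono {zero} h = z≤n
count-mono {suc n} {A} {B} h = ℕᵖ.+-mono-≤ (le (A zero) (B zero) (h zero)) (count-mono (h ∘ suc))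
  where
  le : ∀ a b → (a ≡ true → b ≡ true) → (if a then 1 else 0) ℕ.≤ (if b then 1 else 0)
  le false b _ = z≤n
  le true true _ = ℕᵖ.≤-refl
  le true false h with h refl
  ... | ()

count-true : ∀ n → count {n} (λ _ → true) ≡ n
count-true zero = refl
count-true (suc n) = cong suc (count-true n)

count-positive : ∀ {n} (A : VSet n) → 0 ℕ.< count A → Σ (Fin n) λ v → A v ≡ true
count-positive {suc n} A h with A zero in eq
... | true = zero , eq
... | false = let v , p = count-positive (A ∘ suc) h in suc v , p

_∖_ : ∀ {n} → VSet n → VSet n → VSet n
(A ∖ B) v = if B v then false else A v

count-∖ : ∀ {n} {A B : VSet n} → (∀ v → B v ≡ true → A v ≡ true) → count A ≡ count B ℕ.+ count (A ∖ B)
count-∖ {zero} h = refl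
count-∖ {suc n} {A} {B} h = trans (cong₂ ℕ._+_ (head≡ (A zero) (B zero) (h zero))
    (count-∖ {A = A ∘ suc} {B ∘ suc} (h ∘ suc)))
  (l (if B zero then 1 else 0) _ (count (B ∘ suc)) _)
  where
  head≡ : ∀ a b → (b ≡ true → a ≡ true) → (if a then 1 else 0) ≡ (if b then 1 else 0) ℕ.+
      (if (if b then false else a) then 1 else 0)
  head≡ a false _ = refl
  head≡ a true h rewrite h refl = refl
  l : ∀ a b c d → (a ℕ.+ b) ℕ.+ (c ℕ.+ d) ≡ (a ℕ.+ c) ℕ.+ (b ℕ.+ d)
  l = ℕ-solve-∀

subsetOfSize : ∀ {n} (A : VSet n) s → s ℕ.≤ count A →
  Σ (VSet n) λ B → (∀ v → B v ≡ true → A v ≡ true) × count B ≡ s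
subsetOfSize {zero} A zero h = (λ ()) , (λ ()) , refl
subsetOfSize {suc n} A s h with A zero in eq
subsetOfSize {suc n} A s h | false = let B , B⊆A , cB = subsetOfSize (A ∘ suc) s h in
  (λ { zero → false ; (suc v) → B v }) , (λ { zero () ; (suc v) p → B⊆A v p }) , cB
subsetOfSize {suc n} A zero h | true = (λ _ → false) , (λ _ ()) , count-false (suc n)
  where
  count-false : ∀ n → count {n} (λ _ → false) ≡ 0
  count-false zero = refl
  count-false (suc n) = count-false n
subsetOfSize {suc n} A (suc s) (s≤s h) | true = let B , B⊆A , cB = subsetOfSize (A ∘ suc) s h in
  (λ { zero → true ; (suc v) → B v }) , (λ { zero _ → eq ; (suc v) p → B⊆A v p }) , cong suc cB

record Chopping {n l : ℕ} (A : VSet n) (f : Fin n → Fin l) (M t : ℕ) : Set where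
  field
    chunk : Fin n → Fin M
    size : ∀ j → count (λ v → A v ∧ ⌊ chunk v Fin.≟ j ⌋) ≡ t ⊎ count (λ v → A v ∧ ⌊ chunk v Fin.≟ j ⌋) ≡ suc t
    bad : Fin M → Bool
    monochromatic : ∀ j → bad j ≡ false → ∀ u v → A u ≡ true → A v ≡ true → chunk u ≡ j → chunk v ≡ j → f u ≡ f v
    bad≤ : count (λ v → A v ∧ bad (chunk v)) ℕ.≤ l ℕ.* suc t

∧-true : ∀ {a b} → a ∧ b ≡ true → a ≡ true × b ≡ true
∧-true {true} {true} _ = refl , refl

∧-intro : ∀ {a b} → a ≡ true → b ≡ true → a ∧ b ≡ true
∧-intro refl refl = refl

∧-identityʳ-true : ∀ {a b} → b ≡ true → a ∧ b ≡ a
∧-identityʳ-true {true} refl = refl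
∧-identityʳ-true {false} refl = refl

⌊≟⌋-sound : ∀ {k} {i j : Fin k} → ⌊ i Fin.≟ j ⌋ ≡ true → i ≡ j
⌊≟⌋-sound {i = i} {j} h with i Fin.≟ j
... | yes p = p
⌊≟⌋-sound {i = i} {j} () | no _

nonempty-colours : ∀ {n l} → (Fin n → Fin l) → Fin n → 0 ℕ.< l
nonempty-colours {l = suc l} f v = s≤s z≤n
nonempty-colours {l = zero} f v with f v
... | ()

-- Either B is monochromatic and costs nothing, or so few vertices are left that all of A may count
-- as bad; then the bound holds whatever the later chunks look like.
prependChunk : ∀ {n l M t} {A : VSet n} {f : Fin n → Fin l} (B : VSet n) → (∀ v → B v ≡ true → A v ≡ true) →
  count B ≡ t ⊎ count B ≡ suc t → Chopping (A ∖ B) f M t →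
  (∀ u v → B u ≡ true → B v ≡ true → f u ≡ f v) ⊎ count A ℕ.≤ l ℕ.* suc t → Chopping A f (suc M) t
prependChunk {n} {l} {M} {t} {A} {f} B B⊆A sizeB rest reason = record
  { chunk = chunk′ ; size = size′ ; bad = bad′ reason ; monochromatic = mono reason ; bad≤ = bound reason }
  where
  open Chopping rest
  place : Bool → Fin M → Fin (suc M)
  place b c = if b then zero else suc c
  chunk′ : Fin n → Fin (suc M)
  chunk′ v = place (B v) (chunk v)
  at-zero : ∀ a b c → (b ≡ true → a ≡ true) → a ∧ ⌊ place b c Fin.≟ zero ⌋ ≡ b
  at-zero a true c h = trans (∧-identityʳ-true refl) (h refl)
  at-zero true false c _ = refl
  at-zero false false c _ = refl
  at-suc : ∀ a b c j → a ∧ ⌊ place b c Fin.≟ suc j ⌋ ≡ (if b then false else a) ∧ ⌊ c Fin.≟ j ⌋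
  at-suc true true c j = refl
  at-suc false true c j = refl
  at-suc a false c j = cong (a ∧_) (suc-≟ c j)
  size′ : ∀ j → count (λ v → A v ∧ ⌊ chunk′ v Fin.≟ j ⌋) ≡ t ⊎ count (λ v → A v ∧ ⌊ chunk′ v Fin.≟ j ⌋) ≡ suc t
  size′ zero = subst (λ z → z ≡ t ⊎ z ≡ suc t) (sym (count-cong λ v → at-zero (A v) (B v) (chunk v) (B⊆A v))) sizeB
  size′ (suc j) = subst (λ z → z ≡ t ⊎ z ≡ suc t) (sym (count-cong λ v → at-suc (A v) (B v) (chunk v) j)) (size j)
  Reason : Set
  Reason = (∀ u v → B u ≡ true → B v ≡ true → f u ≡ f v) ⊎ count A ℕ.≤ l ℕ.* suc t
  bad′ : Reason → Fin (suc M) → Bool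
  bad′ (inj₁ _) zero = false
  bad′ (inj₂ _) zero = true
  bad′ _ (suc j) = bad j
  place-zero : ∀ b {c} → place b c ≡ zero → b ≡ true
  place-zero true _ = refl
  place-suc : ∀ b {c j a} → place b c ≡ suc j → a ≡ true → (if b then false else a) ≡ true × c ≡ j
  place-suc false refl p = p , refl
  mono : ∀ r j → bad′ r j ≡ false → ∀ u v → A u ≡ true → A v ≡ true → chunk′ u ≡ j → chunk′ v ≡ j → f u ≡ f v
  mono (inj₁ h) zero _ u v _ _ p q = h u v (place-zero (B u) p) (place-zero (B v) q)
  mono r (suc j) good u v Au Av p q = monochromatic j (unbad r good) u v
    (proj₁ (place-suc (B u) p Au)) (proj₁ (place-suc (B v) q Av)) (proj₂ (place-suc (B u) p Au))
        (proj₂ (place-suc (B v) q Av))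
    where
    unbad : ∀ r → bad′ r (suc j) ≡ false → bad j ≡ false
    unbad (inj₁ _) g = g
    unbad (inj₂ _) g = g
  bound : ∀ r → count (λ v → A v ∧ bad′ r (chunk′ v)) ℕ.≤ l ℕ.* suc t
  bound (inj₂ h) = ℕᵖ.≤-trans (count-mono {A = λ v → A v ∧ bad′ (inj₂ h) (chunk′ v)} {A} λ v p →
      proj₁ (∧-true {A v} p)) h
  bound (inj₁ h) = ℕᵖ.≤-trans (ℕᵖ.≤-reflexive (count-cong λ v → pt (A v) (B v) (chunk v))) bad≤
    where
    pt : ∀ a b c → a ∧ bad′ (inj₁ h) (place b c) ≡ (if b then false else a) ∧ bad c
    pt true true c = refl
    pt false true c = refl
    pt a false c = refl

-- As long as some colour still has a full chunk of vertices, a chunk is taken from it. When none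
-- has, at most l (t + 1) vertices remain. The first r chunks receive t + 1 vertices, the others t.
chop : ∀ {n l} (f : Fin n → Fin l) M t r (A : VSet n) → count A ≡ suc M ℕ.* t ℕ.+ r → r ℕ.≤ suc M →
    Chopping A f (suc M) t
chop {n} {l} f zero t r A cA r≤ = record
  { chunk = λ _ → zero
  ; size = λ { zero → size₀ r cA r≤ }
  ; bad = λ _ → true
  ; monochromatic = λ _ ()
  ; bad≤ = ℕᵖ.≤-trans (ℕᵖ.≤-reflexive (count-cong {A = λ v → A v ∧ true} {A} λ v → ∧-identityʳ-true refl)) total≤ }
  where
  size₀ : ∀ r → count A ≡ (t ℕ.+ 0) ℕ.+ r → r ℕ.≤ 1 →
    count (λ v → A v ∧ true) ≡ t ⊎ count (λ v → A v ∧ true) ≡ suc t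
  size₀ zero eq _ = inj₁ (trans (count-cong λ v → ∧-identityʳ-true {A v} refl)
      (trans eq (trans (ℕᵖ.+-identityʳ _) (ℕᵖ.+-identityʳ t))))
  size₀ (suc zero) eq _ = inj₂ (trans (count-cong λ v → ∧-identityʳ-true {A v} refl)
      (trans eq (trans (ℕᵖ.+-comm (t ℕ.+ 0) 1) (cong suc (ℕᵖ.+-identityʳ t)))))
  size₀ (suc (suc r)) eq (s≤s ())
  -- A single chunk has at most t + 1 vertices; that l is positive is read off from a vertex of A,
  -- hence the case distinction.
  total≤ : count A ℕ.≤ l ℕ.* suc t
  total≤ with count A in eq
  ... | zero = z≤n
  ... | suc m = ℕᵖ.≤-trans (ℕᵖ.≤-reflexive cA) (ℕᵖ.≤-trans (ℕᵖ.≤-trans (ℕᵖ.+-monoʳ-≤ (t ℕ.+ 0) r≤)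
      (ℕᵖ.≤-reflexive (trans (ℕᵖ.+-comm (t ℕ.+ 0) 1) (sym (cong (ℕ._+ 0) (refl {x = suc t}))))))
      (ℕᵖ.*-monoˡ-≤ (suc t) (nonempty-colours f (proj₁ (count-positive A (subst (0 ℕ.<_) (sym eq) (s≤s z≤n)))))))
chop {n} {l} f (suc M) t r A cA r≤ = go (takeSize r cA r≤)
  where
  takeSize : ∀ r → count A ≡ suc (suc M) ℕ.* t ℕ.+ r → r ℕ.≤ suc (suc M) →
    Σ ℕ λ s → (s ≡ t ⊎ s ≡ suc t) × Σ ℕ λ r′ → r′ ℕ.≤ suc M × count A ≡ s ℕ.+ (suc M ℕ.* t ℕ.+ r′)
  takeSize zero eq _ = t , inj₁ refl , 0 , z≤n , trans eq (ℕᵖ.+-assoc t (suc M ℕ.* t) 0)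
  takeSize (suc r) eq (s≤s r≤) = suc t , inj₂ refl , r , r≤ , trans eq (l₁ t (suc M ℕ.* t) r)
    where
    l₁ : ∀ t x r → t ℕ.+ x ℕ.+ suc r ≡ suc t ℕ.+ (x ℕ.+ r)
    l₁ = ℕ-solve-∀
  s≤ : ∀ {s} → s ≡ t ⊎ s ≡ suc t → s ℕ.≤ suc t
  s≤ (inj₁ refl) = ℕᵖ.n≤1+n t
  s≤ (inj₂ refl) = ℕᵖ.≤-refl
  rest : ∀ {s r′} (B : VSet n) → (∀ v → B v ≡ true → A v ≡ true) → count B ≡ s → r′ ℕ.≤ suc M →
    count A ≡ s ℕ.+ (suc M ℕ.* t ℕ.+ r′) → Chopping (A ∖ B) f (suc M) t
  rest {s} {r′} B B⊆A cB r′≤ cA′ = chop f M t r′ (A ∖ B)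
    (ℕᵖ.+-cancelˡ-≡ s _ _ (trans (cong (ℕ._+ count (A ∖ B)) (sym cB))
        (trans (sym (count-∖ {A = A} {B} B⊆A)) cA′))) r′≤
  go : (Σ ℕ λ s → (s ≡ t ⊎ s ≡ suc t) × Σ ℕ λ r′ → r′ ℕ.≤ suc M × count A ≡ s ℕ.+ (suc M ℕ.* t ℕ.+ r′)) →
    Chopping A f (suc (suc M)) t
  go (s , s≡ , r′ , r′≤ , cA′) with any? (λ a → s ℕ.≤? count (fibre A f a))
  ... | yes (a , s≤c) = let B , B⊆ , cB = subsetOfSize (fibre A f a) s s≤c
                            B⊆A = λ v p → proj₁ (∧-true (B⊆ v p))
                            colour = λ v p → ⌊≟⌋-sound {i = f v} {a} (proj₂ (∧-true {A v} (B⊆ v p))) in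
    prependChunk B B⊆A (subst (λ s → s ≡ t ⊎ s ≡ suc t) (sym cB) s≡) (rest B B⊆A cB r′≤ cA′)
      (inj₁ λ u v p q → trans (colour u p) (sym (colour v q)))
  ... | no none = let B , B⊆A , cB = subsetOfSize A s (ℕᵖ.≤-trans (ℕᵖ.m≤m+n s _) (ℕᵖ.≤-reflexive (sym cA′))) in
    prependChunk B B⊆A (subst (λ s → s ≡ t ⊎ s ≡ suc t) (sym cB) s≡) (rest B B⊆A cB r′≤ cA′)
      (inj₂ (count≤ A f λ a → ℕᵖ.≤-trans (ℕᵖ.<⇒≤ (ℕᵖ.≰⇒> λ h → none (a , h))) (s≤ s≡)))

-- Equitability with the smaller size q named, since the bounds relating n to the order refer to it.
EqualParts : ∀ {n k} → ℕ → Partition n k → Set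
EqualParts q P = ∀ i → ∣ Part P i ∣ˢ ≡ q ⊎ ∣ Part P i ∣ˢ ≡ suc q

⌊≟⌋-complete : ∀ {k} {i j : Fin k} → i ≡ j → ⌊ i Fin.≟ j ⌋ ≡ true
⌊≟⌋-complete {i = i} refl = ≟-refl i

argmin : ∀ {k} (f : Fin (suc k) → ℕ) → Σ (Fin (suc k)) λ i → ∀ j → f i ℕ.≤ f j
argmin {zero} f = zero , λ { zero → ℕᵖ.≤-refl }
argmin {suc k} f with argmin (f ∘ suc)
... | i , min with f zero ℕ.≤? f (suc i)
...   | yes le = zero , λ { zero → ℕᵖ.≤-refl ; (suc j) → ℕᵖ.≤-trans le (min j) }
...   | no gt = suc i , λ { zero → ℕᵖ.<⇒≤ (ℕᵖ.≰⇒> gt) ; (suc j) → min j }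

equipartition⇒equalParts : ∀ {n k} (P : Partition n k) → 0 ℕ.< k → IsEquipartition P → Σ ℕ λ q → EqualParts q P
equipartition⇒equalParts {k = suc k} P _ equi = q , λ j → between (min j) (equi j i)
  where
  i = proj₁ (argmin λ i → ∣ Part P i ∣ˢ)
  min = proj₂ (argmin λ i → ∣ Part P i ∣ˢ)
  q = ∣ Part P i ∣ˢ
  between : ∀ {s} → q ℕ.≤ s → s ℕ.≤ suc q → s ≡ q ⊎ s ≡ suc q
  between {s} q≤s s≤ with q ℕ.≟ s
  ... | yes p = inj₁ (sym p)
  ... | no p = inj₂ (ℕᵖ.≤-antisym s≤ (ℕᵖ.≤∧≢⇒< q≤s p))

module _ {n k q : ℕ} (P : Partition n k) (eq : EqualParts q P) where
  parts≥ : ∀ i → q ℕ.≤ ∣ Part P i ∣ˢ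
  parts≥ i = lower (eq i)
    where
    lower : ∀ {s} → s ≡ q ⊎ s ≡ suc q → q ℕ.≤ s
    lower (inj₁ refl) = ℕᵖ.≤-refl
    lower (inj₂ refl) = ℕᵖ.n≤1+n q

  parts≤ : ∀ i → ∣ Part P i ∣ˢ ℕ.≤ suc q
  parts≤ i = upper (eq i)
    where
    upper : ∀ {s} → s ≡ q ⊎ s ≡ suc q → s ℕ.≤ suc q
    upper (inj₁ refl) = ℕᵖ.n≤1+n q
    upper (inj₂ refl) = ℕᵖ.≤-refl

  k*q≤n : k ℕ.* q ℕ.≤ n
  k*q≤n = subst (k ℕ.* q ℕ.≤_) (count-true n) (≤count (λ _ → true) (part P) parts≥)

  n≤k*suc-q : n ℕ.≤ k ℕ.* suc q
  n≤k*suc-q = subst (ℕ._≤ k ℕ.* suc q) (count-true n) (count≤ (λ _ → true) (part P) parts≤)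

equalParts⇒equipartition : ∀ {n k q} (P : Partition n k) → EqualParts q P → IsEquipartition P
equalParts⇒equipartition P eq i j = ℕᵖ.≤-trans (parts≤ P eq i) (s≤s (parts≥ P eq j))

record EquitableRefinement {n k l : ℕ} (P : Partition n k) (f : Fin n → Fin l) (M t : ℕ) : Set where
  field
    Q : Partition n (k ℕ.* M)
    equal : EqualParts t Q
    refines : Refines Q P
    spoilt : VSet n
    spoilt-meas : ∀ u v → part Q u ≡ part Q v → spoilt u ≡ spoilt v
    monochromatic : ∀ u v → part Q u ≡ part Q v → spoilt u ≡ false → f u ≡ f v
    spoilt≤ : count spoilt ℕ.≤ k ℕ.* (l ℕ.* suc t)

refineEquitably : ∀ {n k l q} (P : Partition n k) → EqualParts q P → (f : Fin n → Fin l) → ∀ M t → 0 ℕ.< t →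
  suc M ℕ.* t ℕ.≤ q → q ℕ.< suc M ℕ.* suc t → EquitableRefinement P f (suc M) t
refineEquitably {n} {k} {l} {q} P eq f M t 0<t lo hi = record
  { Q = Q ; equal = equal′ ; refines = proj₁ ∘ Fin.remQuot (suc M) , λ v → sym
      (cong proj₁ (remQuot-combine (part P v) (piece v)))
  ; spoilt = spoilt′ ; spoilt-meas = meas ; monochromatic = mono ; spoilt≤ = bound }
  where
  chops : ∀ i → Chopping (Part P i) f (suc M) t
  -- A part of size q + 1 can leave the remainder M + 1, in which case all chunks have t + 1
  -- vertices; hence `chop` admits r = suc M.
  chops i = chop f M t (∣ Part P i ∣ˢ ℕ.∸ suc M ℕ.* t) (Part P i)
    (sym (ℕᵖ.m+[n∸m]≡n (ℕᵖ.≤-trans lo (parts≥ P eq i))))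
    (ℕᵖ.≤-trans (ℕᵖ.∸-monoˡ-≤ (suc M ℕ.* t) (ℕᵖ.≤-trans (parts≤ P eq i) hi))
      (ℕᵖ.≤-reflexive (trans (cong (ℕ._∸ suc M ℕ.* t) (ℕᵖ.*-suc (suc M) t)) (ℕᵖ.m+n∸n≡m (suc M) (suc M ℕ.* t)))))
  piece : Fin n → Fin (suc M)
  piece v = Chopping.chunk (chops (part P v)) v
  label : Fin n → Fin (k ℕ.* suc M)
  label v = Fin.combine (part P v) (piece v)
  label-part : ∀ i j v → ⌊ label v Fin.≟ Fin.combine i j ⌋ ≡ Part P i v ∧ ⌊ Chopping.chunk (chops i) v Fin.≟ j ⌋
  label-part i j v with part P v Fin.≟ i
  ... | yes refl with piece v Fin.≟ j
  ...   | yes q = ⌊≟⌋-complete (cong (Fin.combine (part P v)) q)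
  ...   | no ¬q with label v Fin.≟ Fin.combine (part P v) j
  ...     | yes r = ⊥-elim (¬q (combine-injectiveʳ (part P v) (piece v) (part P v) j r))
  ...     | no _ = refl
  label-part i j v | no ¬p with label v Fin.≟ Fin.combine i j
  ... | yes r = ⊥-elim (¬p (combine-injectiveˡ (part P v) (piece v) i j r))
  ... | no _ = refl
  equal″ : ∀ a → count (λ v → ⌊ label v Fin.≟ a ⌋) ≡ t ⊎ count (λ v → ⌊ label v Fin.≟ a ⌋) ≡ suc t
  equal″ a with combine-surjective {k} {suc M} a
  ... | i , j , refl = subst (λ z → z ≡ t ⊎ z ≡ suc t) (sym (count-cong (label-part i j)))
      (Chopping.size (chops i) j)
  positive : ∀ {s} → s ≡ t ⊎ s ≡ suc t → 0 ℕ.< s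
  positive (inj₁ refl) = 0<t
  positive (inj₂ refl) = s≤s z≤n
  Q : Partition n (k ℕ.* suc M)
  Q = record { part = label ; nonempty = λ a →
    let v , p = count-positive (λ v → ⌊ label v Fin.≟ a ⌋) (positive (equal″ a)) in v , ⌊≟⌋-sound p }
  equal′ : EqualParts t Q
  equal′ = equal″
  spoilt′ : VSet n
  spoilt′ v = Chopping.bad (chops (part P v)) (piece v)
  same-part : ∀ u v → label u ≡ label v → part P u ≡ part P v
  same-part u v p = combine-injectiveˡ (part P u) (piece u) (part P v) (piece v) p
  same-piece : ∀ u v → label u ≡ label v → piece u ≡ piece v
  same-piece u v p = combine-injectiveʳ (part P u) (piece u) (part P v) (piece v) p
  meas : ∀ u v → label u ≡ label v → spoilt′ u ≡ spoilt′ v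
  meas u v p = cong₂ (λ i j → Chopping.bad (chops i) j) (same-part u v p) (same-piece u v p)
  mono : ∀ u v → label u ≡ label v → spoilt′ u ≡ false → f u ≡ f v
  mono u v p good = Chopping.monochromatic (chops (part P u)) (piece u) good u v (≟-refl (part P u))
    (⌊≟⌋-complete (sym (same-part u v p))) refl
    (trans (cong (λ i → Chopping.chunk (chops i) v) (same-part u v p)) (sym (same-piece u v p)))
  bound : count spoilt′ ℕ.≤ k ℕ.* (l ℕ.* suc t)
  bound = count≤ spoilt′ (part P) λ i → ℕᵖ.≤-trans (count-mono {A = fibre spoilt′ (part P) i}
    {λ v → Part P i v ∧ Chopping.bad (chops i) (Chopping.chunk (chops i) v)} (inside i)) (Chopping.bad≤ (chops i))
    where
    inside : ∀ i v → fibre spoilt′ (part P) i v ≡ true → Part P i v ∧ Chopping.bad (chops i)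
        (Chopping.chunk (chops i) v) ≡ true
    inside i v h = ∧-intro p (subst (λ i → Chopping.bad (chops i) (Chopping.chunk (chops i) v) ≡
        true) (⌊≟⌋-sound {i = part P v} p) (proj₁ (∧-true {spoilt′ v} h)))
      where
      p : ⌊ part P v Fin.≟ i ⌋ ≡ true
      p = proj₂ (∧-true {spoilt′ v} h)

quotient≤ : ∀ q M → suc M ℕ.* (q ℕ./ suc M) ℕ.≤ q
quotient≤ q M = subst (ℕ._≤ q) (ℕᵖ.*-comm (q ℕ./ suc M) (suc M)) (m/n*n≤m q (suc M))

refineEquitablyInto : ∀ {n k l q} (P : Partition n k) → EqualParts q P → (f : Fin n → Fin l) → ∀ M → suc M ℕ.≤ q →
  EquitableRefinement P f (suc M) (q ℕ./ suc M)
refineEquitablyInto {q = q} P eq f M M≤q = refineEquitably P eq f M (q ℕ./ suc M) (m≥n⇒m/n>0 M≤q) (quotient≤ q M) hi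
  where
  hi : q ℕ.< suc M ℕ.* suc (q ℕ./ suc M)
  hi = subst (q ℕ.<_) (ℕᵖ.*-comm (suc (q ℕ./ suc M)) (suc M))
      (ℕᵖ.≤-<-trans (ℕᵖ.≤-reflexive (m≡m%n+[m/n]*n q (suc M)))
    (ℕᵖ.+-monoˡ-< (q ℕ./ suc M ℕ.* suc M) (m%n<n q (suc M))))

∑₂-product : ∀ {n} (A B : VSet n) → ∑₂ (λ u v → 𝟙 (A u) * 𝟙 (B v)) ≡ ℕ→ℚ ∣ A ∣ˢ * ℕ→ℚ ∣ B ∣ˢ
∑₂-product A B = trans (∑-cong λ u → trans (∑-* (𝟙 (A u)) (λ v → 𝟙 (B v)))
    (trans (cong (𝟙 (A u) *_) (sym (count-∑ B))) (*-comm (𝟙 (A u)) b)))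
  (trans (∑-* b (λ u → 𝟙 (A u))) (trans (cong (b *_) (sym (count-∑ A))) (*-comm b (ℕ→ℚ ∣ A ∣ˢ))))
  where
  b : ℚ
  b = ℕ→ℚ ∣ B ∣ˢ

⊆ˢ-apply : ∀ {n} {A B : VSet n} → A ⊆ˢ B → ∀ u → A u ≡ true → B u ≡ true
⊆ˢ-apply {A = A} {B} A⊆B u h = T⇒≡ (A⊆B u (subst T (sym h) tt))
  where
  T⇒≡ : ∀ {b} → T b → b ≡ true
  T⇒≡ {true} _ = refl

-- Regularity from closeness in the cut norm

module _ {n k q : ℕ} (H : Graph n) (P : Partition n k) (eq : EqualParts q P) (0<q : 0 ℕ.< q)
  (x : Fin n → Fin n → ℚ) (mx : Meas₂ (part P) x) {ε τ : ℚ} (0<ε : 0ℚ < ε) (ε≤1 : ε ≤ 1ℚ) (0≤τ : 0ℚ ≤ τ)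
  (τ-small : ℕ→ℚ 8 * τ * (ℕ→ℚ k * ℕ→ℚ k) ≤ ε * ε * ε)
  (close : ∀ (S T : VSet n) → ∣ ∑₂ {n} {n} (λ u v → 𝟙 (S u) * 𝟙 (T v) * (adjacency H u v - x u v)) ∣
      ≤ τ * (ℕ→ℚ n * ℕ→ℚ n)) where

  private
    κ κq : ℚ
    κ = ℕ→ℚ k
    κq = ℕ→ℚ q

    0<κq : 0ℚ < κq
    0<κq = 0<ℕ 0<q

    0≤ε : 0ℚ ≤ ε
    0≤ε = <⇒≤ 0<ε

    ν≤ : ℕ→ℚ n ≤ κ * (κq + κq)
    ν≤ = ≤-trans (ℕ→ℚ-mono (n≤k*suc-q P eq)) (≤-trans (≤-reflexive (ℕ→ℚ-* k (suc q)))
      (*-monoʳ (0≤ℕ k) (≤-trans (ℕ→ℚ-mono (ℕᵖ.+-monoˡ-≤ q 0<q)) (≤-reflexive (ℕ→ℚ-+ q q)))))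

    sizes : ∀ i {A : VSet n} → ε * ℕ→ℚ ∣ Part P i ∣ˢ ≤ ℕ→ℚ ∣ A ∣ˢ → ε * κq ≤ ℕ→ℚ ∣ A ∣ˢ
    sizes i h = ≤-trans (*-monoʳ 0≤ε (ℕ→ℚ-mono (parts≥ P eq i))) h

  module _ {i j : Fin k} {A B : VSet n} (A⊆ : A ⊆ˢ Part P i) (B⊆ : B ⊆ˢ Part P j)
    (hA : ε * κq ≤ ℕ→ℚ ∣ A ∣ˢ) (hB : ε * κq ≤ ℕ→ℚ ∣ B ∣ˢ) where
    private
      base : ℚ
      base = x (proj₁ (nonempty P i)) (proj₁ (nonempty P j))
      a b : ℚ
      a = ℕ→ℚ ∣ A ∣ˢ
      b = ℕ→ℚ ∣ B ∣ˢ
      N : ℚ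
      N = ℕ→ℚ n * ℕ→ℚ n
      0<εq : 0ℚ < ε * κq
      0<εq = 0<* 0<ε 0<κq
      nonzero : ∀ {A : VSet n} → ε * κq ≤ ℕ→ℚ ∣ A ∣ˢ → 0 ℕ.< ∣ A ∣ˢ
      nonzero {A} h = ℕ→ℚ-cancel-< {0} (<-≤-trans 0<εq h)
      member : ∀ {A : VSet n} i → A ⊆ˢ Part P i → ∀ u → A u ≡ true → part P u ≡ i
      member {A} i A⊆ u h = ⌊≟⌋-sound {i = part P u} (⊆ˢ-apply {A = A} {Part P i} A⊆ u h)
      const : ∀ u v → 𝟙 (A u) * 𝟙 (B v) * x u v ≡ base * (𝟙 (A u) * 𝟙 (B v))
      const u v = pt (A u) (B v) refl refl
        where
        pt : ∀ α β → A u ≡ α → B v ≡ β → 𝟙 α * 𝟙 β * x u v ≡ base * (𝟙 α * 𝟙 β)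
        pt true true p q = trans (cong (1ℚ * 1ℚ *_)
            (mx u v _ _ (trans (member i A⊆ u p) (sym (proj₂ (nonempty P i))))
          (trans (member j B⊆ v q) (sym (proj₂ (nonempty P j)))))) (*-comm (1ℚ * 1ℚ) base)
        pt true false _ _ = trans (*-zeroˡ (x u v)) (sym (*-zeroʳ base))
        pt false true _ _ = trans (*-zeroˡ (x u v)) (sym (*-zeroʳ base))
        pt false false _ _ = trans (*-zeroˡ (x u v)) (sym (*-zeroʳ base))
      z : ℚ
      z = pairDensity H A B - base
      z*ab : z * (a * b) ≡ ∑₂ (λ u v → 𝟙 (A u) * 𝟙 (B v) * (adjacency H u v - x u v))
      z*ab = begin
        (pairDensity H A B - base) * (a * b) ≡⟨ l₁ (pairDensity H A B) base (a * b) ⟩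
        pairDensity H A B * (a * b) - base * (a * b)
          ≡⟨ cong₂ _-_ (trans (cong (pairDensity H A B *_) (sym (ℕ→ℚ-* ∣ A ∣ˢ ∣ B ∣ˢ)))
               (trans (frac-* (e H A B) (ℕᵖ.*-mono-< (nonzero {A} hA) (nonzero {B} hB))) (e-∑ H A B)))
             (trans (cong (base *_) (sym (∑₂-product A B)))
                 (trans (sym (∑₂-* base (λ u v → 𝟙 (A u) * 𝟙 (B v)))) (∑₂-cong λ u v → sym (const u v)))) ⟩
        ∑₂ (λ u v → 𝟙 (A u) * 𝟙 (B v) * adjacency H u v) - ∑₂ (λ u v → 𝟙 (A u) * 𝟙 (B v) * x u v)
          ≡⟨ sym (∑₂-- (λ u v → 𝟙 (A u) * 𝟙 (B v) * adjacency H u v) (λ u v → 𝟙 (A u) * 𝟙 (B v) * x u v)) ⟩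
        ∑₂ (λ u v → 𝟙 (A u) * 𝟙 (B v) * adjacency H u v - 𝟙 (A u) * 𝟙 (B v) * x u v)
          ≡⟨ ∑₂-cong (λ u v → l₂ (𝟙 (A u) * 𝟙 (B v)) (adjacency H u v) (x u v)) ⟩
        ∑₂ (λ u v → 𝟙 (A u) * 𝟙 (B v) * (adjacency H u v - x u v)) ∎
        where
        open ≡-Reasoning
        l₁ : ∀ p x y → (p - x) * y ≡ p * y - x * y
        l₁ = solve-∀ ℚ-ring
        l₂ : ∀ w x y → w * x - w * y ≡ w * (x - y)
        l₂ = solve-∀ ℚ-ring
      0≤ab : 0ℚ ≤ a * b
      0≤ab = 0≤* (0≤ℕ ∣ A ∣ˢ) (0≤ℕ ∣ B ∣ˢ)
      S : ℚ
      S = (ε * κq) * (ε * κq)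
      ∣z∣ab≤ : ∣ z ∣ * (a * b) ≤ τ * N
      ∣z∣ab≤ = subst (_≤ τ * N) (trans (cong ∣_∣ (sym z*ab))
          (trans (∣p*q∣≡∣p∣*∣q∣ z (a * b)) (cong (∣ z ∣ *_) (0≤p⇒∣p∣≡p 0≤ab)))) (close A B)

    -- The error τ n² is divided by the product of the sizes, at least (ε q)², and n ≤ 2 k q; the
    -- quotient is at most 4 τ k² / ε², which `τ-small` bounds by ε / 2.
    density-close : ∣ pairDensity H A B - x (proj₁ (nonempty P i)) (proj₁ (nonempty P j)) ∣ ≤ ℚ.½ * ε
    density-close = *-cancelˡ {c = S} (0<* 0<εq 0<εq) (≤-trans (≤-reflexive (*-comm S ∣ z ∣))
      (≤-trans (*-monoʳ (0≤∣p∣ z) (*-mono (<⇒≤ 0<εq) (0≤ℕ ∣ B ∣ˢ) hA hB))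
      (≤-trans ∣z∣ab≤ (≤-trans (*-monoʳ 0≤τ (*-mono (0≤ℕ n) (0≤* (0≤ℕ k) (0≤+ (0≤ℕ q) (0≤ℕ q))) ν≤ ν≤))
        (≤-by (0≤* (0≤* (nonNegative⁻¹ ℚ.½) (0≤² κq)) (≤⇒0≤- τ-small)) (l ε τ κ κq))))))
      where
      l : ∀ ε τ k q → ℚ.½ * (q * q) * (ε * ε * ε - ℕ→ℚ 8 * τ * (k * k))
        ≡ (ε * q) * (ε * q) * (ℚ.½ * ε) - τ * ((k * (q + q)) * (k * (q + q)))
      l = solve-∀ ℚ-ring

  regularPair : ∀ i j → RegularPair ε H (Part P i) (Part P j)
  regularPair i j A B A⊆ B⊆ hA hB = ≤-trans (≤-reflexive (cong ∣_∣ (l₁ dP dA base)))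
    (≤-trans (∣p-q∣≤∣p∣+∣q∣ (dP - base) (dA - base))
    (≤-trans (+-mono-≤
        (density-close {i} {j} {Part P i} {Part P j} (λ _ h → h) (λ _ h → h)
            (sizes i {Part P i} (shrink (∣ Part P i ∣ˢ))) (sizes j {Part P j} (shrink (∣ Part P j ∣ˢ))))
        (density-close {i} {j} {A} {B} A⊆ B⊆ (sizes i {A} hA) (sizes j {B} hB)))
      (≤-reflexive (l₂ ε))))
    where
    dP dA base : ℚ
    dP = pairDensity H (Part P i) (Part P j)
    dA = pairDensity H A B
    base = x (proj₁ (nonempty P i)) (proj₁ (nonempty P j))
    shrink : ∀ m → ε * ℕ→ℚ m ≤ ℕ→ℚ m
    shrink m = subst (ε * ℕ→ℚ m ≤_) (*-identityˡ (ℕ→ℚ m)) (*-monoˡ (0≤ℕ m) ε≤1)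
    l₁ : ∀ x y z → x - y ≡ (x - z) - (y - z)
    l₁ = solve-∀ ℚ-ring
    l₂ : ∀ x → ℚ.½ * x + ℚ.½ * x ≡ x
    l₂ = solve-∀ ℚ-ring

sumF-count-false : ∀ k → ℕ→ℚ (sumF {k} λ i → count {k} (λ j → false)) ≡ 0ℚ
sumF-count-false k = trans (sumF-count-∑ {k} {k} (λ _ _ → false))
    (trans (∑₂-const {k} {k} 0ℚ) (*-zeroʳ (ℕ→ℚ k * ℕ→ℚ k)))

allRegular : ∀ {n k ε} (H : Graph n) (P : Partition n k) → 0ℚ ≤ ε →
    (∀ i j → RegularPair ε H (Part P i) (Part P j)) →
  IsRegularPartition ε H P
allRegular {n} {k} {ε} H P 0≤ε reg = (λ _ _ → false) , subst (_≤ ε * ℕ→ℚ (k ℕ.* k))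
    (sym (sumF-count-false k)) (0≤* 0≤ε (0≤ℕ (k ℕ.* k))) , λ i j _ → reg i j

-- Comparing L¹ distances of block averages

sgn : ℚ → ℚ
sgn z with 0ℚ ≤? z
... | yes _ = 1ℚ
... | no _ = - 1ℚ

sgn-* : ∀ z → sgn z * z ≡ ∣ z ∣
sgn-* z with 0ℚ ≤? z
... | yes 0≤z = trans (*-identityˡ z) (sym (0≤p⇒∣p∣≡p 0≤z))
... | no h = trans (l z) (trans (sym (0≤p⇒∣p∣≡p (neg-≤ (<⇒≤ (≰⇒> h))))) (∣-p∣≡∣p∣ z))
  where
  l : ∀ z → (- 1ℚ) * z ≡ - z
  l = solve-∀ ℚ-ring

sgn-*≤ : ∀ z y → sgn z * y ≤ ∣ y ∣
sgn-*≤ z y with 0ℚ ≤? z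
... | yes _ = subst (_≤ ∣ y ∣) (sym (*-identityˡ y)) (x≤∣x∣ y)
... | no _ = subst (_≤ ∣ y ∣) (l y) (-x≤∣x∣ y)
  where
  l : ∀ z → - z ≡ (- 1ℚ) * z
  l = solve-∀ ℚ-ring

module _ {n k l m : ℕ} (X : Fin n → Fin n → ℚ) (0≤X : ∀ u v → 0ℚ ≤ X u v) (X≤1 : ∀ u v → X u v ≤ 1ℚ)
  {c₀ : Fin n → Fin k} {c : Fin n → Fin l} {c′ : Fin n → Fin m} (c≼c₀ : c ≼ c₀) (c′≼c₀ : c′ ≼ c₀)
  (spoilt : VSet n) (spoilt-meas : ∀ u v → c′ u ≡ c′ v → spoilt u ≡ spoilt v)
  (mono : ∀ u v → c′ u ≡ c′ v → spoilt u ≡ false → c u ≡ c v) where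
  private
    D₀ D D′ : Fin n → Fin n → ℚ
    D₀ = blockAverage c₀ X
    D = blockAverage c X
    D′ = blockAverage c′ X

    η w : Fin n → Fin n → ℚ
    η u v = sgn (D u v - D₀ u v)
    w u v = if spoilt u then 0ℚ else if spoilt v then 0ℚ else η u v

    mη : Meas₂ c η
    mη u v u′ v′ p q = cong₂ (λ x y → sgn (x - y)) (blockAverage-meas c X u v u′ v′ p q)
      (blockAverage-meas c₀ X u v u′ v′ (c≼c₀ u u′ p) (c≼c₀ v v′ q))

    mw : Meas₂ c′ w
    mw u v u′ v′ p q = pt (spoilt u) (spoilt v) refl refl (spoilt u′) (spoilt v′)
        (sym (spoilt-meas u u′ p)) (sym (spoilt-meas v v′ q))
      where
      pt : ∀ α β → spoilt u ≡ α → spoilt v ≡ β → ∀ α′ β′ → α′ ≡ spoilt u → β′ ≡ spoilt v →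
        (if α then 0ℚ else if β then 0ℚ else η u v) ≡ (if α′ then 0ℚ else if β′ then 0ℚ else η u′ v′)
      pt α β s t α′ β′ s′ t′ with trans s′ s | trans t′ t
      pt true β _ _ _ _ _ _ | refl | refl = refl
      pt false true _ _ _ _ _ _ | refl | refl = refl
      pt false false s t _ _ _ _ | refl | refl = mη u v u′ v′ (mono u u′ p s) (mono v v′ q t)

    ∣X-D₀∣≤1 : ∀ u v → ∣ X u v - D₀ u v ∣ ≤ 1ℚ
    ∣X-D₀∣≤1 u v = ∣∣≤ (≤-by (0≤+ (≤⇒0≤- (X≤1 u v)) (0≤blockAverage c₀ X 0≤X u v)) (l₁ (X u v) (D₀ u v)))
      (≤-by (0≤+ (0≤X u v) (≤⇒0≤- (blockAverage≤1 c₀ X X≤1 u v))) (l₂ (X u v) (D₀ u v)))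
      where
      l₁ : ∀ x y → (1ℚ - x) + y ≡ 1ℚ - (x - y)
      l₁ = solve-∀ ℚ-ring
      l₂ : ∀ x y → x + (1ℚ - y) ≡ 1ℚ - (- (x - y))
      l₂ = solve-∀ ℚ-ring

    pointwise : ∀ u v → η u v * (X u v - D₀ u v) ≤ w u v * (X u v - D₀ u v) + (𝟙 (spoilt u) + 𝟙 (spoilt v))
    pointwise u v = pt (spoilt u) (spoilt v)
      where
      E : ℚ
      E = X u v - D₀ u v
      big : η u v * E ≤ 1ℚ
      big = ≤-trans (sgn-*≤ (D u v - D₀ u v) E) (∣X-D₀∣≤1 u v)
      l₁ : ∀ E b → 1ℚ + b ≡ 0ℚ * E + (1ℚ + b)
      l₁ = solve-∀ ℚ-ring
      l₂ : ∀ E → 1ℚ ≡ 0ℚ * E + (0ℚ + 1ℚ)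
      l₂ = solve-∀ ℚ-ring
      pt : ∀ α β → η u v * E ≤ (if α then 0ℚ else if β then 0ℚ else η u v) * E + (𝟙 α + 𝟙 β)
      pt true β = ≤-trans big (≤-trans (≤-by (0≤𝟙 β) (l₃ (𝟙 β))) (≤-reflexive (l₁ E (𝟙 β))))
        where
        l₃ : ∀ b → b ≡ (1ℚ + b) - 1ℚ
        l₃ = solve-∀ ℚ-ring
      pt false true = ≤-trans big (≤-reflexive (l₂ E))
      pt false false = ≤-reflexive (sym (+-identityʳ (η u v * E)))

    w≤ : ∀ u v y → w u v * y ≤ ∣ y ∣
    w≤ u v y = pt (spoilt u) (spoilt v)
      where
      zero≤ : 0ℚ * y ≤ ∣ y ∣
      zero≤ = subst (_≤ ∣ y ∣) (sym (*-zeroˡ y)) (0≤∣p∣ y)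
      pt : ∀ α β → (if α then 0ℚ else if β then 0ℚ else η u v) * y ≤ ∣ y ∣
      pt true β = zero≤
      pt false true = zero≤
      pt false false = sgn-*≤ (D u v - D₀ u v) y

  -- The left side is the test of X - D₀ against the sign of D - D₀. Setting this sign to 0 at
  -- spoilt vertices makes it constant on the blocks of c′, and every pair that meets a spoilt
  -- vertex loses at most 1.
  L¹-transfer : ∑₂ (λ u v → ∣ D u v - D₀ u v ∣) ≤ ∑₂ (λ u v → ∣ D′ u v - D₀ u v ∣) + 2ℚ *
      (ℕ→ℚ n * ℕ→ℚ (count spoilt))
  L¹-transfer = begin
    ∑₂ (λ u v → ∣ D u v - D₀ u v ∣) ≡⟨ ∑₂-cong (λ u v → sym (sgn-* (D u v - D₀ u v))) ⟩
    ∑₂ (λ u v → η u v * (D u v - D₀ u v)) ≡⟨ sym (∑₂-refine X 0≤X X≤1 {c = c₀} {c′ = c} c≼c₀ mη) ⟩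
    ∑₂ (λ u v → η u v * (X u v - D₀ u v)) ≤⟨ ∑₂-mono pointwise ⟩
    ∑₂ (λ u v → w u v * (X u v - D₀ u v) + (𝟙 (spoilt u) + 𝟙 (spoilt v)))
      ≡⟨ ∑₂-+ (λ u v → w u v * (X u v - D₀ u v)) (λ u v → 𝟙 (spoilt u) + 𝟙 (spoilt v)) ⟩
    ∑₂ (λ u v → w u v * (X u v - D₀ u v)) + ∑₂ (λ u v → 𝟙 (spoilt u) + 𝟙 (spoilt v))
      ≡⟨ cong₂ _+_ (∑₂-refine X 0≤X X≤1 {c = c₀} {c′ = c′} c′≼c₀ mw) masses ⟩
    ∑₂ (λ u v → w u v * (D′ u v - D₀ u v)) + 2ℚ * (ν * s)
      ≤⟨ +-monoˡ-≤ (2ℚ * (ν * s)) (∑₂-mono λ u v → w≤ u v (D′ u v - D₀ u v)) ⟩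
    ∑₂ (λ u v → ∣ D′ u v - D₀ u v ∣) + 2ℚ * (ν * s) ∎
    where
    open ℚᵖ.≤-Reasoning
    ν s : ℚ
    ν = ℕ→ℚ n
    s = ℕ→ℚ (count spoilt)
    l₁ : ∀ x → x + x ≡ 2ℚ * x
    l₁ = solve-∀ ℚ-ring
    masses : ∑₂ (λ u v → 𝟙 (spoilt u) + 𝟙 (spoilt v)) ≡ 2ℚ * (ν * s)
    masses = trans (∑₂-+ (λ u v → 𝟙 (spoilt u)) (λ u v → 𝟙 (spoilt v)))
      (trans (cong₂ _+_
        (trans (∑-cong λ u → ∑-const n (𝟙 (spoilt u)))
            (trans (∑-* ν (λ u → 𝟙 (spoilt u))) (cong (ν *_) (sym (count-∑ spoilt)))))
        (trans (∑-const n _) (cong (ν *_) (sym (count-∑ spoilt))))) (l₁ (ν * s)))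

-- Edit distance

sumF-+ : ∀ {n} (f g : Fin n → ℕ) → sumF (λ i → f i ℕ.+ g i) ≡ sumF f ℕ.+ sumF g
sumF-+ {zero} f g = refl
sumF-+ {suc n} f g = trans (cong (f zero ℕ.+ g zero ℕ.+_) (sumF-+ (f ∘ suc) (g ∘ suc))) (l (f zero) (g zero) _ _)
  where
  l : ∀ a b c d → a ℕ.+ b ℕ.+ (c ℕ.+ d) ≡ (a ℕ.+ c) ℕ.+ (b ℕ.+ d)
  l = ℕ-solve-∀

count-sumF : ∀ {n} (A : VSet n) → count A ≡ sumF (λ v → if A v then 1 else 0)
count-sumF {zero} A = refl
count-sumF {suc n} A = cong ((if A zero then 1 else 0) ℕ.+_) (count-sumF (A ∘ suc))

sumF-cong : ∀ {n} {f g : Fin n → ℕ} → (∀ i → f i ≡ g i) → sumF f ≡ sumF g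
sumF-cong {zero} h = refl
sumF-cong {suc n} h = cong₂ ℕ._+_ (h zero) (sumF-cong (h ∘ suc))

-- `edges` halves with rounding, so parity is what recovers the number of ordered pairs from it. The
-- row and the column of vertex zero have the same count.
symmetric-even : ∀ {n} (a : Fin n → Fin n → Bool) → (∀ u v → a u v ≡ a v u) → (∀ u → a u u ≡ false) →
  Σ ℕ λ m → sumF (λ u → count (a u)) ≡ m ℕ.+ m
symmetric-even {zero} a _ _ = 0 , refl
symmetric-even {suc n} a s i with symmetric-even (λ u v → a (suc u) (suc v))
    (λ u v → s (suc u) (suc v)) (λ u → i (suc u))
... | m , eq = r ℕ.+ m , trans
  (cong₂ ℕ._+_ (cong (λ b → (if b then 1 else 0) ℕ.+ r) (i zero))
    (trans (sumF-+ (λ u → if a (suc u) zero then 1 else 0) (λ u → count (λ v → a (suc u) (suc v))))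
      (cong₂ ℕ._+_ (trans (sumF-cong λ u → cong (λ b → if b then 1 else 0) (s (suc u) zero))
          (sym (count-sumF (λ v → a zero (suc v))))) eq)))
  (l r m)
  where
  r : ℕ
  r = count (λ v → a zero (suc v))
  l : ∀ r m → r ℕ.+ (r ℕ.+ (m ℕ.+ m)) ≡ (r ℕ.+ m) ℕ.+ (r ℕ.+ m)
  l = ℕ-solve-∀

half≤ : ∀ m → ℕ.⌊ m /2⌋ ℕ.+ ℕ.⌊ m /2⌋ ℕ.≤ m
half≤ m = ℕᵖ.≤-trans (ℕᵖ.+-monoʳ-≤ ℕ.⌊ m /2⌋ (ℕᵖ.⌊n/2⌋≤⌈n/2⌉ m)) (ℕᵖ.≤-reflexive (ℕᵖ.⌊n/2⌋+⌈n/2⌉≡n m))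

edges-double : ∀ {n} (G : Graph n) → twiceEdges G ≡ edges G ℕ.+ edges G
edges-double G with symmetric-even (adj G) (Graph.sym G) (irrefl G)
... | m , eq = trans eq (cong₂ ℕ._+_ half half)
  where
  half : m ≡ edges G
  half = trans (ℕᵖ.n≡⌊n+n/2⌋ m) (cong ℕ.⌊_/2⌋ (sym eq))

editDistance≤ : ∀ {n} (G H : Graph n) {δ} → ∑₂ (λ u v → flipSign G u v *
    (adjacency H u v - adjacency G u v)) ≤ δ * ℕ→ℚ (twiceEdges G) →
  ℕ→ℚ (editDistance G H) ≤ δ * ℕ→ℚ (edges G)
editDistance≤ G H {δ} h = *-cancelˡ {c = 1ℚ + 1ℚ} (0<ℕ {2} (s≤s z≤n)) (≤-trans (≤-reflexive
    (trans (l (ℕ→ℚ (editDistance G H))) (sym (ℕ→ℚ-+ (editDistance G H) (editDistance G H)))))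
  (≤-trans (ℕ→ℚ-mono (half≤ flips)) (≤-trans (≤-reflexive (trans (sumF-count-∑ (λ u v → adj G u v xor adj H u v))
    (∑₂-cong λ u v → xor-def (adj G u v) (adj H u v))))
        (≤-trans h (≤-reflexive (trans (cong (λ z → δ * ℕ→ℚ z) (edges-double G))
      (trans (cong (δ *_) (ℕ→ℚ-+ (edges G) (edges G))) (l₂ δ (ℕ→ℚ (edges G))))))))))
  where
  flips : ℕ
  flips = sumF (λ u → count (λ v → adj G u v xor adj H u v))
  xor-def : ∀ a b → 𝟙 (a xor b) ≡ (1ℚ - 2ℚ * 𝟙 a) * (𝟙 b - 𝟙 a)
  xor-def true true = refl
  xor-def true false = refl
  xor-def false true = refl
  xor-def false false = refl
  l : ∀ x → 2ℚ * x ≡ x + x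
  l = solve-∀ ℚ-ring
  l₂ : ∀ d x → d * (x + x) ≡ 2ℚ * (d * x)
  l₂ = solve-∀ ℚ-ring

-- One refinement step

-- The cut-norm errors in the step are 1 / precision x, so that 8 · 4 · x² / precision x = 1 / x³ ≤ ε³;
-- weak regularity with that error multiplies the number of classes by at most colours x.
precision : ℕ → ℕ
precision x = 32 ℕ.* (x ℕ.* x ℕ.* x ℕ.* x ℕ.* x)

colours : ℕ → ℕ
colours x = 4 ℕ.^ (precision x ℕ.* precision x)

-- A partition of order at most x is refined into x² · `colours x` pieces per part. One factor x
-- covers the at most x · `colours x` classes of the weakly regular colouring, the other one dilutes
-- the spoilt vertices to a fraction 2 / x.
growth : ℕ → ℕ
growth x = x ℕ.* (x ℕ.* x ℕ.* colours x)

module _ {n : ℕ} (G : Graph n) (0<n : 0 ℕ.< n) {ε δ d : ℚ} (0<ε : 0ℚ < ε) (ε≤1 : ε ≤ 1ℚ) (0<δ : 0ℚ < δ)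
  (0≤d : 0ℚ ≤ d) (d≤1 : d ≤ 1ℚ) (mass : ∑₂ (adjacency G) ≡ d * (ℕ→ℚ n * ℕ→ℚ n))
  (L : ℕ) (scales : half^ L ≤ 2ℚ * d) where

  private
    X : Fin n → Fin n → ℚ
    X = adjacency G
    0≤X : ∀ u v → 0ℚ ≤ X u v
    0≤X u v = 0≤𝟙 (adj G u v)
    X≤1 : ∀ u v → X u v ≤ 1ℚ
    X≤1 u v = 𝟙≤1 (adj G u v)
    ν N : ℚ
    ν = ℕ→ℚ n
    N = ν * ν
    0<N : 0ℚ < N
    0<N = 0<* (0<ℕ 0<n) (0<ℕ 0<n)
    0≤δd : 0ℚ ≤ δ * d
    0≤δd = 0≤* (<⇒≤ 0<δ) 0≤d

  Ψ : ∀ {k} → Partition n k → ℚ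
  Ψ P = potential X 0≤X X≤1 L (part P)

  stepGain : ℚ
  stepGain = ℤ.+ 1 / 96 * (δ * δ) * (d * N)

  Solved : ∀ {k} → Partition n k → Set
  Solved P = Σ (Graph n) λ H → ℕ→ℚ (editDistance G H) ≤ δ * ℕ→ℚ (edges G) × IsRegularPartition ε H P

  record Improved {k} (P : Partition n k) (K : ℕ) : Set where
    field
      {order size} : ℕ
      Q : Partition n order
      order≤ : order ℕ.≤ K
      0<size : 0 ℕ.< size
      equal : EqualParts size Q
      refines : Refines Q P
      gain : Ψ P + stepGain ≤ Ψ Q

  module _ {k q : ℕ} (P : Partition n k) (eq : EqualParts q P) (0<q : 0 ℕ.< q) (x : ℕ) (k≤x : k ℕ.≤ x)
    (ε-large : 1ℚ ≤ ε * ℕ→ℚ x) (δd-large : ℕ→ℚ 16 ≤ δ * d * ℕ→ℚ x)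
    (n-large : ℕ→ℚ 3 * (ℕ→ℚ (precision x) * ℕ→ℚ (precision x) * (ℕ→ℚ (precision x) * ℕ→ℚ (precision x))) ≤ ν)
    (room : growth x ℕ.< n) where

    private
      z g M : ℕ
      z = precision x
      g = z ℕ.* z
      M = x ℕ.* x ℕ.* colours x

      ξ ζ θ κ : ℚ
      ξ = ℕ→ℚ x
      ζ = ℕ→ℚ z
      θ = frac 1 z
      κ = ℕ→ℚ k

      0≤ξ : 0ℚ ≤ ξ
      0≤ξ = 0≤ℕ x

      0<x : 0 ℕ.< x
      0<x = pos x ε-large
        where
        pos : ∀ x → 1ℚ ≤ ε * ℕ→ℚ x → 0 ℕ.< x
        pos zero h = ⊥-elim (<⇒≱ (0<ℕ {1} (s≤s z≤n)) (≤-trans h (≤-reflexive (*-zeroʳ ε))))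
        pos (suc x) _ = s≤s z≤n

      1≤ξ : 1ℚ ≤ ξ
      1≤ξ = ℕ→ℚ-mono 0<x

      0<M : 0 ℕ.< M
      0<M = ℕᵖ.*-mono-< (ℕᵖ.*-mono-< 0<x 0<x) (ℕᵖ.m^n>0 4 g)

      0<z : 0 ℕ.< z
      0<z = ℕᵖ.*-mono-< {0} {32} (s≤s z≤n) (ℕᵖ.*-mono-<
          (ℕᵖ.*-mono-< (ℕᵖ.*-mono-< (ℕᵖ.*-mono-< 0<x 0<x) 0<x) 0<x) 0<x)

      θζ : θ * ζ ≡ 1ℚ
      θζ = frac-* 1 0<z

      0≤θ : 0ℚ ≤ θ
      0≤θ = 0≤frac1 (part P) z

      ζ-def : ζ ≡ ℕ→ℚ 32 * (ξ * ξ * ξ * ξ * ξ)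
      ζ-def = trans (ℕ→ℚ-* 32 (x ℕ.* x ℕ.* x ℕ.* x ℕ.* x))
          (cong (ℕ→ℚ 32 *_) (trans (ℕ→ℚ-* (x ℕ.* x ℕ.* x ℕ.* x) x) (cong (_* ξ)
        (trans (ℕ→ℚ-* (x ℕ.* x ℕ.* x) x) (cong (_* ξ) (trans (ℕ→ℚ-* (x ℕ.* x) x) (cong (_* ξ) (ℕ→ℚ-* x x))))))))

      ξ≤ζ : ξ ≤ ζ
      ξ≤ζ = ℕ→ℚ-mono (ℕᵖ.≤-trans (ℕᵖ.m≤n*m x (x ℕ.* x ℕ.* x ℕ.* x)
          {{ℕ.>-nonZero (ℕᵖ.*-mono-< (ℕᵖ.*-mono-< (ℕᵖ.*-mono-< 0<x 0<x) 0<x) 0<x)}})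
        (ℕᵖ.m≤n*m (x ℕ.* x ℕ.* x ℕ.* x ℕ.* x) 32))

      θξ≤1 : θ * ξ ≤ 1ℚ
      θξ≤1 = subst (θ * ξ ≤_) θζ (*-monoʳ 0≤θ ξ≤ζ)

      θ≤1 : θ ≤ 1ℚ
      θ≤1 = ≤-trans (subst (_≤ θ * ξ) (*-identityʳ θ) (*-monoʳ 0≤θ 1≤ξ)) θξ≤1

      fine : 1ℚ ≤ ℕ→ℚ g * (θ * θ)
      fine = ≤-reflexive (sym (trans (cong (_* (θ * θ)) (ℕ→ℚ-* z z)) (trans (l ζ θ) (cong (λ w → w * w) θζ))))
        where
        l : ∀ ζ θ → ζ * ζ * (θ * θ) ≡ (θ * ζ) * (θ * ζ)
        l = solve-∀ ℚ-ring

      n-large′ : ℕ→ℚ 3 ≤ θ * θ * (θ * θ) * ν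
      n-large′ = ≤-trans (≤-reflexive (sym (trans (l θ ζ) (cong (λ w → ℕ→ℚ 3 * (w * w * (w * w))) θζ))))
        (*-monoʳ (0≤* (0≤² θ) (0≤² θ)) n-large)
        where
        l : ∀ θ ζ → θ * θ * (θ * θ) * (ℕ→ℚ 3 * (ζ * ζ * (ζ * ζ))) ≡ ℕ→ℚ 3 *
            ((θ * ζ) * (θ * ζ) * ((θ * ζ) * (θ * ζ)))
        l = solve-∀ ℚ-ring

      0≤3θ+θ : 0ℚ ≤ ℕ→ℚ 3 * θ + θ
      0≤3θ+θ = 0≤+ (0≤* (0≤ℕ 3) 0≤θ) 0≤θ

      ε-fine : ℕ→ℚ 8 * (ℕ→ℚ 3 * θ + θ) * (κ * κ) ≤ ε * ε * ε
      ε-fine = ≤-trans (*-monoʳ (0≤* (0≤ℕ 8) 0≤3θ+θ) (*-mono (0≤ℕ k) 0≤ξ (ℕ→ℚ-mono k≤x) (ℕ→ℚ-mono k≤x)))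
        (≤-trans (≤-by (0≤* (0≤* (0≤ℕ 32) (0≤* 0≤θ (0≤² ξ))) (≤⇒0≤- cubes)) (l₁ θ ξ ε))
        (≤-reflexive (trans (l₂ θ ξ ε) (trans (cong (λ w → ε * ε * ε * (θ * w)) (sym ζ-def))
            (trans (cong (ε * ε * ε *_) θζ) (*-identityʳ _))))))
        where
        cubes : 1ℚ ≤ (ε * ξ) * (ε * ξ) * (ε * ξ)
        cubes = *-mono {1ℚ} {_} {1ℚ} 0≤1 (≤-trans 0≤1 ε-large)
            (*-mono {1ℚ} {_} {1ℚ} 0≤1 (≤-trans 0≤1 ε-large) ε-large ε-large) ε-large
        l₁ : ∀ θ ξ ε → ℕ→ℚ 32 * (θ * (ξ * ξ)) * ((ε * ξ) * (ε * ξ) * (ε * ξ) - 1ℚ)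
          ≡ ℕ→ℚ 32 * (θ * (ξ * ξ)) * ((ε * ξ) * (ε * ξ) * (ε * ξ)) - ℕ→ℚ 8 * (ℕ→ℚ 3 * θ + θ) * (ξ * ξ)
        l₁ = solve-∀ ℚ-ring
        l₂ : ∀ θ ξ ε → ℕ→ℚ 32 * (θ * (ξ * ξ)) * ((ε * ξ) * (ε * ξ) * (ε * ξ)) ≡ ε * ε * ε *
            (θ * (ℕ→ℚ 32 * (ξ * ξ * ξ * ξ * ξ)))
        l₂ = solve-∀ ℚ-ring

      cost-fine : ℕ→ℚ 3 * θ ≤ ℚ.½ * (δ * d)
      cost-fine = *-cancelˡ {c = ℕ→ℚ 16} (0<ℕ {16} (s≤s z≤n)) (≤-by
        (0≤+ (0≤* (0≤* (0≤ℕ 3) 0≤θ) (≤⇒0≤- δd-large))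
            (0≤+ (0≤* (0≤* (0≤ℕ 3) 0≤δd) (≤⇒0≤- θξ≤1)) (0≤* (0≤ℕ 5) 0≤δd)))
        (l θ ξ (δ * d)))
        where
        l : ∀ θ ξ δ → ℕ→ℚ 3 * θ * (δ * ξ - ℕ→ℚ 16) + (ℕ→ℚ 3 * δ * (1ℚ - θ * ξ) + ℕ→ℚ 5 * δ)
          ≡ ℕ→ℚ 16 * (ℚ.½ * δ) - ℕ→ℚ 16 * (ℕ→ℚ 3 * θ)
        l = solve-∀ ℚ-ring

      D₀ : Fin n → Fin n → ℚ
      D₀ = blockAverage (part P) X

      scale∈ : ∀ {x y} → 0ℚ ≤ x → x ≤ 1ℚ → 0ℚ ≤ y → y ≤ 1ℚ → 0ℚ ≤ scale x y × scale x y ≤ 1ℚ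
      scale∈ {x} {y} a b c d = let p , q , _ = scaleSign-spec {x} {y} a b c d in p , q

      finish : ∀ {l} (c : Fin n → Fin l) (c≼ : c ≼ part P) →
        CutRegular X 0≤X X≤1 (part P) scale (λ a b c d → proj₁ (scale∈ a b c d))
            (λ a b c d → proj₂ (scale∈ a b c d)) θ c →
        ∑₂ (λ u v → ∣ blockAverage c X u v - D₀ u v ∣) ≤ ℚ.½ * (δ * d) * N → Solved P
      finish c c≼ reg small = H
        , editDistance≤ G H {δ} (≤-trans cost (≤-trans
            (+-mono-≤ (≤-trans (≤-reflexive (sym (*-assoc (ℕ→ℚ 3) θ N))) (*-monoˡ (<⇒≤ 0<N) cost-fine)) small)
            (≤-reflexive (trans (l₁ δ d N) (cong (δ *_) (trans (sym mass) (sym (sumF-count-∑ (adj G)))))))))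
        , allRegular {ε = ε} H P (<⇒≤ 0<ε) (regularPair H P eq 0<q D₀ (blockAverage-meas (part P) X)
            0<ε ε≤1 0≤3θ+θ ε-fine
            (λ S T → ≤-trans (cutClose S T) (≤-reflexive (l₂ θ N))))
        where
        approximation = regularApproximation G (part P) c c≼ {θ} {θ} 0≤θ θ≤1 n-large′ reg
        H : Graph n
        H = proj₁ approximation
        cutClose = proj₁ (proj₂ approximation)
        cost = proj₂ (proj₂ approximation)
        l₁ : ∀ δ d N → ℚ.½ * (δ * d) * N + ℚ.½ * (δ * d) * N ≡ δ * (d * N)
        l₁ = solve-∀ ℚ-ring
        l₂ : ∀ θ N → ℕ→ℚ 3 * (θ * N) + θ * N ≡ (ℕ→ℚ 3 * θ + θ) * N
        l₂ = solve-∀ ℚ-ring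

      improve : ∀ {l} → l ℕ.≤ k ℕ.* 4 ℕ.^ g → (c : Fin n → Fin l) (c≼ : c ≼ part P) →
        ℚ.½ * (δ * d) * N ≤ ∑₂ (λ u v → ∣ blockAverage c X u v - D₀ u v ∣) → Improved P (growth x)
      improve {l} l≤ c c≼ big = record
        { Q = Q ; order≤ = ℕᵖ.≤-trans (ℕᵖ.≤-reflexive (cong (k ℕ.*_) suc-M)) (ℕᵖ.*-monoˡ-≤ M k≤x) ;
            0<size = 0<t ; equal = equal ; refines = refines ; gain = gain }
        where
        M′ : ℕ
        M′ = ℕ.pred M
        suc-M : suc M′ ≡ M
        suc-M = ℕᵖ.suc-pred M {{ℕ.>-nonZero 0<M}}
        t : ℕ
        t = q ℕ./ suc M′
        -- If q were smaller than the number of pieces, n would be at most k M ≤ `growth x`, against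
        -- `room`.
        M≤q : suc M′ ℕ.≤ q
        M≤q = ℕᵖ.≮⇒≥ λ h → ℕᵖ.<⇒≱ room (ℕᵖ.≤-trans (n≤k*suc-q P eq) (ℕᵖ.*-mono-≤ k≤x (subst (suc q ℕ.≤_) suc-M h)))
        0<t : 0 ℕ.< t
        0<t = m≥n⇒m/n>0 M≤q
        lo : suc M′ ℕ.* t ℕ.≤ q
        lo = quotient≤ q M′
        open EquitableRefinement (refineEquitablyInto P eq c M′ M≤q)
        Q≼P : part Q ≼ part P
        Q≼P u v p = trans (proj₂ refines u) (trans (cong (proj₁ refines) p) (sym (proj₂ refines v)))
        few : count spoilt ℕ.* x ℕ.≤ 2 ℕ.* n
        few = begin
          count spoilt ℕ.* x ≤⟨ ℕᵖ.*-monoˡ-≤ x (ℕᵖ.≤-trans spoilt≤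
              (ℕᵖ.*-monoʳ-≤ k (ℕᵖ.*-monoʳ-≤ l (ℕᵖ.+-monoˡ-≤ t 0<t)))) ⟩
          k ℕ.* (l ℕ.* (t ℕ.+ t)) ℕ.* x ≡⟨ l₁ k l t x ⟩
          2 ℕ.* (k ℕ.* (l ℕ.* x ℕ.* t)) ≤⟨ ℕᵖ.*-monoʳ-≤ 2 (ℕᵖ.*-monoʳ-≤ k (ℕᵖ.*-monoˡ-≤ t lx≤M)) ⟩
          2 ℕ.* (k ℕ.* (suc M′ ℕ.* t)) ≤⟨ ℕᵖ.*-monoʳ-≤ 2 (ℕᵖ.≤-trans (ℕᵖ.*-monoʳ-≤ k lo) (k*q≤n P eq)) ⟩
          2 ℕ.* n ∎
          where
          open ℕᵖ.≤-Reasoning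
          l₁ : ∀ k l t x → k ℕ.* (l ℕ.* (t ℕ.+ t)) ℕ.* x ≡ 2 ℕ.* (k ℕ.* (l ℕ.* x ℕ.* t))
          l₁ = ℕ-solve-∀
          l₂ : ∀ k c x → k ℕ.* c ℕ.* x ≡ k ℕ.* x ℕ.* c
          l₂ = ℕ-solve-∀
          lx≤M : l ℕ.* x ℕ.≤ suc M′
          lx≤M = ℕᵖ.≤-trans (ℕᵖ.*-monoˡ-≤ x l≤) (ℕᵖ.≤-trans (ℕᵖ.≤-reflexive (l₂ k (colours x) x))
            (ℕᵖ.≤-trans (ℕᵖ.*-monoˡ-≤ (colours x) (ℕᵖ.*-monoˡ-≤ x k≤x)) (ℕᵖ.≤-reflexive (sym suc-M))))
        s : ℚ
        s = ℕ→ℚ (count spoilt)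
        -- At most 2 n / x vertices are spoilt, and x ≥ 16 / (δ d); so passing from c to `Q` loses
        -- at most half of the threshold δ d N / 2.
        s-small : ℕ→ℚ 8 * s ≤ δ * d * ν
        s-small = *-cancelˡ {c = ξ} (<-≤-trans (0<ℕ {1} (s≤s z≤n)) 1≤ξ) (≤-by
          (0≤+ (0≤* (0≤ℕ 8) (≤⇒0≤- few′)) (0≤* (0≤ℕ n) (≤⇒0≤- δd-large))) (l₁ ξ s ν (δ * d)))
          where
          few′ : s * ξ ≤ ℕ→ℚ 2 * ν
          few′ = subst₂ _≤_ (ℕ→ℚ-* (count spoilt) x) (ℕ→ℚ-* 2 n) (ℕ→ℚ-mono few)
          l₁ : ∀ ξ s ν δ → ℕ→ℚ 8 * (ℕ→ℚ 2 * ν - s * ξ) + ν * (δ * ξ - ℕ→ℚ 16) ≡ ξ * (δ * ν) - ξ * (ℕ→ℚ 8 * s)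
          l₁ = solve-∀ ℚ-ring
        Δ′ : ℚ
        Δ′ = ∑₂ (λ u v → ∣ blockAverage (part Q) X u v - D₀ u v ∣)
        Δ′-large : ℤ.+ 1 / 4 * (δ * d) * N ≤ Δ′
        Δ′-large = ≤-by (0≤+ (≤⇒0≤- (≤-trans big (L¹-transfer X 0≤X X≤1 c≼ Q≼P spoilt spoilt-meas monochromatic)))
            (0≤* (0≤* (nonNegative⁻¹ (ℤ.+ 1 / 4)) (0≤ℕ n)) (≤⇒0≤- s-small))) (l₁ Δ′ ν s (δ * d))
          where
          l₁ : ∀ Δ ν s δ → (Δ + 2ℚ * (ν * s) - ℚ.½ * δ * (ν * ν)) + ℤ.+ 1 / 4 * ν * (δ * ν - ℕ→ℚ 8 * s)
            ≡ Δ - ℤ.+ 1 / 4 * δ * (ν * ν)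
          l₁ = solve-∀ ℚ-ring
        gain : Ψ P + stepGain ≤ Ψ Q
        gain = ≤-trans (+-monoʳ-≤ (Ψ P) (≤-by (0≤* (0≤* (nonNegative⁻¹ (ℤ.+ 1 / 12)) (<⇒≤ 0<δ))
            (≤⇒0≤- Δ′-large)) (l₁ δ d N Δ′)))
          -- For an L¹ change of δ d N / 4 the gain is (θ δ / 2 - 6 θ²) d N, which is maximal at θ =
          -- δ / 24, with value δ² d N / 96.
          (potential-gain X 0≤X X≤1 0≤d d≤1 mass L {θ = ℤ.+ 1 / 24 * δ} Q≼P scales)
          where
          l₁ : ∀ δ d N Δ → ℤ.+ 1 / 12 * δ * (Δ - ℤ.+ 1 / 4 * (δ * d) * N)
            ≡ (2ℚ * (ℤ.+ 1 / 24 * δ) * Δ - ℕ→ℚ 6 * ((ℤ.+ 1 / 24 * δ) * (ℤ.+ 1 / 24 * δ)) * (d * N))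
                - ℤ.+ 1 / 96 * (δ * δ) * (d * N)
          l₁ = solve-∀ ℚ-ring

      WeaklyRegular : Set
      WeaklyRegular = Σ ℕ λ l → l ℕ.≤ k ℕ.* 4 ℕ.^ g × Σ (Fin n → Fin l) λ c → c ≼ part P ×
        CutRegular X 0≤X X≤1 (part P) scale (λ a b c d → proj₁ (scale∈ a b c d))
            (λ a b c d → proj₂ (scale∈ a b c d)) θ c

      decide : WeaklyRegular → Solved P ⊎ Improved P (growth x)
      -- Half of the budget δ d N is reserved for the rounding (`cost-fine`); the other half is the
      -- threshold for the L¹ distance.
      decide (l , l≤ , c , c≼ , reg) = Sum.map (finish c c≼ reg) (improve l≤ c c≼)
        (≤-total (∑₂ (λ u v → ∣ blockAverage c X u v - D₀ u v ∣)) (ℚ.½ * (δ * d) * N))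

    step : Solved P ⊎ Improved P (growth x)
    step = decide (weakRegularity X 0≤X X≤1 (part P) scale (λ a b c d → proj₁ (scale∈ a b c d))
        (λ a b c d → proj₂ (scale∈ a b c d)) {θ} g 0≤θ 0<N fine)

-- Powers, logarithms and towers

0≤^ : ∀ {r} k → 0ℚ ≤ r → 0ℚ ≤ r ^ℚ k
0≤^ zero 0≤r = 0≤1
0≤^ (suc k) 0≤r = 0≤* 0≤r (0≤^ k 0≤r)

0<^ : ∀ {r} k → 0ℚ < r → 0ℚ < r ^ℚ k
0<^ zero 0<r = 0<ℕ {1} (s≤s z≤n)
0<^ (suc k) 0<r = 0<* 0<r (0<^ k 0<r)

^-mono : ∀ {r s} k → 0ℚ ≤ r → r ≤ s → r ^ℚ k ≤ s ^ℚ k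
^-mono zero 0≤r r≤s = ≤-refl
^-mono (suc k) 0≤r r≤s = *-mono 0≤r (0≤^ k (≤-trans 0≤r r≤s)) r≤s (^-mono k 0≤r r≤s)

^-mono-< : ∀ {r s} k → 0ℚ ≤ r → r < s → r ^ℚ suc k < s ^ℚ suc k
^-mono-< {r} {s} k 0≤r r<s = ≤-<-trans (*-monoʳ 0≤r (^-mono k 0≤r (<⇒≤ r<s)))
  (*-monoˡ-<-pos (s ^ℚ k) {{ℚ.positive (0<^ k (≤-<-trans 0≤r r<s))}} r<s)

^-cancel-≤ : ∀ {r s} k → 0ℚ ≤ s → r ^ℚ suc k ≤ s ^ℚ suc k → r ≤ s
^-cancel-≤ k 0≤s h = ≮⇒≥ λ s<r → <⇒≱ (^-mono-< k 0≤s s<r) h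

^-+ : ∀ r j k → r ^ℚ (j ℕ.+ k) ≡ r ^ℚ j * r ^ℚ k
^-+ r zero k = sym (*-identityˡ (r ^ℚ k))
^-+ r (suc j) k = trans (cong (r *_) (^-+ r j k)) (sym (*-assoc r (r ^ℚ j) (r ^ℚ k)))

^-* : ∀ r j k → r ^ℚ (j ℕ.* k) ≡ (r ^ℚ k) ^ℚ j
^-* r zero k = refl
^-* r (suc j) k = trans (^-+ r k (j ℕ.* k)) (cong (r ^ℚ k *_) (^-* r j k))

ℕ→ℚ-^ : ∀ a k → ℕ→ℚ (a ℕ.^ k) ≡ ℕ→ℚ a ^ℚ k
ℕ→ℚ-^ a zero = refl
ℕ→ℚ-^ a (suc k) = trans (ℕ→ℚ-* a (a ℕ.^ k)) (cong (ℕ→ℚ a *_) (ℕ→ℚ-^ a k))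

2^-^ : ∀ a k → 2^ a ^ℚ k ≡ 2^ (a ℕ.* k)
2^-^ a k = trans (sym (ℕ→ℚ-^ (2 ℕ.^ a) k)) (cong ℕ→ℚ (ℕᵖ.^-*-assoc 2 a k))

2^-cancel-≤ : ∀ {a b} → 2^ a ≤ 2^ b → a ℕ.≤ b
2^-cancel-≤ {a} {b} h = ℕᵖ.≮⇒≥ λ b<a → <⇒≱ (ℕ→ℚ-mono-< (ℕᵖ.^-monoʳ-< 2 (s≤s (s≤s z≤n)) b<a)) h

^-cancelʳ-≤ : ∀ {x a b} → 0ℚ < x → (1ℚ + x) ^ℚ a ≤ (1ℚ + x) ^ℚ b → a ℕ.≤ b
^-cancelʳ-≤ {x} {a} {b} 0<x h = ℕᵖ.≮⇒≥ λ b<a → <⇒≱ (strict b<a) h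
  where
  0<1+x : 0ℚ < 1ℚ + x
  0<1+x = +-mono-≤-< 0≤1 0<x
  1≤^ : ∀ k → 1ℚ ≤ (1ℚ + x) ^ℚ k
  1≤^ zero = ≤-refl
  1≤^ (suc k) = *-mono {1ℚ} {1ℚ + x} {1ℚ} 0≤1 (0≤^ k (<⇒≤ 0<1+x)) (≤-by (<⇒≤ 0<x) (l x)) (1≤^ k)
    where
    l : ∀ x → x ≡ (1ℚ + x) - 1ℚ
    l = solve-∀ ℚ-ring
  strict : b ℕ.< a → (1ℚ + x) ^ℚ b < (1ℚ + x) ^ℚ a
  strict b<a = subst (λ a → (1ℚ + x) ^ℚ b < (1ℚ + x) ^ℚ a) (ℕᵖ.m+[n∸m]≡n b<a) (<-≤-trans
    (<-by (0<* 0<x (0<^ b 0<1+x)) (l x ((1ℚ + x) ^ℚ b)))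
    (≤-trans (≤-trans (≤-reflexive (sym (*-identityʳ ((1ℚ + x) ^ℚ suc b))))
        (*-monoʳ (0≤^ (suc b) (<⇒≤ 0<1+x)) (1≤^ (a ℕ.∸ suc b))))
      (≤-reflexive (sym (^-+ (1ℚ + x) (suc b) (a ℕ.∸ suc b))))))
    where
    l : ∀ x y → x * y ≡ (1ℚ + x) * y - y
    l = solve-∀ ℚ-ring

bernoulli : ∀ {x} k → 0ℚ ≤ x → 1ℚ + ℕ→ℚ k * x ≤ (1ℚ + x) ^ℚ k
bernoulli {x} zero 0≤x = ≤-reflexive (trans (cong (1ℚ +_) (*-zeroˡ x)) (+-identityʳ 1ℚ))
bernoulli {x} (suc k) 0≤x = ≤-trans
  (≤-by (0≤* (0≤ℕ k) (0≤² x)) (trans (l x (ℕ→ℚ k))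
      (cong (λ z → (1ℚ + x) * (1ℚ + ℕ→ℚ k * x) - (1ℚ + z * x)) (sym (ℕ→ℚ-suc k)))))
  (*-monoʳ (0≤+ 0≤1 0≤x) (bernoulli k 0≤x))
  where
  l : ∀ x k → k * (x * x) ≡ (1ℚ + x) * (1ℚ + k * x) - (1ℚ + (1ℚ + k) * x)
  l = solve-∀ ℚ-ring

natFloor : ∀ y → 0ℚ ≤ y → Σ ℕ λ K → ℕ→ℚ K ≤ y × y < ℕ→ℚ (suc K)
natFloor (mkℚ -[1+ a ] b c) (*≤* ())
natFloor (mkℚ (ℤ.+ a) b c) _ = K
  , subst (_≤ mkℚ (ℤ.+ a) b c) (sym (ℕ→ℚ-def K)) (*≤*
      (subst₂ ℤ._≤_ (ℤᵖ.pos-* K (suc b)) (sym (ℤᵖ.*-identityʳ (ℤ.+ a))) (ℤ.+≤+ (m/n*n≤m a (suc b)))))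
  , subst (mkℚ (ℤ.+ a) b c <_) (sym (ℕ→ℚ-def (suc K)))
      (*<* (subst₂ ℤ._<_ (sym (ℤᵖ.*-identityʳ (ℤ.+ a))) (ℤᵖ.pos-* (suc K) (suc b)) (ℤ.+<+ below)))
  where
  K : ℕ
  K = a ℕ./ suc b
  below : a ℕ.< suc K ℕ.* suc b
  below = ℕᵖ.≤-<-trans (ℕᵖ.≤-reflexive (m≡m%n+[m/n]*n a (suc b))) (ℕᵖ.+-monoˡ-< (K ℕ.* suc b) (m%n<n a (suc b)))

archimedean : ∀ {x} → 0ℚ < x → ∀ y → 0ℚ ≤ y → Σ ℕ λ b → y ≤ ℕ→ℚ (suc b) * x × ℕ→ℚ b * x ≤ y
archimedean {x} 0<x y 0≤y = let K , lo , hi = natFloor (y * inv x 0<x) (0≤* 0≤y (<⇒≤ (0<inv x 0<x))) in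
  K , subst (_≤ ℕ→ℚ (suc K) * x) cancel′ (*-monoˡ (<⇒≤ 0<x) (<⇒≤ hi)) , subst (ℕ→ℚ K * x ≤_) cancel′
      (*-monoˡ (<⇒≤ 0<x) lo)
  where
  cancel′ : y * inv x 0<x * x ≡ y
  cancel′ = trans (*-assoc y (inv x 0<x) x) (trans (cong (y *_) (inv-*ˡ x 0<x)) (*-identityʳ y))

-- Clears the denominator of s, so that comparisons of logarithms become comparisons of natural
-- exponents.
log-fraction : ∀ r s → 0ℚ < s → Log2≤ r s → Σ ℕ λ a → Σ ℕ λ b → r ^ℚ suc b ≤ 2^ a × s * ℕ→ℚ (suc b) ≡ ℕ→ℚ a
log-fraction r (mkℚ -[1+ a ] b c) (*<* ()) h
log-fraction r s@(mkℚ (ℤ.+ a) b _) _ h = a , b , h ,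
  trans (cong (_* ℕ→ℚ (suc b)) (sym (↥p/↧p≡p s))) (frac-def a b)

module _ {r s : ℚ} (0<s : 0ℚ < s) (log : Log2≤ r s) where
  private
    a b : ℕ
    a = proj₁ (log-fraction r s 0<s log)
    b = proj₁ (proj₂ (log-fraction r s 0<s log))
    r^≤ : r ^ℚ suc b ≤ 2^ a
    r^≤ = proj₁ (proj₂ (proj₂ (log-fraction r s 0<s log)))
    sb≡a : s * ℕ→ℚ (suc b) ≡ ℕ→ℚ a
    sb≡a = proj₂ (proj₂ (proj₂ (log-fraction r s 0<s log)))
    0<b : 0ℚ < ℕ→ℚ (suc b)
    0<b = 0<ℕ {suc b} (s≤s z≤n)

  log-lower : ∀ L → 2^ L ≤ r → ℕ→ℚ L ≤ s
  log-lower L h = *-cancelˡ {c = ℕ→ℚ (suc b)} 0<b (subst₂ _≤_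
    (trans (ℕ→ℚ-* L (suc b)) (*-comm (ℕ→ℚ L) (ℕ→ℚ (suc b)))) (trans (sym sb≡a) (*-comm s (ℕ→ℚ (suc b))))
    (ℕ→ℚ-mono (2^-cancel-≤ {L ℕ.* suc b} {a} (≤-trans (≤-reflexive (sym (2^-^ L (suc b))))
        (≤-trans (^-mono (suc b) (0≤2^ L) h) r^≤)))))

  log-upper : ∀ h → s ≤ ℕ→ℚ h → r ≤ 2^ h
  log-upper h s≤h = ^-cancel-≤ b (0≤2^ h) (≤-trans r^≤
      (≤-trans (ℕ→ℚ-mono (ℕᵖ.^-monoʳ-≤ 2 a≤)) (≤-reflexive (sym (2^-^ h (suc b))))))
    where
    a≤ : a ℕ.≤ h ℕ.* suc b
    a≤ = ℕ→ℚ-cancel-≤ (subst₂ _≤_ sb≡a (sym (ℕ→ℚ-* h (suc b))) (*-monoˡ (<⇒≤ 0<b) s≤h))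

  -- With j ≈ 1/x, Bernoulli gives (1 + x)^j ≥ 2 and hence log₂ (1 + x) ≥ 1/j ≥ x/2.
  log-linear : ∀ {x} → 0ℚ < x → x ≤ 1ℚ → 1ℚ + x ≤ r → x ≤ 2ℚ * s
  log-linear {x} 0<x x≤1 h = *-cancelˡ {c = ℕ→ℚ (suc b)} 0<b (≤-trans
      (≤-trans (*-monoˡ 0≤x (≤-trans (ℕ→ℚ-mono sb≤) (≤-reflexive (ℕ→ℚ-* a j))))
          (≤-by (0≤* (0≤ℕ a) (≤⇒0≤- jx≤)) (l₁ (ℕ→ℚ a) (ℕ→ℚ j) x)))
      (≤-reflexive (trans (cong (_* 2ℚ) (sym sb≡a)) (l₂ s (ℕ→ℚ (suc b))))))
    where
    0≤x : 0ℚ ≤ x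
    0≤x = <⇒≤ 0<x
    k j : ℕ
    k = proj₁ (archimedean 0<x 1ℚ 0≤1)
    j = suc k
    two≤ : 2ℚ ≤ (1ℚ + x) ^ℚ j
    two≤ = ≤-trans (+-monoʳ-≤ 1ℚ (proj₁ (proj₂ (archimedean 0<x 1ℚ 0≤1)))) (bernoulli j 0≤x)
    jx≤ : ℕ→ℚ j * x ≤ 2ℚ
    jx≤ = ≤-trans (≤-reflexive (trans (cong (_* x) (ℕ→ℚ-suc k)) (l x (ℕ→ℚ k))))
        (+-mono-≤ x≤1 (proj₂ (proj₂ (archimedean 0<x 1ℚ 0≤1))))
      where
      l : ∀ x k → (1ℚ + k) * x ≡ x + k * x
      l = solve-∀ ℚ-ring
    2^≤ : 2^ a ≤ (1ℚ + x) ^ℚ (a ℕ.* j)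
    2^≤ = ≤-trans (≤-reflexive (ℕ→ℚ-^ 2 a)) (≤-trans (^-mono a (0≤ℕ 2) two≤) (≤-reflexive (sym (^-* (1ℚ + x) a j))))
    sb≤ : suc b ℕ.≤ a ℕ.* j
    sb≤ = ^-cancelʳ-≤ {x} {suc b} {a ℕ.* j} 0<x (≤-trans (^-mono (suc b) (0≤+ 0≤1 0≤x) h) (≤-trans r^≤ 2^≤))
    l₁ : ∀ a j x → a * (2ℚ - j * x) ≡ a * 2ℚ - a * j * x
    l₁ = solve-∀ ℚ-ring
    l₂ : ∀ s b → s * b * 2ℚ ≡ b * (2ℚ * s)
    l₂ = solve-∀ ℚ-ring

-- Integer towers below the real tower

tower : ℕ → ℕ → ℕ
tower K zero = K
tower K (suc h) = 2 ℕ.^ tower K h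

1≤tower : ∀ {K} → 0 ℕ.< K → ∀ h → 0 ℕ.< tower K h
1≤tower 0<K zero = 0<K
1≤tower {K} 0<K (suc h) = ℕᵖ.m^n>0 2 (tower K h)

-- Bernoulli's inequality for A / r, with denominators cleared in `grow`. The factor 2 pays for
-- lowering an exponent by one, which leaves room for a rational bound on log₂ r strictly below log₂
-- A.
power-gap : ∀ {r A} → 0ℚ < r → r < A → Σ ℕ λ b → 2ℚ * r ^ℚ suc b ≤ A ^ℚ suc b
power-gap {r} {A} 0<r r<A = b , *-cancelˡ 0<r (≤-trans
    (≤-by (0≤* (0≤^ (suc b) 0≤r) (≤⇒0≤- r≤)) (l₁ r (r ^ℚ suc b) (ℕ→ℚ (suc b) * (A - r))))
    (≤-trans (grow (suc b)) (≤-reflexive (*-comm (A ^ℚ suc b) r))))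
  where
  0≤r : 0ℚ ≤ r
  0≤r = <⇒≤ 0<r
  b : ℕ
  b = proj₁ (archimedean (<⇒0<- r<A) r 0≤r)
  r≤ : r ≤ ℕ→ℚ (suc b) * (A - r)
  r≤ = proj₁ (proj₂ (archimedean (<⇒0<- r<A) r 0≤r))
  l₁ : ∀ r p x → p * (x - r) ≡ p * (r + x) - r * (2ℚ * p)
  l₁ = solve-∀ ℚ-ring
  grow : ∀ b → r ^ℚ b * (r + ℕ→ℚ b * (A - r)) ≤ A ^ℚ b * r
  grow zero = ≤-reflexive (cong (1ℚ *_) (trans (cong (r +_) (*-zeroˡ (A - r))) (+-identityʳ r)))
  grow (suc b) = ≤-trans (≤-by (0≤* (0≤^ b 0≤r) (0≤* (0≤ℕ b) (0≤² (A - r))))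
      (trans (l r A (r ^ℚ b) (ℕ→ℚ b)) (cong (λ z → A * (r ^ℚ b * (r + ℕ→ℚ b * (A - r))) - r * r ^ℚ b
          * (r + z * (A - r))) (sym (ℕ→ℚ-suc b)))))
    (≤-trans (*-monoʳ (<⇒≤ (<-trans 0<r r<A)) (grow b)) (≤-reflexive (sym (*-assoc A (A ^ℚ b) r))))
    where
    l : ∀ r A p b → p * (b * ((A - r) * (A - r))) ≡ A * (p * (r + b * (A - r))) - r * p * (r + (1ℚ + b) * (A - r))
    l = solve-∀ ℚ-ring

below-tower : ∀ {K y} → 0 ℕ.< K → ℕ→ℚ K ≤ y → ∀ h r → r < ℕ→ℚ (tower K h) → LtTwr r y h
below-tower 0<K K≤y zero r r<K = <-≤-trans r<K K≤y
below-tower {K} {y} 0<K K≤y (suc h) r r< with r ≤? 0ℚ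
... | yes r≤0 = inj₁ r≤0
... | no r≰0 = inj₂ (s , 0<r , r^≤ , below-tower 0<K K≤y h s s<)
  where
  a : ℕ
  a = tower K h
  0<r : 0ℚ < r
  0<r = ≰⇒> r≰0
  b : ℕ
  b = proj₁ (power-gap 0<r r<)
  n : ℕ
  n = ℕ.pred (a ℕ.* suc b)
  suc-n : suc n ≡ a ℕ.* suc b
  suc-n = ℕᵖ.suc-pred (a ℕ.* suc b) {{ℕ.>-nonZero (ℕᵖ.*-mono-< (1≤tower 0<K h) (s≤s (z≤n {b})))}}
  coprime : Cop.Coprime n (suc b)
  coprime {d} (d∣n , d∣b) = ∣1⇒≡1 (∣m+n∣m⇒∣n {d} {n} {1}
      (subst (d Div.∣_) (trans (sym suc-n) (sym (ℕᵖ.+-comm n 1))) (∣n⇒∣m*n a d∣b)) d∣n)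
  -- This is a - 1 / (b + 1), built directly in lowest terms so that `Log2≤` computes on its
  -- numerator and denominator.
  s : ℚ
  s = mkℚ (ℤ.+ n) b coprime
  r^≤ : r ^ℚ suc b ≤ 2^ n
  r^≤ = *-cancelˡ {c = 1ℚ + 1ℚ} (0<ℕ {2} (s≤s z≤n)) (≤-trans (proj₂ (power-gap 0<r r<))
    (≤-reflexive (trans (2^-^ a (suc b)) (trans (cong 2^ (sym suc-n)) (2^-suc n)))))
  s< : s < ℕ→ℚ a
  s< = subst (s <_) (sym (ℕ→ℚ-def a)) (*<* (subst₂ ℤ._<_ (sym (ℤᵖ.*-identityʳ (ℤ.+ n))) (ℤᵖ.pos-* a (suc b))
    (ℤ.+<+ (ℕᵖ.≤-reflexive suc-n))))

Outcome : ∀ {n k₀} → ℚ → ℚ → Graph n → Partition n k₀ → ℕ → Set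
Outcome {n} ε δ G P₀ S = Σ (Graph n) λ G′ → (ℕ→ℚ (editDistance G G′) ≤ δ * ℕ→ℚ (edges G)) ×
  Σ ℕ λ k → (k ℕ.≤ S) × Σ (Partition n k) λ P → IsEquipartition P × Refines P P₀ × IsRegularPartition ε G′ P

refines-trans : ∀ {n k l m} (R : Partition n m) (Q : Partition n l) (P : Partition n k) → Refines R
    Q → Refines Q P → Refines R P
refines-trans R Q P (g , p) (h , q) = h ∘ g , λ v → trans (q v) (cong h (p v))

-- Iterating the refinement step

module _ {n : ℕ} (G : Graph n) (0<n : 0 ℕ.< n) {ε δ d : ℚ} (0<ε : 0ℚ < ε) (ε≤1 : ε ≤ 1ℚ) (0<δ : 0ℚ < δ)
  (0≤d : 0ℚ ≤ d) (d≤1 : d ≤ 1ℚ) (mass : ∑₂ (adjacency G) ≡ d * (ℕ→ℚ n * ℕ→ℚ n))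
  (L : ℕ) (scales : half^ L ≤ 2ℚ * d) where
  private
    Φ : ∀ {k} → Partition n k → ℚ
    Φ = Ψ G 0<n 0<ε ε≤1 0<δ 0≤d d≤1 mass L scales
    unit : ℚ
    unit = stepGain G 0<n 0<ε ε≤1 0<δ 0≤d d≤1 mass L scales

  -- After i improvements the potential is at least base + i unit, so `limit` rules out T + 1 of
  -- them. `bound i` is fixed in advance and dominates the order after i steps, whatever the actual
  -- order is.
  iterate : ∀ {k₀} (P₀ : Partition n k₀) {base top : ℚ} (bound : ℕ → ℕ) (T S : ℕ) →
    top < base + ℕ→ℚ (suc T) * unit →
    (∀ {k} (P : Partition n k) → Φ P ≤ top) →
    (∀ i → i ℕ.≤ T → growth (bound i) ℕ.≤ bound (suc i)) →
    (∀ i → i ℕ.≤ T → growth (bound i) ℕ.< n) →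
    (∀ i → i ℕ.≤ T → ℕ→ℚ 3 * (ℕ→ℚ (precision (bound i)) * ℕ→ℚ (precision (bound i)) *
        (ℕ→ℚ (precision (bound i)) * ℕ→ℚ (precision (bound i)))) ≤ ℕ→ℚ n) →
    (∀ i → i ℕ.≤ T → 1ℚ ≤ ε * ℕ→ℚ (bound i)) →
    (∀ i → i ℕ.≤ T → ℕ→ℚ 16 ≤ δ * d * ℕ→ℚ (bound i)) →
    (∀ i → i ℕ.≤ T → bound i ℕ.≤ S) →
    ∀ fuel i → fuel ℕ.+ i ≡ suc T → ∀ {k q} (P : Partition n k) → EqualParts q P → 0 ℕ.< q → k ℕ.≤ bound i →
    base + ℕ→ℚ i * unit ≤ Φ P → Refines P P₀ → Outcome ε δ G P₀ S
  iterate P₀ {base} {top} bound T S limit ≤top grow room large ε-large δd-large ≤S = loop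
    where
    loop : ∀ fuel i → fuel ℕ.+ i ≡ suc T → ∀ {k q} (P : Partition n k) → EqualParts q P → 0 ℕ.< q → k ℕ.≤ bound i →
      base + ℕ→ℚ i * unit ≤ Φ P → Refines P P₀ → Outcome ε δ G P₀ S
    loop zero i refl P _ _ _ high _ = ⊥-elim (<⇒≱ limit (≤-trans high (≤top P)))
    loop (suc fuel) i eq {k} {q} P equal 0<q k≤ high ref = continue
      (step G 0<n 0<ε ε≤1 0<δ 0≤d d≤1 mass L scales P equal 0<q (bound i) k≤ (ε-large i i≤T)
          (δd-large i i≤T) (large i i≤T) (room i i≤T))
      where
      i≤T : i ℕ.≤ T
      i≤T = subst (i ℕ.≤_) (ℕᵖ.suc-injective eq) (ℕᵖ.m≤n+m i fuel)
      l : ∀ b i u → b + (1ℚ + i) * u ≡ b + i * u + u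
      l = solve-∀ ℚ-ring
      continue : Solved G 0<n 0<ε ε≤1 0<δ 0≤d d≤1 mass L scales P ⊎ Improved G 0<n 0<ε ε≤1 0<δ 0≤d
          d≤1 mass L scales P (growth (bound i)) → Outcome ε δ G P₀ S
      continue (inj₁ (H , cost , reg)) = H , cost , k , ℕᵖ.≤-trans k≤ (≤S i i≤T) , P ,
          equalParts⇒equipartition P equal , ref , reg
      continue (inj₂ better) = loop fuel (suc i) (trans (ℕᵖ.+-suc fuel i) eq) B.Q B.equal B.0<size
        (ℕᵖ.≤-trans B.order≤ (grow i i≤T))
        (≤-trans (≤-reflexive (trans (cong (λ z → base + z * unit) (ℕ→ℚ-suc i))
            (l base (ℕ→ℚ i) unit))) (≤-trans (+-monoˡ-≤ unit high) B.gain))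
        (refines-trans B.Q P P₀ B.refines ref)
        where module B = Improved better

-- Small vertex sets and nearly complete graphs

module _ {n : ℕ} (G : Graph n) where
  pairDensity-cong : ∀ {A A′ B B′ : VSet n} → (∀ v → A v ≡ A′ v) → (∀ v → B v ≡ B′ v) → pairDensity
      G A B ≡ pairDensity G A′ B′
  pairDensity-cong {A} {A′} {B} {B′} p q = cong₂ frac
    (sumF-cong λ u → count-cong λ v → cong₂ (λ a b → a ∧ b ∧ adj G u v) (p u) (q v))
        (cong₂ ℕ._*_ (count-cong p) (count-cong q))

  pairDensity-complete : ∀ {A B : VSet n} → (∀ u v → A u ≡ true → B v ≡ true → adj G u v ≡ true) →
    0 ℕ.< ∣ A ∣ˢ → 0 ℕ.< ∣ B ∣ˢ → pairDensity G A B ≡ 1ℚ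
  pairDensity-complete {A} {B} full 0<A 0<B = ≤-antisym
      (*-cancelˡ {c = ℕ→ℚ ab} 0<ab (≤-reflexive eq)) (*-cancelˡ {c = ℕ→ℚ ab} 0<ab (≤-reflexive (sym eq)))
    where
    ab : ℕ
    ab = ∣ A ∣ˢ ℕ.* ∣ B ∣ˢ
    0<ab : 0ℚ < ℕ→ℚ ab
    0<ab = 0<ℕ {ab} (ℕᵖ.*-mono-< 0<A 0<B)
    pt : ∀ u v α β → A u ≡ α → B v ≡ β → 𝟙 α * 𝟙 β * 𝟙 (adj G u v) ≡ 𝟙 α * 𝟙 β
    pt u v true true p q = cong (λ z → 1ℚ * 1ℚ * 𝟙 z) (full u v p q)
    pt u v true false _ _ = *-zeroˡ (𝟙 (adj G u v))
    pt u v false true _ _ = *-zeroˡ (𝟙 (adj G u v))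
    pt u v false false _ _ = *-zeroˡ (𝟙 (adj G u v))
    eq : ℕ→ℚ ab * pairDensity G A B ≡ ℕ→ℚ ab * 1ℚ
    eq = trans (*-comm (ℕ→ℚ ab) (pairDensity G A B)) (trans (frac-* (e G A B) (ℕᵖ.*-mono-< 0<A 0<B))
      (trans (e-∑ G A B) (trans (∑₂-cong λ u v → pt u v (A u) (B v) refl refl)
        (trans (∑₂-product A B) (trans (sym (ℕ→ℚ-* ∣ A ∣ˢ ∣ B ∣ˢ)) (sym (*-identityʳ (ℕ→ℚ ab))))))))

∣x-x∣≤ : ∀ x {ε} → 0ℚ ≤ ε → ∣ x - x ∣ ≤ ε
∣x-x∣≤ x {ε} 0≤ε = subst (λ z → ∣ z ∣ ≤ ε) (sym (+-inverseʳ x)) 0≤ε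

positive-size : ∀ {n ε} {A B : VSet n} → 0ℚ < ε → 0 ℕ.< ∣ A ∣ˢ → ε * ℕ→ℚ ∣ A ∣ˢ ≤ ℕ→ℚ ∣ B ∣ˢ → 0 ℕ.< ∣ B ∣ˢ
positive-size {A = A} 0<ε 0<A h = ℕ→ℚ-cancel-< {0} (<-≤-trans (0<* 0<ε (0<ℕ {∣ A ∣ˢ} 0<A)) h)

part-nonempty : ∀ {n k} (P : Partition n k) i → 0 ℕ.< ∣ Part P i ∣ˢ
part-nonempty P i = count-pos (Part P i) (proj₁ (nonempty P i)) (⌊≟⌋-complete (proj₂ (nonempty P i)))

true≢false : true ≢ false
true≢false ()

discretePartition : ∀ n → Partition n n
discretePartition n = record { part = id ; nonempty = λ v → v , refl }

-- For ε > 0 an admissible subset of a singleton is nonempty, hence the whole singleton; so every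
-- pair is regular and G stays unedited.
discreteOutcome : ∀ {n k₀ ε δ S} (G : Graph n) (P₀ : Partition n k₀) → 0ℚ < ε → 0ℚ ≤ δ → n ℕ.≤ S →
    Outcome ε δ G P₀ S
discreteOutcome {n} {k₀} {ε} {δ} G P₀ 0<ε 0≤δ n≤S = G
  , editDistance≤ G G {δ} (≤-trans (≤-reflexive no-flips) (0≤* 0≤δ (0≤ℕ (twiceEdges G))))
  , n , n≤S , Pᵈ , (λ i j → ℕᵖ.≤-trans (single i) (s≤s z≤n)) , (part P₀ , λ v → refl)
  , allRegular {ε = ε} G Pᵈ (<⇒≤ 0<ε) regular
  where
  Pᵈ : Partition n n
  Pᵈ = discretePartition n
  no-flips : ∑₂ (λ u v → flipSign G u v * (adjacency G u v - adjacency G u v)) ≡ 0ℚ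
  no-flips = trans (∑₂-cong λ u v → trans (cong (flipSign G u v *_) (+-inverseʳ (adjacency G u v)))
      (*-zeroʳ (flipSign G u v)))
    (trans (∑₂-const {n} {n} 0ℚ) (*-zeroʳ (ℕ→ℚ n * ℕ→ℚ n)))
  single : ∀ i → ∣ Part Pᵈ i ∣ˢ ℕ.≤ 1
  single i = ℕ→ℚ-cancel-≤ {∣ Part Pᵈ i ∣ˢ} {1} (≤-reflexive
      (trans (count-∑ (Part Pᵈ i)) (trans (∑-cong λ v → cong 𝟙 (≟-comm v i)) (∑-indicator i))))
  whole : ∀ i {A : VSet n} → A ⊆ˢ Part Pᵈ i → ε * ℕ→ℚ ∣ Part Pᵈ i ∣ˢ ≤ ℕ→ℚ ∣ A ∣ˢ → ∀ v → Part Pᵈ i v ≡ A v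
  whole i {A} A⊆ h v = pt (A v) refl
    where
    w = count-positive A (positive-size {A = Part Pᵈ i} {A} 0<ε (part-nonempty Pᵈ i) h)
    w≡i : proj₁ w ≡ i
    w≡i = ⌊≟⌋-sound (⊆ˢ-apply {A = A} {Part Pᵈ i} A⊆ (proj₁ w) (proj₂ w))
    pt : ∀ α → A v ≡ α → Part Pᵈ i v ≡ A v
    pt true p = trans (⊆ˢ-apply {A = A} {Part Pᵈ i} A⊆ v p) (sym p)
    pt false p = trans (off ⌊ v Fin.≟ i ⌋ refl) (sym p)
      where
      off : ∀ β → ⌊ v Fin.≟ i ⌋ ≡ β → ⌊ v Fin.≟ i ⌋ ≡ false
      off false q = q
      off true q = ⊥-elim (true≢false (trans (sym (proj₂ w))
          (trans (cong A (trans w≡i (sym (⌊≟⌋-sound {i = v} q)))) p)))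
  regular : ∀ i j → RegularPair ε G (Part Pᵈ i) (Part Pᵈ j)
  regular i j A B A⊆ B⊆ hA hB = subst (λ z → ∣ pairDensity G (Part Pᵈ i) (Part Pᵈ j) - z ∣ ≤ ε)
    (pairDensity-cong G {Part Pᵈ i} {A} {Part Pᵈ j} {B} (whole i {A} A⊆ hA) (whole j {B} B⊆ hB))
        (∣x-x∣≤ (pairDensity G (Part Pᵈ i) (Part Pᵈ j)) (<⇒≤ 0<ε))

≢⇒not-≟ : ∀ {k} {i j : Fin k} → i ≢ j → not ⌊ i Fin.≟ j ⌋ ≡ true
≢⇒not-≟ {i = i} {j} i≢j with i Fin.≟ j
... | yes i≡j = ⊥-elim (i≢j i≡j)
... | no _ = refl

completeGraph : ∀ n → Graph n
completeGraph n = record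
  { adj = λ u v → not ⌊ u Fin.≟ v ⌋ ; sym = λ u v → cong not (≟-comm u v) ; irrefl = λ u → cong not (≟-refl u) }

-- In a complete graph the density between subsets of distinct parts is 1. The k pairs of a part
-- with itself, disturbed by the missing loops, are declared exceptional; they are at most ε k² once
-- ε k ≥ 1.
completeOutcome : ∀ {n k₀ ε δ d S} (G : Graph n) (P₀ : Partition n k₀) → 0 ℕ.< n → IsEquipartition P₀ →
  0ℚ < ε → ∑₂ (adjacency G) ≡ d * (ℕ→ℚ n * ℕ→ℚ n) → 1ℚ - d ≤ δ * d →
  ∀ M → 1ℚ ≤ ε * ℕ→ℚ (k₀ ℕ.* suc M) → k₀ ℕ.* suc M ℕ.≤ S → S ℕ.< n → Outcome ε δ G P₀ S
completeOutcome {n} {k₀} {ε} {δ} {d} {S} G P₀ 0<n equi 0<ε mass d-large M fine small room = H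
  , editDistance≤ G H {δ} flips
  , k₀ ℕ.* suc M , small , Q , equalParts⇒equipartition Q equal , refines
  , (λ i j → ⌊ i Fin.≟ j ⌋) , few , regular
  where
  H : Graph n
  H = completeGraph n
  X : Fin n → Fin n → ℚ
  X = adjacency G
  N : ℚ
  N = ℕ→ℚ n * ℕ→ℚ n
  pt : ∀ u v → flipSign G u v * (adjacency H u v - X u v) ≤ 1ℚ * 1ℚ + (- 1ℚ) * X u v
  pt u v with u Fin.≟ v
  ... | yes refl rewrite irrefl G u = 0≤1
  ... | no _ with adj G u v
  ...   | true = ≤-refl
  ...   | false = ≤-refl
  flips : ∑₂ (λ u v → flipSign G u v * (adjacency H u v - X u v)) ≤ δ * ℕ→ℚ (twiceEdges G)
  flips = ≤-trans (∑₂-mono pt) (≤-trans (≤-reflexive (trans (∑₂-lin 1ℚ (- 1ℚ) (λ _ _ → 1ℚ) X)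
      (trans (cong₂ (λ a b → 1ℚ * a + (- 1ℚ) * b) (∑₂-const {n} {n} 1ℚ) mass) (l d N))))
    (≤-trans (*-monoˡ (0≤² (ℕ→ℚ n)) d-large) (≤-reflexive
        (trans (*-assoc δ d N) (cong (δ *_) (trans (sym mass) (sym (sumF-count-∑ (adj G)))))))))
    where
    l : ∀ d N → 1ℚ * (N * 1ℚ) + (- 1ℚ) * (d * N) ≡ (1ℚ - d) * N
    l = solve-∀ ℚ-ring
  0<k₀ : 0 ℕ.< k₀
  0<k₀ = nonempty-colours (part P₀) (Fin.fromℕ< 0<n)
  q : ℕ
  q = proj₁ (equipartition⇒equalParts P₀ 0<k₀ equi)
  eq₀ : EqualParts q P₀
  eq₀ = proj₂ (equipartition⇒equalParts P₀ 0<k₀ equi)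
  M≤q : suc M ℕ.≤ q
  M≤q = ℕᵖ.≮⇒≥ λ h → ℕᵖ.<⇒≱ room (ℕᵖ.≤-trans (n≤k*suc-q P₀ eq₀) (ℕᵖ.≤-trans (ℕᵖ.*-monoʳ-≤ k₀ h) small))
  -- A constant colouring, since only the equitability of the refinement is wanted.
  open EquitableRefinement (refineEquitablyInto P₀ eq₀ (λ _ → zero {0}) M M≤q)
  few : ℕ→ℚ (sumF {k₀ ℕ.* suc M} (λ i → count {k₀ ℕ.* suc M} (λ j → ⌊ i Fin.≟ j ⌋))) ≤ ε * ℕ→ℚ
      ((k₀ ℕ.* suc M) ℕ.* (k₀ ℕ.* suc M))
  few = ≤-trans (≤-reflexive (trans (sumF-count-∑ {k} {k} (λ i j → ⌊ i Fin.≟ j ⌋))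
      (trans (∑-cong ∑-indicator) (∑-const k 1ℚ))))
    (≤-trans (≤-trans (≤-reflexive (*-comm (ℕ→ℚ k) 1ℚ)) (*-monoˡ (0≤ℕ k) fine))
        (≤-reflexive (trans (*-assoc ε (ℕ→ℚ k) (ℕ→ℚ k)) (cong (ε *_) (sym (ℕ→ℚ-* k k))))))
    where
    k : ℕ
    k = k₀ ℕ.* suc M
  regular : ∀ i j → ⌊ i Fin.≟ j ⌋ ≡ false → RegularPair ε H (Part Q i) (Part Q j)
  regular i j i≢j A B A⊆ B⊆ hA hB = subst₂ (λ y z → ∣ y - z ∣ ≤ ε)
    (sym (pairDensity-complete H {Part Q i} {Part Q j} (λ u v → apart u v) (part-nonempty Q i) (part-nonempty Q j)))
    (sym (pairDensity-complete H {A} {B} (λ u v p r → apart u v (⊆ˢ-apply {A = A} {Part Q i} A⊆ u p)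
        (⊆ˢ-apply {A = B} {Part Q j} B⊆ v r))
      (positive-size {A = Part Q i} {A} 0<ε (part-nonempty Q i) hA)
          (positive-size {A = Part Q j} {B} 0<ε (part-nonempty Q j) hB)))
    (∣x-x∣≤ 1ℚ (<⇒≤ 0<ε))
    where
    apart : ∀ u v → Part Q i u ≡ true → Part Q j v ≡ true → adj H u v ≡ true
    apart u v p r = ≢⇒not-≟ λ u≡v → clash (trans (sym (⌊≟⌋-sound {i = part Q u} p))
        (trans (cong (part Q) u≡v) (⌊≟⌋-sound {i = part Q v} r)))
      where
      clash : i ≢ j
      clash i≡j = true≢false (trans (sym (⌊≟⌋-complete i≡j)) i≢j)

-- Growth of the orders

opaque
  -- Opaque, since 2 ^ (c + n) with a literal c would be unfolded to a sum of 2 ^ c summands.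
  exp2 : ℕ → ℕ
  exp2 n = 2 ℕ.^ n

  exp2-def : ∀ n → 2 ℕ.^ n ≡ exp2 n
  exp2-def n = refl

  4^-exp2 : ∀ n → 4 ℕ.^ n ≡ exp2 (2 ℕ.* n)
  4^-exp2 n = ℕᵖ.^-*-assoc 2 2 n

  n<exp2 : ∀ n → n ℕ.< exp2 n
  n<exp2 zero = s≤s z≤n
  n<exp2 (suc n) = ℕᵖ.≤-trans (ℕᵖ.+-mono-≤ (ℕᵖ.m^n>0 2 n) (n<exp2 n))
      (ℕᵖ.≤-reflexive (cong (2 ℕ.^ n ℕ.+_) (sym (ℕᵖ.+-identityʳ (2 ℕ.^ n)))))

  exp2-mono : ∀ {a b} → a ℕ.≤ b → exp2 a ℕ.≤ exp2 b
  exp2-mono = ℕᵖ.^-monoʳ-≤ 2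

  exp2-+ : ∀ a b → exp2 a ℕ.* exp2 b ≡ exp2 (a ℕ.+ b)
  exp2-+ a b = sym (ℕᵖ.^-distribˡ-+-* 2 a b)

  exp2-suc : ∀ n → exp2 (suc n) ≡ 2 ℕ.* exp2 n
  exp2-suc n = refl

  exp2-2 : exp2 2 ≡ 4
  exp2-2 = refl

  exp2-5 : exp2 5 ≡ 32
  exp2-5 = refl

  exp2-6 : exp2 6 ≡ 64
  exp2-6 = refl

  exp2-7 : exp2 7 ≡ 128
  exp2-7 = refl

scale-exp2 : ∀ {c n} k → exp2 c ≡ k → k ℕ.* exp2 n ≡ exp2 (c ℕ.+ n)
scale-exp2 {c} {n} k refl = exp2-+ c n

precision-exp2 : ∀ y → precision (exp2 y) ≡ exp2 (5 ℕ.+ (y ℕ.+ y ℕ.+ y ℕ.+ y ℕ.+ y))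
precision-exp2 y = trans (cong (32 ℕ.*_) fifth) (scale-exp2 {5} 32 exp2-5)
  where
  Y : ℕ
  Y = exp2 y
  fifth : Y ℕ.* Y ℕ.* Y ℕ.* Y ℕ.* Y ≡ exp2 (y ℕ.+ y ℕ.+ y ℕ.+ y ℕ.+ y)
  fifth = trans (cong (ℕ._* Y) (trans (cong (ℕ._* Y)
      (trans (cong (ℕ._* Y) (exp2-+ y y)) (exp2-+ (y ℕ.+ y) y))) (exp2-+ (y ℕ.+ y ℕ.+ y) y)))
    (exp2-+ (y ℕ.+ y ℕ.+ y ℕ.+ y) y)

precision²-exp2 : ∀ y → precision (exp2 y) ℕ.* precision (exp2 y) ≡ exp2 (10 ℕ.+ 10 ℕ.* y)
precision²-exp2 y = trans (cong₂ ℕ._*_ (precision-exp2 y) (precision-exp2 y))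
  (trans (exp2-+ (5 ℕ.+ (y ℕ.+ y ℕ.+ y ℕ.+ y ℕ.+ y)) (5 ℕ.+ (y ℕ.+ y ℕ.+ y ℕ.+ y ℕ.+ y))) (cong exp2 (l y)))
  where
  l : ∀ y → 5 ℕ.+ (y ℕ.+ y ℕ.+ y ℕ.+ y ℕ.+ y) ℕ.+ (5 ℕ.+ (y ℕ.+ y ℕ.+ y ℕ.+ y ℕ.+ y)) ≡ 10 ℕ.+ 10 ℕ.* y
  l = ℕ-solve-∀

-- 7 is the first y for which this holds: 82 ≤ 128, whereas 72 > 64. From there on doubling outruns
-- the linear growth.
linear≤exp2 : ∀ y → 7 ℕ.≤ y → 12 ℕ.+ 10 ℕ.* y ℕ.≤ exp2 y
linear≤exp2 y 7≤y = subst (λ y → 12 ℕ.+ 10 ℕ.* y ℕ.≤ exp2 y) (ℕᵖ.m+[n∸m]≡n 7≤y) (shifted (y ℕ.∸ 7))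
  where
  l : ∀ j → 12 ℕ.+ 10 ℕ.* (7 ℕ.+ j) ℕ.+ (46 ℕ.+ 118 ℕ.* j) ≡ 128 ℕ.* suc j
  l = ℕ-solve-∀
  shifted : ∀ j → 12 ℕ.+ 10 ℕ.* (7 ℕ.+ j) ℕ.≤ exp2 (7 ℕ.+ j)
  shifted j = ℕᵖ.≤-trans (ℕᵖ.≤-trans (ℕᵖ.m≤m+n _ (46 ℕ.+ 118 ℕ.* j)) (ℕᵖ.≤-reflexive (l j)))
    (ℕᵖ.≤-trans (ℕᵖ.*-monoʳ-≤ 128 (n<exp2 j)) (ℕᵖ.≤-reflexive (scale-exp2 {7} 128 exp2-7)))

-- As a power of 2, the left side has exponent 3 y + 2^(11 + 10 y), where 10 y stems from the tenth
-- power of the order in the square of `precision`. Since 12 + 10 y ≤ 2^y, a step costs two levels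
-- of the tower.
growth-exp2 : ∀ y → 7 ℕ.≤ y → growth (exp2 y) ℕ.≤ exp2 (exp2 (exp2 y))
growth-exp2 y 7≤y = ℕᵖ.≤-trans (ℕᵖ.≤-reflexive exact)
    (exp2-mono (ℕᵖ.≤-trans exponent (exp2-mono (linear≤exp2 y 7≤y))))
  where
  w : ℕ
  w = 11 ℕ.+ 10 ℕ.* y
  colours≡ : colours (exp2 y) ≡ exp2 (exp2 w)
  colours≡ = trans (4^-exp2 (precision (exp2 y) ℕ.* precision (exp2 y)))
    (cong exp2 (trans (cong (2 ℕ.*_) (precision²-exp2 y)) (sym (exp2-suc (10 ℕ.+ 10 ℕ.* y)))))
  exact : growth (exp2 y) ≡ exp2 (y ℕ.+ (y ℕ.+ y ℕ.+ exp2 w))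
  exact = trans (cong (exp2 y ℕ.*_) (trans (cong₂ ℕ._*_ (exp2-+ y y) colours≡)
      (exp2-+ (y ℕ.+ y) (exp2 w)))) (exp2-+ y (y ℕ.+ y ℕ.+ exp2 w))
  l₁ : ∀ y z → y ℕ.+ (y ℕ.+ y ℕ.+ z) ≡ 3 ℕ.* y ℕ.+ z
  l₁ = ℕ-solve-∀
  l₂ : ∀ y → 3 ℕ.* y ℕ.+ (12 ℕ.+ 7 ℕ.* y) ≡ suc (11 ℕ.+ 10 ℕ.* y)
  l₂ = ℕ-solve-∀
  l₃ : ∀ z → z ℕ.+ z ≡ 2 ℕ.* z
  l₃ = ℕ-solve-∀
  exponent : y ℕ.+ (y ℕ.+ y ℕ.+ exp2 w) ℕ.≤ exp2 (12 ℕ.+ 10 ℕ.* y)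
  exponent = ℕᵖ.≤-trans (ℕᵖ.≤-reflexive (l₁ y (exp2 w))) (ℕᵖ.≤-trans
    (ℕᵖ.+-monoˡ-≤ (exp2 w) (ℕᵖ.≤-trans (ℕᵖ.m≤m+n (3 ℕ.* y) (12 ℕ.+ 7 ℕ.* y))
        (ℕᵖ.≤-trans (ℕᵖ.≤-reflexive (l₂ y)) (n<exp2 w))))
    (ℕᵖ.≤-reflexive (trans (l₃ (exp2 w)) (sym (exp2-suc w)))))

precision⁴-exp2 : ∀ y → 7 ℕ.≤ y → let z = precision (exp2 y) in 3 ℕ.* (z ℕ.* z ℕ.* (z ℕ.* z)) ℕ.≤ exp2 (exp2 (exp2 y))
precision⁴-exp2 y 7≤y = ℕᵖ.≤-trans (ℕᵖ.*-monoˡ-≤ (z ℕ.* z ℕ.* (z ℕ.* z)) (ℕᵖ.n≤1+n 3))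
  (ℕᵖ.≤-trans (ℕᵖ.≤-reflexive exact) (exp2-mono (ℕᵖ.≤-trans exponent (exp2-mono (n<exp2 y)))))
  where
  z w : ℕ
  z = precision (exp2 y)
  w = 10 ℕ.+ 10 ℕ.* y
  exact : 4 ℕ.* (z ℕ.* z ℕ.* (z ℕ.* z)) ≡ exp2 (2 ℕ.+ (w ℕ.+ w))
  exact = trans (cong (4 ℕ.*_) (trans (cong₂ ℕ._*_ (precision²-exp2 y) (precision²-exp2 y))
      (exp2-+ w w))) (scale-exp2 {2} 4 exp2-2)
  l : ∀ y → 2 ℕ.+ (10 ℕ.+ 10 ℕ.* y ℕ.+ (10 ℕ.+ 10 ℕ.* y)) ℕ.+ 2 ≡ 2 ℕ.* (12 ℕ.+ 10 ℕ.* y)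
  l = ℕ-solve-∀
  exponent : 2 ℕ.+ (w ℕ.+ w) ℕ.≤ exp2 (suc y)
  exponent = ℕᵖ.≤-trans (ℕᵖ.≤-trans (ℕᵖ.m≤m+n _ 2) (ℕᵖ.≤-reflexive (l y)))
    (ℕᵖ.≤-trans (ℕᵖ.*-monoʳ-≤ 2 (linear≤exp2 y 7≤y)) (ℕᵖ.≤-reflexive (sym (exp2-suc y))))

module _ (K : ℕ) where
  tower-suc : ∀ j → tower K (suc j) ≡ exp2 (tower K j)
  tower-suc j = exp2-def (tower K j)

  tower-< : ∀ j → tower K j ℕ.< tower K (suc j)
  tower-< j = subst (tower K j ℕ.<_) (sym (tower-suc j)) (n<exp2 (tower K j))

  tower-mono : ∀ {i j} → i ℕ.≤ j → tower K i ℕ.≤ tower K j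
  tower-mono {i} {j} i≤j = subst (λ j → tower K i ℕ.≤ tower K j) (ℕᵖ.m∸n+n≡m i≤j) (climb (j ℕ.∸ i))
    where
    climb : ∀ k → tower K i ℕ.≤ tower K (k ℕ.+ i)
    climb zero = ℕᵖ.≤-refl
    climb (suc k) = ℕᵖ.≤-trans (climb k) (ℕᵖ.<⇒≤ (tower-< (k ℕ.+ i)))

  height≤tower : ∀ j → j ℕ.≤ tower K j
  height≤tower zero = z≤n
  height≤tower (suc j) = ℕᵖ.≤-trans (s≤s (height≤tower j)) (tower-< j)

-- The refinement starts with bounds of height h₂ + 2 and gains two levels per step.
module Heights (K a r h h₂ : ℕ) (h≡ : h ≡ 32 ℕ.+ 4 ℕ.* a ℕ.+ r) (h₂≡ : h₂ ≡ 12 ℕ.+ 2 ℕ.* a ℕ.+ r) where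
  steps : ℕ
  steps = 8 ℕ.+ a

  level-bound : ℕ → ℕ
  level-bound i = tower K (suc (i ℕ.* 2 ℕ.+ suc h₂))

  private
    exponent : ℕ → ℕ
    exponent i = tower K (i ℕ.* 2 ℕ.+ suc h₂)

    level≡ : ∀ i → level-bound i ≡ exp2 (exponent i)
    level≡ i = tower-suc K (i ℕ.* 2 ℕ.+ suc h₂)

    next≡ : ∀ i → level-bound (suc i) ≡ exp2 (exp2 (exp2 (exponent i)))
    next≡ i = trans (tower-suc K (suc (suc j))) (cong exp2 (trans (tower-suc K (suc j)) (cong exp2 (level≡ i))))
      where
      j : ℕ
      j = i ℕ.* 2 ℕ.+ suc h₂

    7≤exponent : ∀ i → 7 ℕ.≤ exponent i
    7≤exponent i = ℕᵖ.≤-trans (ℕᵖ.≤-trans seven≤ (ℕᵖ.m≤n+m (suc h₂) (i ℕ.* 2)))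
        (height≤tower K (i ℕ.* 2 ℕ.+ suc h₂))
      where
      seven≤ : 7 ℕ.≤ suc h₂
      seven≤ = ℕᵖ.≤-trans (ℕᵖ.m≤m+n 7 (6 ℕ.+ (2 ℕ.* a ℕ.+ r)))
          (ℕᵖ.≤-reflexive (cong suc (trans (sym (ℕᵖ.+-assoc 12 (2 ℕ.* a) r)) (sym h₂≡))))

  level-growth : ∀ i → growth (level-bound i) ℕ.≤ level-bound (suc i)
  level-growth i = subst₂ (λ x z → growth x ℕ.≤ z) (sym (level≡ i)) (sym (next≡ i))
      (growth-exp2 (exponent i) (7≤exponent i))

  level-precision : ∀ i → let z = precision (level-bound i) in 3 ℕ.* (z ℕ.* z ℕ.* (z ℕ.* z)) ℕ.≤ level-bound (suc i)
  level-precision i = subst₂ (λ x t → 3 ℕ.* (precision x ℕ.* precision x ℕ.* (precision x ℕ.* precision x)) ℕ.≤ t)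
    (sym (level≡ i)) (sym (next≡ i)) (precision⁴-exp2 (exponent i) (7≤exponent i))

  level-mono : ∀ {i j} → i ℕ.≤ j → level-bound i ℕ.≤ level-bound j
  level-mono i≤j = tower-mono K (s≤s (ℕᵖ.+-monoˡ-≤ (suc h₂) (ℕᵖ.*-monoˡ-≤ 2 i≤j)))

  -- The constants of `Heights` are balanced here: 9 + a increments of two levels above the start h₂
  -- + 2 end exactly at h.
  level-top : level-bound (suc steps) ≡ tower K h
  level-top = cong (tower K) (trans (cong (λ z → suc ((9 ℕ.+ a) ℕ.* 2 ℕ.+ suc z)) h₂≡) (trans (l a r) (sym h≡)))
    where
    l : ∀ a r → suc ((9 ℕ.+ a) ℕ.* 2 ℕ.+ suc (12 ℕ.+ 2 ℕ.* a ℕ.+ r)) ≡ 32 ℕ.+ 4 ℕ.* a ℕ.+ r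
    l = ℕ-solve-∀

  K<level : ∀ i → K ℕ.< level-bound i
  K<level i = ℕᵖ.≤-<-trans (tower-mono K {0} {i ℕ.* 2 ℕ.+ suc h₂} z≤n) (tower-< K (i ℕ.* 2 ℕ.+ suc h₂))

  -- h 2^h ≤ 2^(2 h), and 2 h ≤ 2^h₂ leaves only two more levels to climb. An order of this size
  -- exceeds 16 / (δ p), as 2^h ≥ 1 / p and h δ ≥ 16.
  h2^h≤level : ∀ i → h ℕ.* 2 ℕ.^ h ℕ.≤ level-bound i
  h2^h≤level i = ℕᵖ.≤-trans (ℕᵖ.≤-reflexive (cong (h ℕ.*_) (exp2-def h)))
    (ℕᵖ.≤-trans (ℕᵖ.≤-trans (ℕᵖ.*-monoˡ-≤ (exp2 h) (ℕᵖ.<⇒≤ (n<exp2 h))) (ℕᵖ.≤-reflexive (exp2-+ h h)))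
    (ℕᵖ.≤-trans (exp2-mono (ℕᵖ.≤-trans double (exp2-mono (height≤tower K h₂))))
      (ℕᵖ.≤-trans (ℕᵖ.≤-reflexive (sym (trans (tower-suc K (suc h₂)) (cong exp2 (tower-suc K h₂)))))
          (level-mono {0} {i} z≤n))))
    where
    l₁ : ∀ a r → 32 ℕ.+ 4 ℕ.* a ℕ.+ r ℕ.+ (32 ℕ.+ 4 ℕ.* a ℕ.+ r) ℕ.+ (56 ℕ.* a ℕ.+ 62 ℕ.* r) ≡ 64 ℕ.* suc (a ℕ.+ r)
    l₁ = ℕ-solve-∀
    l₂ : ∀ a r → 6 ℕ.+ (a ℕ.+ r) ℕ.+ (6 ℕ.+ a) ≡ 12 ℕ.+ 2 ℕ.* a ℕ.+ r
    l₂ = ℕ-solve-∀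
    double : h ℕ.+ h ℕ.≤ exp2 h₂
    double = ℕᵖ.≤-trans (ℕᵖ.≤-trans (ℕᵖ.m≤m+n (h ℕ.+ h) (56 ℕ.* a ℕ.+ 62 ℕ.* r)) (ℕᵖ.≤-reflexive
        (trans (cong (λ h → h ℕ.+ h ℕ.+ (56 ℕ.* a ℕ.+ 62 ℕ.* r)) h≡) (l₁ a r))))
      (ℕᵖ.≤-trans (ℕᵖ.*-monoʳ-≤ 64 (n<exp2 (a ℕ.+ r))) (ℕᵖ.≤-trans (ℕᵖ.≤-reflexive (scale-exp2 {6} 64 exp2-6))
        (exp2-mono (ℕᵖ.≤-trans (ℕᵖ.m≤m+n (6 ℕ.+ (a ℕ.+ r)) (6 ℕ.+ a))
            (ℕᵖ.≤-reflexive (trans (l₂ a r) (sym h₂≡)))))))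

-- Assembling the bound

-- A search for the largest L with 2^L d ≤ 1; failure at L + 1 is the second claim, and `limit`
-- bounds the search.
densityScale : ∀ {d} fuel L → 2^ L * d ≤ 1ℚ → (∀ L′ → 2^ L′ * d ≤ 1ℚ → L′ ℕ.≤ fuel ℕ.+ L) →
  Σ ℕ λ L → 2^ L * d ≤ 1ℚ × half^ L ≤ 2ℚ * d
densityScale {d} fuel L low limit with 2^ (suc L) * d ≤? 1ℚ
... | no high = L , low , subst₂ _≤_ (*-identityʳ (half^ L)) eq (*-monoʳ (0≤half^ L) (<⇒≤ (≰⇒> high)))
  where
  l : ∀ h p d → h * (2ℚ * p * d) ≡ 2ℚ * d * (p * h)
  l = solve-∀ ℚ-ring
  eq : half^ L * (2^ (suc L) * d) ≡ 2ℚ * d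
  eq = trans (cong (λ z → half^ L * (z * d)) (2^-suc L)) (trans (l (half^ L) (2^ L) d)
    (trans (cong (2ℚ * d *_) (2^*half^ L)) (*-identityʳ (2ℚ * d))))
densityScale {d} zero L low limit | yes low′ = ⊥-elim (ℕᵖ.<-irrefl refl (limit (suc L) low′))
densityScale {d} (suc fuel) L low limit | yes low′ = densityScale fuel (suc L) low′
  λ L′ p → subst (L′ ℕ.≤_) (sym (ℕᵖ.+-suc fuel L)) (limit L′ p)

module _ {n : ℕ} (G : Graph n) (0<n : 0 ℕ.< n) where
  private
    N : ℚ
    N = ℕ→ℚ n * ℕ→ℚ n

  density-mass : ∑₂ (adjacency G) ≡ density G * N
  density-mass = trans (sym (sumF-count-∑ (adj G)))
      (trans (sym (frac-* (twiceEdges G) (ℕᵖ.*-mono-< 0<n 0<n))) (cong (density G *_) (ℕ→ℚ-* n n)))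

  density≤1 : density G ≤ 1ℚ
  density≤1 = *-cancelˡ {c = N} (0<* (0<ℕ 0<n) (0<ℕ 0<n))
      (subst₂ _≤_ (trans density-mass (*-comm (density G) N)) (∑₂-const {n} {n} 1ℚ)
    (∑₂-mono λ u v → 𝟙≤1 (adj G u v)))

-- For L = 0 the potential is Σ D², which varies by at most d (1 - d) n²; otherwise each of the
-- L + 1 ≤ 2 L scales contributes at most 2 d n².
module _ {n : ℕ} (G : Graph n) (0<n : 0 ℕ.< n) {ε δ d : ℚ} (0<ε : 0ℚ < ε) (ε≤1 : ε ≤ 1ℚ) (0<δ : 0ℚ < δ)
  (0≤d : 0ℚ ≤ d) (d≤1 : d ≤ 1ℚ) (mass : ∑₂ (adjacency G) ≡ d * (ℕ→ℚ n * ℕ→ℚ n)) {s : ℚ}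
      (0≤s : 0ℚ ≤ s) (sparse : 1ℚ - d ≤ 2ℚ * s) where
  private
    N : ℚ
    N = ℕ→ℚ n * ℕ→ℚ n
    0≤dN : 0ℚ ≤ d * N
    0≤dN = 0≤* 0≤d (0≤² (ℕ→ℚ n))
    X : Fin n → Fin n → ℚ
    X = adjacency G
    0≤X : ∀ u v → 0ℚ ≤ X u v
    0≤X u v = 0≤𝟙 (adj G u v)
    X≤1 : ∀ u v → X u v ≤ 1ℚ
    X≤1 u v = 𝟙≤1 (adj G u v)

  potentialWindow : ∀ L (scales : half^ L ≤ 2ℚ * d) → ℕ→ℚ L ≤ s → Σ ℚ λ base → Σ ℚ λ top → top ≤
      base + ℕ→ℚ 4 * s * (d * N) ×
    (∀ {k} (P : Partition n k) → base ≤ Ψ G 0<n 0<ε ε≤1 0<δ 0≤d d≤1 mass L scales P × Ψ G 0<n 0<ε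
        ε≤1 0<δ 0≤d d≤1 mass L scales P ≤ top)
  potentialWindow zero scales _ = d * d * N , d * N
    , ≤-by (0≤+ (0≤* (≤⇒0≤- sparse) 0≤dN) (0≤* (0≤* (0≤ℕ 2) 0≤s) 0≤dN)) (l d N s)
    , λ P → ≤potential-0 X 0≤X X≤1 0≤d d≤1 mass (part P)
      , subst (potential X 0≤X X≤1 0 (part P) ≤_) mass (potential-0≤ X 0≤X X≤1 (part P))
    where
    l : ∀ d N s → (2ℚ * s - (1ℚ - d)) * (d * N) + 2ℚ * s * (d * N) ≡ (d * d * N + ℕ→ℚ 4 * s * (d * N)) - d * N
    l = solve-∀ ℚ-ring
  potentialWindow (suc L) scales L≤s = 0ℚ , ℕ→ℚ (suc (suc L)) * (2ℚ * (d * N))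
    , ≤-by (0≤* (0≤+ (0≤* (0≤ℕ 4) (≤⇒0≤- L≤s)) (0≤* (0≤ℕ 2) (0≤ℕ L))) 0≤dN)
        (trans (cong (λ z → (ℕ→ℚ 4 * (s - z) + ℕ→ℚ 2 * ℕ→ℚ L) * (d * N)) (ℕ→ℚ-suc L))
        (trans (l (ℕ→ℚ L) s (d * N)) (cong (λ z → (0ℚ + ℕ→ℚ 4 * s * (d * N)) - z * (2ℚ * (d * N)))
            (sym (trans (ℕ→ℚ-suc (suc L)) (cong (1ℚ +_) (ℕ→ℚ-suc L)))))))
    , λ P → 0≤potential X 0≤X X≤1 (suc L) (part P)
      , subst (λ z → potential X 0≤X X≤1 (suc L) (part P) ≤ ℕ→ℚ (suc (suc L)) * (2ℚ * z)) mass
          (potential≤ X 0≤X X≤1 (suc L) (part P))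
    where
    l : ∀ L s D → (ℕ→ℚ 4 * (s - (1ℚ + L)) + ℕ→ℚ 2 * L) * D ≡ (0ℚ + ℕ→ℚ 4 * s * D) - (1ℚ + (1ℚ + L)) * (2ℚ * D)
    l = solve-∀ ℚ-ring

multipleAbove : ∀ K k → 0 ℕ.< k → Σ ℕ λ M → K ℕ.< k ℕ.* suc M × k ℕ.* suc M ℕ.≤ k ℕ.+ K
multipleAbove K (suc k) _ = M
  , subst (K ℕ.<_) (ℕᵖ.*-comm (suc M) (suc k)) (ℕᵖ.≤-<-trans
      (ℕᵖ.≤-reflexive (m≡m%n+[m/n]*n K (suc k))) (ℕᵖ.+-monoˡ-< (M ℕ.* suc k) (m%n<n K (suc k))))
  , subst (ℕ._≤ suc k ℕ.+ K) (ℕᵖ.*-comm (suc M) (suc k)) (ℕᵖ.+-monoʳ-≤ (suc k) (m/n*n≤m K (suc k)))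
  where
  M : ℕ
  M = K ℕ./ suc k

double≤2^ : ∀ K → 0 ℕ.< K → K ℕ.+ K ℕ.≤ 2 ℕ.^ K
double≤2^ (suc j) _ = subst (suc j ℕ.+ suc j ℕ.≤_) (sym (trans (exp2-def (suc j)) (exp2-suc j)))
  (ℕᵖ.≤-trans (ℕᵖ.≤-reflexive (cong (suc j ℕ.+_) (sym (ℕᵖ.+-identityʳ (suc j))))) (ℕᵖ.*-monoʳ-≤ 2 (n<exp2 j)))

-- The bound for fixed ε, δ, p and height

module Bound (c : ℚ) (hc : 0ℚ < c) (c≡ : c ≡ ℕ→ℚ 4096) (ε δ p : ℚ) (hε : 0ℚ < ε) (ε<1 : ε < 1ℚ)
    (0<δ : 0ℚ < δ) (δ<1 : δ < 1ℚ)
  (hp : 0ℚ < p) (p<1 : p < 1ℚ) (m : ℕ) (log : Log2≤ (inv p hp) (ℕ→ℚ (suc m) * (δ * δ) * inv c hc)) where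

  private
    h K S : ℕ
    h = suc m
    K = proj₁ (natFloor (inv ε hε) (<⇒≤ (0<inv ε hε)))
    S = tower K h

    r s x : ℚ
    r = inv p hp
    s = ℕ→ℚ h * (δ * δ) * inv c hc
    x = 1ℚ - p

    0<s : 0ℚ < s
    0<s = 0<* (0<* (0<ℕ {h} (s≤s z≤n)) (0<* 0<δ 0<δ)) (0<inv c hc)

    0≤s : 0ℚ ≤ s
    0≤s = <⇒≤ 0<s

    s-def : s * ℕ→ℚ 4096 ≡ ℕ→ℚ h * (δ * δ)
    s-def = trans (cong (s *_) (sym c≡)) (trans (*-assoc (ℕ→ℚ h * (δ * δ)) (inv c hc) c)
      (trans (cong (ℕ→ℚ h * (δ * δ) *_) (inv-*ˡ c hc)) (*-identityʳ (ℕ→ℚ h * (δ * δ)))))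

    s≤h : s ≤ ℕ→ℚ h
    s≤h = *-cancelˡ {c = ℕ→ℚ 4096} (0<ℕ {4096} (s≤s z≤n)) (≤-trans (≤-reflexive (trans (*-comm (ℕ→ℚ 4096) s) s-def))
      (≤-by (0≤+ (0≤* (0≤ℕ h) (≤⇒0≤- (x²≤1 (<⇒≤ 0<δ) (<⇒≤ δ<1)))) (0≤* (0≤ℕ 4095) (0≤ℕ h))) (l (ℕ→ℚ h) (δ * δ))))
      where
      l : ∀ h z → h * (1ℚ - z) + ℕ→ℚ 4095 * h ≡ ℕ→ℚ 4096 * h - h * z
      l = solve-∀ ℚ-ring

    0<x : 0ℚ < x
    0<x = <⇒0<- p<1

    x≤1 : x ≤ 1ℚ
    x≤1 = complement≤1 (<⇒≤ hp)

    1+x≤r : 1ℚ + x ≤ r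
    1+x≤r = *-cancelˡ {c = p} hp (≤-trans (≤-by (0≤² x) (l p)) (≤-reflexive (sym (inv-*ʳ p hp))))
      where
      l : ∀ p → (1ℚ - p) * (1ℚ - p) ≡ 1ℚ - p * (1ℚ + (1ℚ - p))
      l = solve-∀ ℚ-ring

    x≤2s : x ≤ 2ℚ * s
    x≤2s = log-linear 0<s log 0<x x≤1 1+x≤r

    K≤inv : ℕ→ℚ K ≤ inv ε hε
    K≤inv = proj₁ (proj₂ (natFloor (inv ε hε) (<⇒≤ (0<inv ε hε))))

    inv<K+1 : inv ε hε < ℕ→ℚ (suc K)
    inv<K+1 = proj₂ (proj₂ (natFloor (inv ε hε) (<⇒≤ (0<inv ε hε))))

    ≤K : ∀ k → ε * ℕ→ℚ k ≤ 1ℚ → k ℕ.≤ K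
    ≤K k h = ℕᵖ.≤-pred (ℕ→ℚ-cancel-< (≤-<-trans (*-cancelˡ {c = ε} hε
        (≤-trans h (≤-reflexive (sym (inv-*ʳ ε hε))))) inv<K+1))

    0<K : 0 ℕ.< K
    0<K = ≤K 1 (≤-trans (≤-reflexive (*-identityʳ ε)) (<⇒≤ ε<1))

    ε-reaches : ∀ {k} → K ℕ.< k → 1ℚ ≤ ε * ℕ→ℚ k
    ε-reaches {k} K<k = ≤-trans (≤-reflexive (sym (inv-*ʳ ε hε)))
        (*-monoʳ (<⇒≤ hε) (≤-trans (<⇒≤ inv<K+1) (ℕ→ℚ-mono K<k)))

  module _ {n : ℕ} (G : Graph n) (0<n : 0 ℕ.< n) (p≤d : p ≤ density G) {k₀ : ℕ}
      (P₀ : Partition n k₀) (equi : IsEquipartition P₀)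
    (few : ε * ℕ→ℚ k₀ ≤ 1ℚ) where
    private
      d N : ℚ
      d = density G
      N = ℕ→ℚ n * ℕ→ℚ n

      0<d : 0ℚ < d
      0<d = <-≤-trans hp p≤d

      0≤d : 0ℚ ≤ d
      0≤d = <⇒≤ 0<d

      d≤1 : d ≤ 1ℚ
      d≤1 = density≤1 G 0<n

      mass : ∑₂ (adjacency G) ≡ d * N
      mass = density-mass G 0<n

      0<dN : 0ℚ < d * N
      0<dN = 0<* 0<d (0<* (0<ℕ 0<n) (0<ℕ 0<n))

      sparse : 1ℚ - d ≤ 2ℚ * s
      sparse = ≤-trans (+-monoʳ-≤ 1ℚ (neg-antimono-≤ p≤d)) x≤2s

      k₀≤K : k₀ ℕ.≤ K
      k₀≤K = ≤K k₀ few

      0<k₀ : 0 ℕ.< k₀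
      0<k₀ = nonempty-colours (part P₀) (Fin.fromℕ< 0<n)

      K≤S : K ℕ.≤ S
      K≤S = tower-mono K {0} {h} z≤n

      nearlyComplete : ℕ→ℚ 4 * s ≤ δ → S ℕ.< n → Outcome ε δ G P₀ S
      nearlyComplete 4s≤δ S<n = completeOutcome {δ = δ} {d} G P₀ 0<n equi hε mass
        -- (1 + δ) (1 - d) ≤ 2 · 2 s ≤ δ, which rearranges to 1 - d ≤ δ d.
        (≤-by (0≤+ (0≤+ (0≤* (<⇒≤ 0<δ) (≤⇒0≤- sparse)) (≤⇒0≤- sparse))
            (0≤+ (≤⇒0≤- 4s≤δ) (0≤* (0≤* (0≤ℕ 2) 0≤s) (≤⇒0≤- (<⇒≤ δ<1))))) (l δ d s))
        -- The order is a multiple of k₀ between K + 1 and 2 K ≤ 2^K: large enough for ε k ≥ 1, and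
        -- covered by a single level of the tower.
        (proj₁ M) (ε-reaches (proj₁ (proj₂ M)))
        (ℕᵖ.≤-trans (proj₂ (proj₂ M)) (ℕᵖ.≤-trans (ℕᵖ.+-monoˡ-≤ K k₀≤K)
            (ℕᵖ.≤-trans (double≤2^ K 0<K) (tower-mono K {1} {h} (s≤s z≤n))))) S<n
        where
        M = multipleAbove K k₀ 0<k₀
        l : ∀ δ d s → δ * (2ℚ * s - (1ℚ - d)) + (2ℚ * s - (1ℚ - d)) +
            ((δ - ℕ→ℚ 4 * s) + ℕ→ℚ 2 * s * (1ℚ - δ)) ≡ δ * d - (1ℚ - d)
        l = solve-∀ ℚ-ring

      scale≤s : ∀ L → 2^ L * d ≤ 1ℚ → ℕ→ℚ L ≤ s
      scale≤s L h = log-lower 0<s log L (*-cancelˡ {c = p} hp (≤-trans (≤-reflexive (*-comm p (2^ L)))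
        (≤-trans (*-monoʳ (0≤2^ L) p≤d) (≤-trans h (≤-reflexive (sym (inv-*ʳ p hp)))))))

      scaleData : Σ ℕ λ L → 2^ L * d ≤ 1ℚ × half^ L ≤ 2ℚ * d
      scaleData = densityScale {d} h 0 (≤-trans (≤-reflexive (*-identityˡ d)) d≤1)
        λ L q → ℕᵖ.≤-trans (ℕ→ℚ-cancel-≤ (≤-trans (scale≤s L q) s≤h)) (ℕᵖ.≤-reflexive (sym (ℕᵖ.+-identityʳ h)))

      L : ℕ
      L = proj₁ scaleData

      scales : half^ L ≤ 2ℚ * d
      scales = proj₂ (proj₂ scaleData)

      module Refining (δ≤4s : δ ≤ ℕ→ℚ 4 * s) (S<n : S ℕ.< n) where
        -- As 4096 s = h δ², the alternative δ ≤ 4 s forces a tall tower: it has the height 32 that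
        -- `Heights` presupposes and beats 16 / δ.
        hδ-large : ℕ→ℚ 1024 ≤ ℕ→ℚ h * δ
        hδ-large = *-cancelˡ {c = δ} 0<δ (≤-trans (≤-by (0≤* (0≤ℕ 1024) (≤⇒0≤- δ≤4s)) (l δ s))
          (≤-reflexive (trans s-def (l₂ (ℕ→ℚ h) δ))))
          where
          l : ∀ δ s → ℕ→ℚ 1024 * (ℕ→ℚ 4 * s - δ) ≡ s * ℕ→ℚ 4096 - δ * ℕ→ℚ 1024
          l = solve-∀ ℚ-ring
          l₂ : ∀ h δ → h * (δ * δ) ≡ δ * (h * δ)
          l₂ = solve-∀ ℚ-ring

        32≤h : 32 ℕ.≤ h
        32≤h = ℕᵖ.≤-trans (ℕᵖ.m≤m+n 32 992) (ℕ→ℚ-cancel-≤ (≤-trans hδ-large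
          (subst (ℕ→ℚ h * δ ≤_) (*-identityʳ (ℕ→ℚ h)) (*-monoʳ (0≤ℕ h) (<⇒≤ δ<1)))))

        quotient remainder a h₂ : ℕ
        quotient = h ℕ./ 4
        remainder = h ℕ.% 4
        a = quotient ℕ.∸ 8
        h₂ = 12 ℕ.+ 2 ℕ.* a ℕ.+ remainder

        h≡ : h ≡ 32 ℕ.+ 4 ℕ.* a ℕ.+ remainder
        h≡ = trans (m≡m%n+[m/n]*n h 4) (trans (cong (λ z → remainder ℕ.+ z ℕ.* 4)
            (sym (ℕᵖ.m+[n∸m]≡n (/-monoˡ-≤ 4 32≤h)))) (l a remainder))
          where
          l : ∀ a r → r ℕ.+ (8 ℕ.+ a) ℕ.* 4 ≡ 32 ℕ.+ 4 ℕ.* a ℕ.+ r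
          l = ℕ-solve-∀

        open Heights K a remainder h h₂ h≡ refl

        level≤S : ∀ {i} → i ℕ.≤ suc steps → level-bound i ℕ.≤ S
        level≤S i≤ = ℕᵖ.≤-trans (level-mono i≤) (ℕᵖ.≤-reflexive level-top)

        h≤ : h ℕ.≤ 4 ℕ.* suc steps
        h≤ = ℕᵖ.≤-trans (ℕᵖ.≤-reflexive h≡) (ℕᵖ.≤-trans
            (ℕᵖ.+-monoʳ-≤ (32 ℕ.+ 4 ℕ.* a) (ℕᵖ.<⇒≤ (m%n<n h 4))) (ℕᵖ.≤-reflexive (l a)))
          where
          l : ∀ a → 32 ℕ.+ 4 ℕ.* a ℕ.+ 4 ≡ 4 ℕ.* suc (8 ℕ.+ a)
          l = ℕ-solve-∀

        unit : ℚ
        unit = stepGain G 0<n hε (<⇒≤ ε<1) 0<δ 0≤d d≤1 mass L scales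

        enough : ℕ→ℚ 4 * s * (d * N) < ℕ→ℚ (suc steps) * unit
        -- At least h / 4 steps of gain δ² d N / 96 amount to (4096 / 384) s d N = (32 / 3) s d N,
        -- against a window of length 4 s d N; the surplus is (20 / 3) s d N.
        enough = <-by (+-mono-≤-< (0≤* (0≤* (0≤* (nonNegative⁻¹ (ℤ.+ 1 / 384)) (≤⇒0≤- h≤′)) (0≤² δ)) (<⇒≤ 0<dN))
            (0<* (0<* (positive⁻¹ (ℤ.+ 20 / 3)) 0<s) 0<dN))
          (trans (l₁ (ℕ→ℚ h) (ℕ→ℚ (suc steps)) δ s (d * N))
            (trans (cong (λ z → (ℕ→ℚ (suc steps) * (ℤ.+ 1 / 96 * (δ * δ) * (d * N)) - ℕ→ℚ 4 * s *
                (d * N)) + ℤ.+ 1 / 384 * (s * ℕ→ℚ 4096 - z) * (d * N)) (sym s-def))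
              (l₂ (ℕ→ℚ (suc steps) * unit - ℕ→ℚ 4 * s * (d * N)) (s * ℕ→ℚ 4096) (d * N))))
          where
          h≤′ : ℕ→ℚ h ≤ ℕ→ℚ 4 * ℕ→ℚ (suc steps)
          h≤′ = ≤-trans (ℕ→ℚ-mono h≤) (≤-reflexive (ℕ→ℚ-* 4 (suc steps)))
          l₁ : ∀ h τ δ s D → ℤ.+ 1 / 384 * (ℕ→ℚ 4 * τ - h) * (δ * δ) * D + ℤ.+ 20 / 3 * s * D
            ≡ (τ * (ℤ.+ 1 / 96 * (δ * δ) * D) - ℕ→ℚ 4 * s * D) + ℤ.+ 1 / 384 * (s * ℕ→ℚ 4096 - h * (δ * δ)) * D
          l₁ = solve-∀ ℚ-ring
          l₂ : ∀ y z D → y + ℤ.+ 1 / 384 * (z - z) * D ≡ y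
          l₂ = solve-∀ ℚ-ring

        window = potentialWindow G 0<n hε (<⇒≤ ε<1) 0<δ 0≤d d≤1 mass 0≤s sparse L scales
            (scale≤s L (proj₁ (proj₂ scaleData)))
        base top : ℚ
        base = proj₁ window
        top = proj₁ (proj₂ window)
        top≤ : top ≤ base + ℕ→ℚ 4 * s * (d * N)
        top≤ = proj₁ (proj₂ (proj₂ window))
        inside = proj₂ (proj₂ (proj₂ window))

        1≤p2^h : 1ℚ ≤ p * 2^ h
        1≤p2^h = ≤-trans (≤-reflexive (sym (inv-*ʳ p hp))) (*-monoʳ (<⇒≤ hp) (log-upper 0<s log h s≤h))

        δd-reaches : ∀ i → ℕ→ℚ 16 ≤ δ * d * ℕ→ℚ (level-bound i)
        δd-reaches i = ≤-trans (ℕ→ℚ-mono {16} {1024} (ℕᵖ.m≤m+n 16 1008)) (≤-trans hδ-large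
          (≤-trans (≤-by (0≤* (0≤* (0≤ℕ h) (<⇒≤ 0<δ)) (≤⇒0≤- 1≤p2^h)) (l (ℕ→ℚ h) δ p (2^ h)))
          (≤-trans (*-mono (0≤* (<⇒≤ 0<δ) (<⇒≤ hp)) (0≤ℕ (level-bound i)) (*-monoʳ (<⇒≤ 0<δ) p≤d)
            (≤-trans (≤-reflexive (sym (ℕ→ℚ-* h (2 ℕ.^ h)))) (ℕ→ℚ-mono (h2^h≤level i)))) ≤-refl)))
          where
          l : ∀ h δ p z → h * δ * (p * z - 1ℚ) ≡ δ * p * (h * z) - h * δ
          l = solve-∀ ℚ-ring

        ℕ→ℚ-precision : ∀ z → ℕ→ℚ (3 ℕ.* (z ℕ.* z ℕ.* (z ℕ.* z))) ≡ ℕ→ℚ 3 * (ℕ→ℚ z * ℕ→ℚ z * (ℕ→ℚ z * ℕ→ℚ z))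
        ℕ→ℚ-precision z = trans (ℕ→ℚ-* 3 (z ℕ.* z ℕ.* (z ℕ.* z)))
            (cong (ℕ→ℚ 3 *_) (trans (ℕ→ℚ-* (z ℕ.* z) (z ℕ.* z)) (cong₂ _*_ (ℕ→ℚ-* z z) (ℕ→ℚ-* z z))))

        q₀ : ℕ
        q₀ = proj₁ (equipartition⇒equalParts P₀ 0<k₀ equi)

        equal₀ : EqualParts q₀ P₀
        equal₀ = proj₂ (equipartition⇒equalParts P₀ 0<k₀ equi)

        0<q₀ : 0 ℕ.< q₀
        0<q₀ = ℕᵖ.≮⇒≥ λ q₀<1 → ℕᵖ.<⇒≱ S<n (ℕᵖ.≤-trans (n≤k*suc-q P₀ equal₀) (ℕᵖ.≤-trans (ℕᵖ.*-monoʳ-≤ k₀ q₀<1)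
          (ℕᵖ.≤-trans (ℕᵖ.≤-reflexive (ℕᵖ.*-identityʳ k₀)) (ℕᵖ.≤-trans k₀≤K K≤S))))

        outcome : Outcome ε δ G P₀ S
        outcome = iterate G 0<n hε (<⇒≤ ε<1) 0<δ 0≤d d≤1 mass L scales P₀ {base} {top} level-bound steps S
          (≤-<-trans top≤ (+-monoʳ-< base enough)) (λ P → proj₂ (inside P))
          (λ i _ → level-growth i)
          (λ i i≤ → ℕᵖ.≤-<-trans (ℕᵖ.≤-trans (level-growth i) (level≤S (s≤s i≤))) S<n)
          (λ i i≤ → ≤-trans (≤-reflexive (sym (ℕ→ℚ-precision (precision (level-bound i)))))
            (ℕ→ℚ-mono (ℕᵖ.≤-trans (level-precision i) (ℕᵖ.≤-trans (level≤S (s≤s i≤)) (ℕᵖ.<⇒≤ S<n)))))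
          (λ i _ → ε-reaches (K<level i)) (λ i _ → δd-reaches i) (λ i i≤ → level≤S (ℕᵖ.m≤n⇒m≤1+n i≤))
          (suc steps) 0 (ℕᵖ.+-identityʳ (suc steps)) P₀ equal₀ 0<q₀ (ℕᵖ.≤-trans k₀≤K (ℕᵖ.<⇒≤ (K<level 0)))
          (≤-trans (≤-reflexive (trans (cong (base +_) (*-zeroˡ unit)) (+-identityʳ base))) (proj₁ (inside P₀)))
          (id , λ v → refl)

    boundedOutcome : Outcome ε δ G P₀ S
    boundedOutcome = bySize (ℕᵖ.≤-<-connex n S)
      where
      byDensity : S ℕ.< n → ℕ→ℚ 4 * s ≤ δ ⊎ δ ≤ ℕ→ℚ 4 * s → Outcome ε δ G P₀ S
      byDensity S<n (inj₁ 4s≤δ) = nearlyComplete 4s≤δ S<n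
      byDensity S<n (inj₂ δ≤4s) = Refining.outcome δ≤4s S<n
      bySize : n ℕ.≤ S ⊎ S ℕ.< n → Outcome ε δ G P₀ S
      bySize (inj₁ n≤S) = discreteOutcome G P₀ hε (<⇒≤ 0<δ) n≤S
      bySize (inj₂ S<n) = byDensity S<n (≤-total (ℕ→ℚ 4 * s) δ)

  works : Works ε δ p S
  -- On no vertices the density is 0 by the convention of `frac`, which contradicts 0 < p.
  works zero G p≤d = ⊥-elim (<⇒≱ hp p≤d)
  works (suc n) G p≤d k₀ P₀ equi few = boundedOutcome G (s≤s z≤n) p≤d P₀ equi few

  order-bounded : Σ ℕ λ S → (S ≤twr[ inv ε hε ] (suc m)) × Works ε δ p S
  order-bounded = S , below-tower 0<K K≤inv (suc m) , works

-- A step gains δ² d n² / 96 inside a window of length 4 s d n², where s = (m + 1) δ² / 4096 bounds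
-- log₂ (1 / p); hence there are fewer than (m + 1) / 4 steps of two tower levels each, which leaves
-- half of the height for reaching 1 / (δ p).
theorem1p5 : Σ ℚ λ c → Σ (0ℚ < c) λ hc →
    ∀ (ε δ p : ℚ) (hε : 0ℚ < ε) → ε < 1ℚ → 0ℚ < δ → δ < 1ℚ →
    (hp : 0ℚ < p) → p < 1ℚ →
    ∀ (m : ℕ) →
    Log2> (inv p hp) (ℕ→ℚ m * (δ * δ) * inv c hc) →
    Log2≤ (inv p hp) (ℕ→ℚ (suc m) * (δ * δ) * inv c hc) →
    Σ ℕ λ S → (S ≤twr[ inv ε hε ] (suc m)) × Works ε δ p S
theorem1p5 = ℕ→ℚ 4096 , 0<ℕ {4096} (s≤s z≤n) , λ ε δ p hε ε<1 0<δ δ<1 hp p<1 m _ log →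
  Bound.order-bounded (ℕ→ℚ 4096) (0<ℕ {4096} (s≤s z≤n)) refl ε δ p hε ε<1 0<δ δ<1 hp p<1 m log
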